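{- Let $c(n)=m\mu(k)$ when $n=m^2k$ with $k$ squarefree. Then the series $\sum_{n=1}^\infty \frac{c(n)}{n}$ converges and \[\sum_{n=1}^\infty\frac{c(n)}{n}=\frac12.\]
   Context: $\mu$ is the Möbius function. Equivalently, $c(n)$ is defined by $\sum_{n\ge1}c(n)n^{ -s}=\zeta(2s-1)/\zeta(s)$ for $\operatorname{Re}(s)>1$. -}

module Defs where

open import Data.Nat as ℕ using (ℕ; zero; suc; _*_; _≤_)
open import Data.Nat.Divisibility using (_∣_; _∣?_)
open import Data.Nat.DivMod using (_/_)
open import Data.Integer as ℤ using (ℤ; +_; -_)
open import Data.Rational as ℚ using (ℚ)
open import Relation.Nullary using (yes; no)
open import Relation.Binary.PropositionalEquality using (_≡_)

-- Möbius function, computed by trial division.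
-- muAux fuel n e : processes n, trying the candidate divisor d = 2 + e.
-- The first candidate dividing n is its smallest prime factor p;
-- if p² ∣ n then μ = 0, otherwise μ(n) = - μ(n / p) (continuing with larger candidates).
-- Fuel n suffices since the candidate never exceeds the original n.
muAux : ℕ → ℕ → ℕ → ℤ
muAux zero    n e = + 1
muAux (suc f) zero e = + 0
muAux (suc f) (suc zero) e = + 1
muAux (suc f) n@(suc (suc _)) e with (2 ℕ.+ e) ∣? n
... | no _ = muAux f n (suc e)
... | yes _ with ((2 ℕ.+ e) * (2 ℕ.+ e)) ∣? n
...   | yes _ = + 0
...   | no _  = - muAux f (n / (2 ℕ.+ e)) (suc e)

μ : ℕ → ℤ
μ n = muAux n n 0

SquareFree : ℕ → Set
SquareFree k = ∀ d → d * d ∣ k → d ≡ 1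

partialSum : (ℕ → ℤ) → ℕ → ℚ
partialSum c zero    = ℚ.0ℚ
partialSum c (suc N) = partialSum c N ℚ.+ (c (suc N) ℚ./ suc N)

{-# OPTIONS --safe #-}
module Submission where

-- Write M(x) = Σ_{n≤x} μ(n), H(n) = Σ_{k≤n} 1/k and h(v) = H(⌊√v⌋) − H(⌊v⌋)/2. Since c is the Dirichlet
-- convolution of μ with the function m² ↦ m, and since Σ_{k≤x} μ(k)/k · H(x/k) = Σ_{k≤x} μ(k)⌊x/k⌋ = 1,
--   Σ_{n≤x} c(n)/n − 1/2 = Σ_{k≤x} μ(k)/k · h(x/k).
-- As h(v) = γ + O(v^(-1/2)), Axer's splitting at k = x/J² reduces the theorem to M(x) = o(x).
--
-- For M(x) = o(x) we follow Richter's elementary argument, arranged without logarithms. Let A(x) = M(x)/x.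
-- The Turán–Kubilius inequality and μ(pn) = −μ(n) give A(x) ≈ −avg A(x/p), where p runs over any finite set of
-- large primes with large Σ 1/p. Chebyshev's bounds, together with the divisibility of a binomial coefficient
-- by the primes of a short interval, show that on every scale there are two cells (G a, G (a+1)] and
-- (G b, G (b+1)] rich in primes whose ratio b/a is close to, but bounded away from, 1. Pairing the primes of
-- such cells over many scales gives A(x) ≈ A(xb/a) with arbitrarily small error; iterating, A(x) ≈ A(x/p) for
-- every p of a fixed set of primes. Hence A(x) ≈ −A(x), that is A(x) → 0.

-- The pair of popular cells found on a scale varies with the scale, whereas Turán-Kubilius needs
-- primes of large reciprocal sum that share one ratio b/a. On every scale the cell indices lie
-- below 32 Q, so only finitely many labels (a, b) occur. For fixed Q, the scale 2^g carries
-- reciprocal mass of order 1/g in a popular cell, and Σ 1/g diverges, so some label collects as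
-- much mass as desired. The delicate point is the order of choices. A shift from x to x b/a costs
-- O(1/Q), since a cell has relative width at most 1/Q. Reaching x from x/p takes O(W p) shifts when
-- b/a ≥ 1 + 1/W, so Q must be chosen after W and after the primes p. This is possible because
-- raising the parameter r multiplies Q, d and D by the same power of two: the bounds 1 + 1/W < b/a
-- < 1 + 1/E, with W = 2^17 E², stay put while the cells become finer. What remains is an error
-- O(1/E) from the last, incomplete shift.

open import Defs
open import Data.Integer as ℤ using (ℤ; 0ℤ; 1ℤ)
import Data.Integer.Properties as ℤ
open import Data.List using (List; []; _∷_; _++_; length; map; filter; take; zip; cartesianProduct)
open import Data.List.Membership.Propositional using (_∈_)
open import Data.List.Membership.Propositional.Properties using (∈-filter⁺; ∈-cartesianProduct⁺; ∈-++⁻)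
open import Data.List.Properties using (length-++; length-filter; length-map; length-take; filter-++; map-++)
open import Data.List.Relation.Unary.All as All using (All)
import Data.List.Relation.Unary.All.Properties as All
import Data.List.Relation.Unary.AllPairs as AllPairs
open import Data.List.Relation.Unary.Any using (here; there)
open import Data.List.Relation.Unary.Unique.Propositional using (Unique)
import Data.List.Relation.Unary.Unique.Propositional.Properties as Unique
open import Data.Maybe using (Maybe; just; nothing)
open import Data.Nat as ℕ using (ℕ; zero; suc; z≤n; s≤s)
import Data.Nat.Properties as ℕ
open import Data.Nat.Coprimality as Coprime using (Coprime; coprime-divisor; 1-coprimeTo)
open import Data.Nat.Divisibility
open import Data.Nat.DivMod using (_/_; _%_; m≡m%n+[m/n]*n; m%n<n; m/n*n≤m; m*n/n≡m; m/n≤m; m*[n/m]≡n)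
open import Data.Nat.GCD using (gcd; gcd[m,n]∣m; gcd[m,n]∣n; gcd-greatest)
open import Data.Nat.LCM using (lcm; m∣lcm[m,n]; n∣lcm[m,n]; lcm-least)
open import Data.Nat.ListAction using (product)
open import Data.Nat.Primality
open import Data.Nat.Primality.Factorisation using (factorise; module PrimeFactorisation)
import Data.Nat.Tactic.RingSolver as ℕ-Solver
open import Data.Product using (∃; ∃₂; _×_; _,_; proj₁; proj₂)
open import Data.Product.Properties using (≡-dec)
import Data.Rational as ℚ
import Data.Rational.Properties as ℚ
open import Data.Rational.Unnormalised as ℚᵘ using (mkℚᵘ; *≡*; *≤*)
import Data.Rational.Unnormalised.Properties as ℚᵘ
open import Data.Sum using (_⊎_; inj₁; inj₂; [_,_]′)
open import Data.Unit using (tt)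
open import Level using (0ℓ)
open import Relation.Binary.Definitions using (tri<; tri≈; tri>)
open import Relation.Binary.PropositionalEquality using (_≡_; _≢_; refl; sym; trans; cong; cong₂; subst; subst₂; module ≡-Reasoning)
open import Relation.Nullary using (¬_; Dec; yes; no; contradiction)
open import Relation.Nullary.Decidable using (_×-dec_; from-yes)
import Tactic.RingSolver as Solver
import Tactic.RingSolver.Core.AlmostCommutativeRing as ACR


-- Rational arithmetic: integers as rationals, reciprocals, inequalities by ring identities

module Rationals where
  open import Data.Rational public using (ℚ; 0ℚ; 1ℚ; ½; _+_; _*_; _-_; -_; ∣_∣; _≤_; _<_)
  open import Data.Rational using (mkℚ)
  open import Data.Rational.Properties
  open import Data.Integer using (+_)

  0≟_ : (q : ℚ) → Maybe (0ℚ ≡ q)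
  0≟ q with 0ℚ ≟ q
  ... | yes e = just e
  ... | no _ = nothing

  ring : ACR.AlmostCommutativeRing 0ℓ 0ℓ
  ring = ACR.fromCommutativeRing +-*-commutativeRing 0≟_

  2ℚ 3ℚ 4ℚ : ℚ
  2ℚ = 1ℚ + 1ℚ
  3ℚ = 1ℚ + 2ℚ
  4ℚ = 2ℚ + 2ℚ

  ≤-resp : ∀ {x y z w : ℚ} → x ≡ y → z ≡ w → x ≤ z → y ≤ w
  ≤-resp refl refl h = h

  0≤+ : ∀ {a b} → 0ℚ ≤ a → 0ℚ ≤ b → 0ℚ ≤ a + b
  0≤+ {a} {b} p q = subst (_≤ a + b) (+-identityˡ 0ℚ) (+-mono-≤ p q)

  0≤* : ∀ {a b} → 0ℚ ≤ a → 0ℚ ≤ b → 0ℚ ≤ a * b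
  0≤* {a} {b} p q = subst (_≤ a * b) (*-zeroʳ a) (*-monoˡ-≤-nonNeg a {{ℚ.nonNegative p}} q)

  diff : ∀ {a b} → a ≤ b → 0ℚ ≤ b - a
  diff {a} {b} h = subst (_≤ b - a) (+-inverseʳ a) (+-monoˡ-≤ (- a) h)

  undiff : ∀ {a b} → 0ℚ ≤ b - a → a ≤ b
  undiff {a} {b} h = ≤-resp (+-identityˡ a) (eq a b) (+-monoˡ-≤ a h)
    where
    eq : ∀ a b → b - a + a ≡ b
    eq a b = Solver.solve (a ∷ b ∷ []) ring

  -- The standard form of every nonlinear estimate below: `t` is a sum of products of nonnegative
  -- quantities, mostly gaps `diff h` of known inequalities, and the ring solver verifies the
  -- identity.
  by-diff : ∀ {a b t} → 0ℚ ≤ t → b - a ≡ t → a ≤ b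
  by-diff h e = undiff (subst (0ℚ ≤_) (sym e) h)

  0≤1 : 0ℚ ≤ 1ℚ
  0≤1 = nonNegative⁻¹ 1ℚ
  0<1 : 0ℚ < 1ℚ
  0<1 = positive⁻¹ 1ℚ
  0≤2 : 0ℚ ≤ 2ℚ
  0≤2 = nonNegative⁻¹ 2ℚ
  0≤½ : 0ℚ ≤ ½
  0≤½ = nonNegative⁻¹ ½

  square-nonneg : ∀ x → 0ℚ ≤ x * x
  square-nonneg x with ≤-total 0ℚ x
  ... | inj₁ h = 0≤* h h
  ... | inj₂ h = subst (0ℚ ≤_) (eq x) (0≤* (diff h) (diff h))
    where
    eq : ∀ x → (0ℚ - x) * (0ℚ - x) ≡ x * x
    eq x = Solver.solve (x ∷ []) ring

  *-cancel-≤ : ∀ {a b} r → 0ℚ < r → r * a ≤ r * b → a ≤ b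
  *-cancel-≤ r 0<r = *-cancelˡ-≤-pos r {{ℚ.positive 0<r}}

  abs≤ : ∀ {x b} → x ≤ b → - x ≤ b → ∣ x ∣ ≤ b
  abs≤ {x} h k with ∣p∣≡p∨∣p∣≡-p x
  ... | inj₁ e = subst (_≤ _) (sym e) h
  ... | inj₂ e = subst (_≤ _) (sym e) k

  ∣∣-*-≤ : ∀ {x y a b} → ∣ x ∣ ≤ a → ∣ y ∣ ≤ b → ∣ x * y ∣ ≤ a * b
  ∣∣-*-≤ {x} {y} {a} {b} h k = subst (_≤ a * b) (sym (∣p*q∣≡∣p∣*∣q∣ x y))
    (by-diff (0≤+ (0≤* (diff h) (0≤+ (0≤∣p∣ y) (diff k))) (0≤* (0≤∣p∣ x) (diff k))) (eq ∣ x ∣ ∣ y ∣ a b))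
    where
    eq : ∀ u v a b → a * b - u * v ≡ (a - u) * (v + (b - v)) + u * (b - v)
    eq u v a b = Solver.solve (u ∷ v ∷ a ∷ b ∷ []) ring

  opaque
    ι : ℤ → ℚ
    ι z = mkℚ z 0 (Coprime.sym (1-coprimeTo ℤ.∣ z ∣))

  ⟦_⟧ : ℕ → ℚ
  ⟦ n ⟧ = ι (+ n)

  opaque
    unfolding ι

    ι-+ : ∀ a b → ι (a ℤ.+ b) ≡ ι a + ι b
    ι-+ a b = toℚᵘ-injective (ℚᵘ.≃-trans (*≡* eq) (ℚᵘ.≃-sym (toℚᵘ-homo-+ (ι a) (ι b))))
      where
      eq : (a ℤ.+ b) ℤ.* (+ 1) ≡ (a ℤ.* (+ 1) ℤ.+ b ℤ.* (+ 1)) ℤ.* (+ 1)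
      eq = cong (ℤ._* + 1) (cong₂ ℤ._+_ (sym (ℤ.*-identityʳ a)) (sym (ℤ.*-identityʳ b)))

    ι-* : ∀ a b → ι (a ℤ.* b) ≡ ι a * ι b
    ι-* a b = toℚᵘ-injective (ℚᵘ.≃-trans (*≡* refl) (ℚᵘ.≃-sym (toℚᵘ-homo-* (ι a) (ι b))))

    ι-neg : ∀ a → ι (ℤ.- a) ≡ - ι a
    ι-neg a = toℚᵘ-injective (ℚᵘ.≃-trans (*≡* refl) (ℚᵘ.≃-sym (toℚᵘ-homo‿- (ι a))))

    ι0 : ι (+ 0) ≡ 0ℚ
    ι0 = refl

    ι1 : ι (+ 1) ≡ 1ℚ
    ι1 = refl

    ι-mono : ∀ {a b} → a ℤ.≤ b → ι a ≤ ι b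
    ι-mono {a} {b} h = toℚᵘ-cancel-≤ (*≤* (ℤ.*-monoʳ-≤-nonNeg (+ 1) h))

    ι-mono-< : ∀ {a b} → a ℤ.< b → ι a < ι b
    ι-mono-< {a} {b} h = toℚᵘ-cancel-< (ℚᵘ.*<* (ℤ.*-monoʳ-<-pos (+ 1) h))

    ι-cancel : ∀ {a b} → ι a ≤ ι b → a ℤ.≤ b
    ι-cancel {a} {b} h = ℤ.*-cancelʳ-≤-pos a b (+ 1) (drop-*≤* h)

  ⟦⟧-+ : ∀ m n → ⟦ m ℕ.+ n ⟧ ≡ ⟦ m ⟧ + ⟦ n ⟧
  ⟦⟧-+ m n = ι-+ (+ m) (+ n)

  ⟦⟧-* : ∀ m n → ⟦ m ℕ.* n ⟧ ≡ ⟦ m ⟧ * ⟦ n ⟧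
  ⟦⟧-* m n = trans (cong ι (ℤ.pos-* m n)) (ι-* (+ m) (+ n))

  ⟦⟧-mono : ∀ {m n} → m ℕ.≤ n → ⟦ m ⟧ ≤ ⟦ n ⟧
  ⟦⟧-mono h = ι-mono (ℤ.+≤+ h)

  ⟦⟧-cancel : ∀ {m n} → ⟦ m ⟧ ≤ ⟦ n ⟧ → m ℕ.≤ n
  ⟦⟧-cancel h = ℤ.drop‿+≤+ (ι-cancel h)

  ⟦⟧-suc : ∀ n → ⟦ suc n ⟧ ≡ 1ℚ + ⟦ n ⟧
  ⟦⟧-suc n = trans (⟦⟧-+ 1 n) (cong (_+ ⟦ n ⟧) ι1)

  0≤⟦⟧ : ∀ n → 0ℚ ≤ ⟦ n ⟧
  0≤⟦⟧ n = subst (_≤ ⟦ n ⟧) ι0 (⟦⟧-mono ℕ.z≤n)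

  1≤⟦⟧ : ∀ {n} → 1 ℕ.≤ n → 1ℚ ≤ ⟦ n ⟧
  1≤⟦⟧ {n} h = subst (_≤ ⟦ n ⟧) ι1 (⟦⟧-mono h)

  0<⟦⟧ : ∀ {n} → 1 ℕ.≤ n → 0ℚ < ⟦ n ⟧
  0<⟦⟧ {n} h = subst (_< ⟦ n ⟧) ι0 (ι-mono-< (ℤ.+<+ h))

  -- inv 0 = 0
  opaque
    inv : ℕ → ℚ
    inv zero = 0ℚ
    inv (suc n) = + 1 ℚ./ suc n

  opaque
    unfolding inv ι

    inv-inverse : ∀ {n} → 1 ℕ.≤ n → inv n * ⟦ n ⟧ ≡ 1ℚ
    inv-inverse {suc n} _ = toℚᵘ-injective
      (ℚᵘ.≃-trans (toℚᵘ-homo-* (+ 1 ℚ./ suc n) ⟦ suc n ⟧)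
      (ℚᵘ.≃-trans (ℚᵘ.*-congʳ {mkℚᵘ (+ suc n) 0} (toℚᵘ-fromℚᵘ (mkℚᵘ (+ 1) n)))
      (*≡* (cong +_ eq))))
      where
      eq : (suc n ℕ.+ 0) ℕ.* 1 ≡ suc (n ℕ.* 1 ℕ.+ 0)
      eq = trans (ℕ.*-identityʳ (suc n ℕ.+ 0)) (cong suc (cong (ℕ._+ 0) (sym (ℕ.*-identityʳ n))))

    /-as-inv : ∀ z n → z ℚ./ suc n ≡ ι z * inv (suc n)
    /-as-inv z n = toℚᵘ-injective
      (ℚᵘ.≃-trans (toℚᵘ-fromℚᵘ (mkℚᵘ z n))
      (ℚᵘ.≃-sym (ℚᵘ.≃-trans (toℚᵘ-homo-* (ι z) (inv (suc n)))
      (ℚᵘ.≃-trans (ℚᵘ.*-congˡ {mkℚᵘ z 0} (toℚᵘ-fromℚᵘ (mkℚᵘ (+ 1) n)))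
      (*≡* (cong₂ ℤ._*_ (ℤ.*-identityʳ z) (cong +_ (cong suc (sym (ℕ.+-identityʳ n))))))))))

    0≤inv : ∀ n → 0ℚ ≤ inv n
    0≤inv zero = ≤-refl
    0≤inv (suc n) = <⇒≤ (positive⁻¹ (+ 1 ℚ./ suc n) {{normalize-pos 1 (suc n)}})

  1/-unique : ∀ {n} x → 1 ℕ.≤ n → x * ⟦ n ⟧ ≡ 1ℚ → x ≡ inv n
  1/-unique {n} x h e = trans (eq₁ x (inv n) ⟦ n ⟧ (inv-inverse h)) (trans (cong (_* inv n) e) (*-identityˡ (inv n)))
    where
    eq₂ : ∀ x y z → x * (y * z) ≡ x * z * y
    eq₂ x y z = Solver.solve (x ∷ y ∷ z ∷ []) ring
    eq₁ : ∀ x y z → y * z ≡ 1ℚ → x ≡ x * z * y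
    eq₁ x y z e = trans (sym (*-identityʳ x)) (trans (cong (x *_) (sym e)) (eq₂ x y z))

  inv-1 : inv 1 ≡ 1ℚ
  inv-1 = sym (1/-unique 1ℚ (ℕ.s≤s ℕ.z≤n) (trans (*-identityˡ ⟦ 1 ⟧) ι1))

  inv-* : ∀ {m n} → 1 ℕ.≤ m → 1 ℕ.≤ n → inv (m ℕ.* n) ≡ inv m * inv n
  inv-* {m} {n} h k = sym (1/-unique (inv m * inv n) (ℕ.*-mono-≤ h k)
    (trans (cong (inv m * inv n *_) (⟦⟧-* m n)) (trans (eq (inv m) (inv n) ⟦ m ⟧ ⟦ n ⟧)
     (trans (cong₂ _*_ (inv-inverse h) (inv-inverse k)) (*-identityˡ 1ℚ)))))
    where
    eq : ∀ a b c d → a * b * (c * d) ≡ (a * c) * (b * d)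
    eq a b c d = Solver.solve (a ∷ b ∷ c ∷ d ∷ []) ring

  ≤inv* : ∀ {x y n} → 1 ℕ.≤ n → ⟦ n ⟧ * x ≤ y → x ≤ inv n * y
  ≤inv* {x} {y} {n} h k = subst (_≤ inv n * y) (trans (eq (inv n) ⟦ n ⟧ x) (trans (cong (_* x) (inv-inverse h)) (*-identityˡ x)))
    (by-diff (0≤* (0≤inv n) (diff k)) (eq′ (inv n) y (⟦ n ⟧ * x)))
    where
    eq : ∀ a b c → a * (b * c) ≡ a * b * c
    eq a b c = Solver.solve (a ∷ b ∷ c ∷ []) ring
    eq′ : ∀ a b c → a * b - a * c ≡ a * (b - c)
    eq′ a b c = Solver.solve (a ∷ b ∷ c ∷ []) ring

  inv*≤ : ∀ {x y n} → 1 ℕ.≤ n → y ≤ ⟦ n ⟧ * x → inv n * y ≤ x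
  inv*≤ {x} {y} {n} h k = subst (inv n * y ≤_) (trans (eq (inv n) ⟦ n ⟧ x) (trans (cong (_* x) (inv-inverse h)) (*-identityˡ x)))
    (by-diff (0≤* (0≤inv n) (diff k)) (eq′ (inv n) y (⟦ n ⟧ * x)))
    where
    eq : ∀ a b c → a * (b * c) ≡ a * b * c
    eq a b c = Solver.solve (a ∷ b ∷ c ∷ []) ring
    eq′ : ∀ a b c → a * c - a * b ≡ a * (c - b)
    eq′ a b c = Solver.solve (a ∷ b ∷ c ∷ []) ring

  inv-antitone : ∀ {m n} → 1 ℕ.≤ m → m ℕ.≤ n → inv n ≤ inv m
  inv-antitone {m} {n} h k = subst (_≤ inv m) (*-identityʳ (inv n)) (inv*≤ (ℕ.≤-trans h k)
    (subst (_≤ ⟦ n ⟧ * inv m) (inv-inverse h)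
      (by-diff (0≤* (0≤inv m) (diff (⟦⟧-mono k))) (eq ⟦ n ⟧ (inv m) ⟦ m ⟧))))
    where
    eq : ∀ a b c → a * b - b * c ≡ b * (a - c)
    eq a b c = Solver.solve (a ∷ b ∷ c ∷ []) ring

  -- The denominator of `ε` serves as `n`, because a positive fraction has numerator at least 1.
  archimedes : ∀ ε → 0ℚ < ε → ∃ λ n → 1 ℕ.≤ n × inv n ≤ ε
  archimedes ε 0<ε = suc d , ℕ.s≤s ℕ.z≤n , subst (inv (suc d) ≤_) eq
      (subst (_≤ ι (ℚ.↥ ε) * inv (suc d)) (*-identityˡ (inv (suc d)))
        (by-diff (0≤* (0≤inv (suc d)) (diff 1≤)) (eq′ (inv (suc d)) (ι (ℚ.↥ ε)))))
    where
    d = ℚ.ℚ.denominator-1 ε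
    eq : ι (ℚ.↥ ε) * inv (suc d) ≡ ε
    eq = trans (sym (/-as-inv (ℚ.↥ ε) d)) (↥p/↧p≡p ε)
    1≤ : 1ℚ ≤ ι (ℚ.↥ ε)
    1≤ = subst (_≤ ι (ℚ.↥ ε)) ι1 (ι-mono (pos ε (ℚ.positive 0<ε)))
      where
      pos : ∀ q → ℚ.Positive q → + 1 ℤ.≤ ℚ.↥ q
      pos (mkℚ (+ suc n) _ _) _ = ℤ.+≤+ (ℕ.s≤s ℕ.z≤n)
    eq′ : ∀ a b → b * a - 1ℚ * a ≡ a * (b - 1ℚ)
    eq′ a b = Solver.solve (a ∷ b ∷ []) ring

-- Finite sums over lists and over initial segments

module Sums where
  open import Data.Rational.Properties
  open Rationals

  ∑ : ∀ {A : Set} → List A → (A → ℚ) → ℚ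
  ∑ [] f = 0ℚ
  ∑ (x ∷ xs) f = f x + ∑ xs f

  module _ {A : Set} where

    ∑-cong : ∀ (xs : List A) {f g} → (∀ x → x ∈ xs → f x ≡ g x) → ∑ xs f ≡ ∑ xs g
    ∑-cong [] h = refl
    ∑-cong (x ∷ xs) h = cong₂ _+_ (h x (here refl)) (∑-cong xs (λ y p → h y (there p)))

    ∑-mono : ∀ (xs : List A) {f g} → (∀ x → x ∈ xs → f x ≤ g x) → ∑ xs f ≤ ∑ xs g
    ∑-mono [] h = ≤-refl
    ∑-mono (x ∷ xs) h = +-mono-≤ (h x (here refl)) (∑-mono xs (λ y p → h y (there p)))

    ∑-zero : ∀ (xs : List A) {f} → (∀ x → x ∈ xs → f x ≡ 0ℚ) → ∑ xs f ≡ 0ℚ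
    ∑-zero [] h = refl
    ∑-zero (x ∷ xs) h = trans (cong₂ _+_ (h x (here refl)) (∑-zero xs (λ y p → h y (there p)))) (+-identityʳ 0ℚ)

    ∑-nonneg : ∀ (xs : List A) {f} → (∀ x → x ∈ xs → 0ℚ ≤ f x) → 0ℚ ≤ ∑ xs f
    ∑-nonneg xs {f} h = subst (_≤ ∑ xs f) (∑-zero xs {λ _ → 0ℚ} (λ _ _ → refl)) (∑-mono xs h)

    ∑-+ : ∀ (xs : List A) f g → ∑ xs (λ x → f x + g x) ≡ ∑ xs f + ∑ xs g
    ∑-+ [] f g = sym (+-identityʳ 0ℚ)
    ∑-+ (x ∷ xs) f g = trans (cong (f x + g x +_) (∑-+ xs f g)) (eq (f x) (g x) (∑ xs f) (∑ xs g))
      where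
      eq : ∀ a b c d → a + b + (c + d) ≡ a + c + (b + d)
      eq a b c d = Solver.solve (a ∷ b ∷ c ∷ d ∷ []) ring

    ∑-* : ∀ (xs : List A) c f → ∑ xs (λ x → c * f x) ≡ c * ∑ xs f
    ∑-* [] c f = sym (*-zeroʳ c)
    ∑-* (x ∷ xs) c f = trans (cong (c * f x +_) (∑-* xs c f)) (sym (*-distribˡ-+ c (f x) (∑ xs f)))

    ∑-neg : ∀ (xs : List A) f → ∑ xs (λ x → - f x) ≡ - ∑ xs f
    ∑-neg [] f = refl
    ∑-neg (x ∷ xs) f = trans (cong (- f x +_) (∑-neg xs f)) (sym (neg-distrib-+ (f x) (∑ xs f)))

    ∑-- : ∀ (xs : List A) f g → ∑ xs (λ x → f x - g x) ≡ ∑ xs f - ∑ xs g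
    ∑-- xs f g = trans (∑-+ xs f (λ x → - g x)) (cong (∑ xs f +_) (∑-neg xs g))

    ∑-const : ∀ (xs : List A) c → ∑ xs (λ _ → c) ≡ ⟦ length xs ⟧ * c
    ∑-const [] c = sym (trans (cong (_* c) ι0) (*-zeroˡ c))
    ∑-const (x ∷ xs) c = trans (cong (c +_) (∑-const xs c)) (trans (eq c ⟦ length xs ⟧) (cong (_* c) (sym (⟦⟧-suc (length xs)))))
      where
      eq : ∀ c n → c + n * c ≡ (1ℚ + n) * c
      eq c n = Solver.solve (c ∷ n ∷ []) ring

    ∑-abs : ∀ (xs : List A) f → ∣ ∑ xs f ∣ ≤ ∑ xs (λ x → ∣ f x ∣)
    ∑-abs [] f = ≤-refl
    ∑-abs (x ∷ xs) f = ≤-trans (∣p+q∣≤∣p∣+∣q∣ (f x) (∑ xs f)) (+-monoʳ-≤ ∣ f x ∣ (∑-abs xs f))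

    ∑-abs-≤ : ∀ (xs : List A) {f g} → (∀ x → x ∈ xs → ∣ f x ∣ ≤ g x) → ∣ ∑ xs f ∣ ≤ ∑ xs g
    ∑-abs-≤ xs {f} h = ≤-trans (∑-abs xs f) (∑-mono xs h)

    ∑-++ : ∀ (xs ys : List A) f → ∑ (xs ++ ys) f ≡ ∑ xs f + ∑ ys f
    ∑-++ [] ys f = sym (+-identityˡ _)
    ∑-++ (x ∷ xs) ys f = trans (cong (f x +_) (∑-++ xs ys f)) (sym (+-assoc (f x) (∑ xs f) (∑ ys f)))

    ∑-map : ∀ {B : Set} (g : B → A) (xs : List B) f → ∑ (map g xs) f ≡ ∑ xs (λ x → f (g x))
    ∑-map g [] f = refl
    ∑-map g (x ∷ xs) f = cong (f (g x) +_) (∑-map g xs f)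

    ∑-term : ∀ (xs : List A) {f} → (∀ x → x ∈ xs → 0ℚ ≤ f x) → ∀ {y} → y ∈ xs → f y ≤ ∑ xs f
    ∑-term (x ∷ xs) {f} h (here refl) = subst (_≤ f x + ∑ xs f) (+-identityʳ (f x))
      (+-monoʳ-≤ (f x) (∑-nonneg xs (λ y p → h y (there p))))
    ∑-term (x ∷ xs) {f} h {y} (there p) = subst (_≤ f x + ∑ xs f) (+-identityˡ (f y))
      (+-mono-≤ (h x (here refl)) (∑-term xs (λ z q → h z (there q)) p))

    -- Pigeonhole by scanning: discarding an entry whose value is below `R` leaves a list whose
    -- average is still at least `R`.
    average : ∀ (xs : List A) {f} R → 1 ℕ.≤ length xs → ⟦ length xs ⟧ * R ≤ ∑ xs f → ∃ λ x → x ∈ xs × R ≤ f x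
    average [] R () h
    average (x ∷ xs) {f} R _ h = step (R ≤? f x) xs (subst (_≤ f x + ∑ xs f) (cong (_* R) (⟦⟧-suc (length xs))) h)
      where
      eq : ∀ f s n R → s - n * R ≡ (f + s - (1ℚ + n) * R) + (R - f)
      eq f s n R = Solver.solve (f ∷ s ∷ n ∷ R ∷ []) ring
      step : Dec (R ≤ f x) → ∀ xs → (1ℚ + ⟦ length xs ⟧) * R ≤ f x + ∑ xs f → ∃ λ y → y ∈ x ∷ xs × R ≤ f y
      step (yes p) xs k = x , here refl , p
      step (no ¬p) [] k = contradiction (≤-resp (trans (cong (λ t → (1ℚ + t) * R) ι0) (*-identityˡ R)) (+-identityʳ (f x)) k) ¬p
      step (no ¬p) (y ∷ ys) k =
        let z , q , r = average (y ∷ ys) {f} R (ℕ.s≤s ℕ.z≤n)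
                          (by-diff (0≤+ (diff k) (diff (<⇒≤ (≰⇒> ¬p)))) (eq (f x) (∑ (y ∷ ys) f) ⟦ suc (length ys) ⟧ R))
        in z , there q , r

  ∑-swap : ∀ {A B : Set} (xs : List A) (ys : List B) (f : A → B → ℚ) → ∑ xs (λ x → ∑ ys (f x)) ≡ ∑ ys (λ y → ∑ xs (λ x → f x y))
  ∑-swap [] ys f = sym (∑-zero ys {λ _ → 0ℚ} (λ _ _ → refl))
  ∑-swap (x ∷ xs) ys f = trans (cong (∑ ys (f x) +_) (∑-swap xs ys f)) (sym (∑-+ ys (f x) (λ y → ∑ xs (λ x → f x y))))

  -- Descending, so that a sum up to `suc n` unfolds by definition into its last term and the sum up
  -- to `n`.
  [1…_] : ℕ → List ℕ
  [1… zero ] = []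
  [1… suc n ] = suc n ∷ [1… n ]

  ∈[1…]⁻ : ∀ {k} n → k ∈ [1… n ] → 1 ℕ.≤ k × k ℕ.≤ n
  ∈[1…]⁻ (suc n) (here refl) = ℕ.s≤s ℕ.z≤n , ℕ.≤-refl
  ∈[1…]⁻ (suc n) (there p) with ∈[1…]⁻ n p
  ... | a , b = a , ℕ.m≤n⇒m≤1+n b

  ∈[1…]⁺ : ∀ {k} n → 1 ℕ.≤ k → k ℕ.≤ n → k ∈ [1… n ]
  ∈[1…]⁺ zero 1≤k k≤n = contradiction (ℕ.≤-trans 1≤k k≤n) λ ()
  ∈[1…]⁺ {k} (suc n) 1≤k k≤n with k ℕ.≟ suc n
  ... | yes refl = here refl
  ... | no k≢ = there (∈[1…]⁺ n 1≤k (ℕ.≤-pred (ℕ.≤∧≢⇒< k≤n k≢)))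

  length-[1…] : ∀ n → length [1… n ] ≡ n
  length-[1…] zero = refl
  length-[1…] (suc n) = cong suc (length-[1…] n)

  ∑-split : ∀ m n f → ∑ [1… m ℕ.+ n ] f ≡ ∑ [1… m ] f + ∑ [1… n ] (λ k → f (m ℕ.+ k))
  ∑-split m zero f = trans (cong (λ t → ∑ [1… t ] f) (ℕ.+-identityʳ m)) (sym (+-identityʳ _))
  ∑-split m (suc n) f rewrite ℕ.+-suc m n = trans (cong (f (suc (m ℕ.+ n)) +_) (∑-split m n f)) (eq (f (suc (m ℕ.+ n))) (∑ [1… m ] f) (∑ [1… n ] (λ k → f (m ℕ.+ k))))
    where
    eq : ∀ a b c → a + (b + c) ≡ b + (a + c)
    eq a b c = Solver.solve (a ∷ b ∷ c ∷ []) ring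

  𝟙 : ∀ {P : Set} → Dec P → ℚ
  𝟙 (yes _) = 1ℚ
  𝟙 (no _) = 0ℚ

  𝟙-yes : ∀ {P : Set} (d : Dec P) → P → 𝟙 d ≡ 1ℚ
  𝟙-yes (yes _) _ = refl
  𝟙-yes (no ¬p) p = contradiction p ¬p

  𝟙-no : ∀ {P : Set} (d : Dec P) → ¬ P → 𝟙 d ≡ 0ℚ
  𝟙-no (yes p) ¬p = contradiction p ¬p
  𝟙-no (no _) _ = refl

  𝟙-cong : ∀ {P Q : Set} (d : Dec P) (e : Dec Q) → (P → Q) → (Q → P) → 𝟙 d ≡ 𝟙 e
  𝟙-cong (yes p) e f g = sym (𝟙-yes e (f p))
  𝟙-cong (no ¬p) e f g = sym (𝟙-no e (λ q → ¬p (g q)))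

  0≤𝟙 : ∀ {P : Set} (d : Dec P) → 0ℚ ≤ 𝟙 d
  0≤𝟙 (yes _) = 0≤1
  0≤𝟙 (no _) = ≤-refl

  𝟙≤1 : ∀ {P : Set} (d : Dec P) → 𝟙 d ≤ 1ℚ
  𝟙≤1 (yes _) = ≤-refl
  𝟙≤1 (no _) = 0≤1

  ∑-extend : ∀ {m n} f → m ℕ.≤ n → (∀ k → m ℕ.< k → k ℕ.≤ n → f k ≡ 0ℚ) → ∑ [1… n ] f ≡ ∑ [1… m ] f
  ∑-extend {m} {n} f m≤n h = subst (λ t → ∑ [1… t ] f ≡ ∑ [1… m ] f) (ℕ.m+[n∸m]≡n m≤n)
    (trans (∑-split m (n ℕ.∸ m) f) (trans (cong (∑ [1… m ] f +_) (∑-zero [1… n ℕ.∸ m ] (λ k p → zz k (∈[1…]⁻ (n ℕ.∸ m) p)))) (+-identityʳ _)))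
    where
    zz : ∀ k → 1 ℕ.≤ k × k ℕ.≤ n ℕ.∸ m → f (m ℕ.+ k) ≡ 0ℚ
    zz k (a , b) = h (m ℕ.+ k) (ℕ.m<m+n m a) (subst (m ℕ.+ k ℕ.≤_) (ℕ.m+[n∸m]≡n m≤n) (ℕ.+-monoʳ-≤ m b))

  ∑-range-mono : ∀ {m n} f → m ℕ.≤ n → (∀ k → 1 ℕ.≤ k → k ℕ.≤ n → 0ℚ ≤ f k) → ∑ [1… m ] f ≤ ∑ [1… n ] f
  ∑-range-mono {m} {n} f m≤n h = subst (λ t → ∑ [1… m ] f ≤ ∑ [1… t ] f) (ℕ.m+[n∸m]≡n m≤n)
    (≤-resp (+-identityʳ _) (sym (∑-split m (n ℕ.∸ m) f))
      (+-monoʳ-≤ (∑ [1… m ] f) (∑-nonneg [1… n ℕ.∸ m ] (λ k p → zz k (∈[1…]⁻ (n ℕ.∸ m) p)))))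
    where
    zz : ∀ k → 1 ℕ.≤ k × k ℕ.≤ n ℕ.∸ m → 0ℚ ≤ f (m ℕ.+ k)
    zz k (a , b) = h (m ℕ.+ k) (ℕ.≤-trans a (ℕ.m≤n+m k m)) (subst (m ℕ.+ k ℕ.≤_) (ℕ.m+[n∸m]≡n m≤n) (ℕ.+-monoʳ-≤ m b))

-- Floor quotients, multiples and prime divisors

module Division where
  open Rationals
  open Sums

  -- n ÷ 0 = 0
  _÷_ : ℕ → ℕ → ℕ
  n ÷ zero = 0
  n ÷ suc k = n / suc k
  infixl 7 _÷_

  ÷-*≤ : ∀ n k → n ÷ k ℕ.* k ℕ.≤ n
  ÷-*≤ n zero = z≤n
  ÷-*≤ n (suc k) = m/n*n≤m n (suc k)

  <÷-* : ∀ n {k} → 1 ℕ.≤ k → n ℕ.< suc (n ÷ k) ℕ.* k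
  <÷-* n {suc k} _ = subst (ℕ._< suc (n / suc k) ℕ.* suc k) (sym (m≡m%n+[m/n]*n n (suc k)))
    (ℕ.+-monoˡ-< (n / suc k ℕ.* suc k) (m%n<n n (suc k)))

  *≤⇒≤÷ : ∀ {m n k} → 1 ℕ.≤ k → m ℕ.* k ℕ.≤ n → m ℕ.≤ n ÷ k
  *≤⇒≤÷ {m} {n} {k} h le = ℕ.≤-pred (ℕ.*-cancelʳ-< k m (suc (n ÷ k)) (ℕ.≤-<-trans le (<÷-* n h)))

  ≤÷⇒*≤ : ∀ {m n} k → m ℕ.≤ n ÷ k → m ℕ.* k ℕ.≤ n
  ≤÷⇒*≤ {m} {n} k h = ℕ.≤-trans (ℕ.*-monoˡ-≤ k h) (÷-*≤ n k)

  ÷≤ : ∀ n k → n ÷ k ℕ.≤ n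
  ÷≤ n zero = z≤n
  ÷≤ n (suc k) = m/n≤m n (suc k)

  *÷ : ∀ m {k} → 1 ℕ.≤ k → (m ℕ.* k) ÷ k ≡ m
  *÷ m {suc k} _ = m*n/n≡m m (suc k)

  ÷≤ℚ : ∀ n {k} → 1 ℕ.≤ k → ⟦ n ÷ k ⟧ ≤ inv k * ⟦ n ⟧
  ÷≤ℚ n {k} h = ≤inv* h (subst (_≤ ⟦ n ⟧) (trans (⟦⟧-* (n ÷ k) k) (ℚ.*-comm ⟦ n ÷ k ⟧ ⟦ k ⟧)) (⟦⟧-mono (÷-*≤ n k)))

  ≤÷+1ℚ : ∀ n {k} → 1 ℕ.≤ k → inv k * ⟦ n ⟧ ≤ 1ℚ + ⟦ n ÷ k ⟧
  ≤÷+1ℚ n {k} h = inv*≤ h (subst (⟦ n ⟧ ≤_) (trans (⟦⟧-* (suc (n ÷ k)) k) (trans (ℚ.*-comm ⟦ suc (n ÷ k) ⟧ ⟦ k ⟧) (cong (⟦ k ⟧ *_) (⟦⟧-suc (n ÷ k)))))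
    (⟦⟧-mono (ℕ.<⇒≤ (<÷-* n h))))

  ∣⇒≤′ : ∀ {m n} → 1 ℕ.≤ n → m ∣ n → m ℕ.≤ n
  ∣⇒≤′ {n = suc n} _ h = ∣⇒≤ h

  -- Write `X` as remainder plus quotient times `p`. The topmost terms, as many as the remainder,
  -- contain no multiple of `p`; below them every block of length `p` contains one, at its upper
  -- end.
  ∑-multiples : ∀ X {p} (f : ℕ → ℚ) → 1 ℕ.≤ p → ∑ [1… X ] (λ n → 𝟙 (p ∣? n) * f n) ≡ ∑ [1… X ÷ p ] (λ m → f (p ℕ.* m))
  ∑-multiples X {suc p} f _ = trans (cong (λ t → ∑ [1… t ] g) (m≡m%n+[m/n]*n X (suc p)))
      (trans (residual (X % suc p) (X / suc p) (m%n<n X (suc p))) (exact (X / suc p)))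
    where
    g : ℕ → ℚ
    g n = 𝟙 (suc p ∣? n) * f n
    residual : ∀ r q → r ℕ.< suc p → ∑ [1… r ℕ.+ q ℕ.* suc p ] g ≡ ∑ [1… q ℕ.* suc p ] g
    residual zero q _ = refl
    residual (suc r) q r<p = trans (cong₂ _+_ head (residual r q (ℕ.<-trans (ℕ.n<1+n r) r<p))) (ℚ.+-identityˡ _)
      where
      head : g (suc (r ℕ.+ q ℕ.* suc p)) ≡ 0ℚ
      head = trans (cong (_* f (suc (r ℕ.+ q ℕ.* suc p)))
        (𝟙-no (suc p ∣? suc (r ℕ.+ q ℕ.* suc p)) λ d → ℕ.<⇒≱ r<p
          (∣⇒≤ (∣m+n∣m⇒∣n (subst (suc p ∣_) (ℕ.+-comm (suc r) (q ℕ.* suc p)) d) (n∣m*n q)))))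
        (ℚ.*-zeroˡ (f (suc (r ℕ.+ q ℕ.* suc p))))
    exact : ∀ q → ∑ [1… q ℕ.* suc p ] g ≡ ∑ [1… q ] (λ m → f (suc p ℕ.* m))
    exact zero = refl
    exact (suc q) = cong₂ _+_
      (trans (cong (_* f (suc (p ℕ.+ q ℕ.* suc p))) (𝟙-yes (suc p ∣? (suc q ℕ.* suc p)) (n∣m*n (suc q))))
        (trans (ℚ.*-identityˡ (f (suc q ℕ.* suc p))) (cong f (ℕ.*-comm (suc q) (suc p)))))
      (trans (residual p q (ℕ.n<1+n p)) (exact q))

  count-multiples : ∀ X {p} → 1 ℕ.≤ p → ∑ [1… X ] (λ n → 𝟙 (p ∣? n)) ≡ ⟦ X ÷ p ⟧
  count-multiples X {p} h = trans (∑-cong [1… X ] (λ n _ → sym (ℚ.*-identityʳ (𝟙 (p ∣? n)))))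
    (trans (∑-multiples X (λ _ → 1ℚ) h)
    (trans (∑-const [1… X ÷ p ] 1ℚ) (trans (ℚ.*-identityʳ _) (cong ⟦_⟧ (length-[1…] (X ÷ p))))))

  prime≥2 : ∀ {p} → Prime p → 2 ℕ.≤ p
  prime≥2 {p} pr = ℕ.nonTrivial⇒n>1 p {{prime⇒nonTrivial pr}}

  prime≥1 : ∀ {p} → Prime p → 1 ℕ.≤ p
  prime≥1 pr = ℕ.<⇒≤ (prime≥2 pr)

  prime∣prime : ∀ {p q} → Prime p → Prime q → p ∣ q → p ≡ q
  prime∣prime pr qr h with prime⇒irreducible qr h
  ... | inj₁ refl = contradiction (prime≥2 pr) λ { (s≤s ()) }
  ... | inj₂ e = e

  prime-cancel : ∀ {p q n} → Prime p → Prime q → p ≢ q → p ∣ q ℕ.* n → p ∣ n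
  prime-cancel {p} {q} {n} pr qr p≢q h with euclidsLemma q n pr h
  ... | inj₁ k = contradiction (prime∣prime pr qr k) p≢q
  ... | inj₂ k = k

  prime²-cancel : ∀ {p q n} → Prime p → Prime q → p ≢ q → p ℕ.* p ∣ q ℕ.* n → p ℕ.* p ∣ n
  prime²-cancel {p} {q} {n} pr qr p≢q h with prime-cancel {n = n} pr qr p≢q (m*n∣⇒m∣ p p h)
  ... | divides k refl = subst (p ℕ.* p ∣_) (ℕ.*-comm p k) (*-monoʳ-∣ p
        (prime-cancel {n = k} pr qr p≢q (*-cancelˡ-∣ p {{prime⇒nonZero pr}} (subst (p ℕ.* p ∣_) e h))))
    where
    e : q ℕ.* (k ℕ.* p) ≡ p ℕ.* (q ℕ.* k)
    e = trans (sym (ℕ.*-assoc q k p)) (ℕ.*-comm (q ℕ.* k) p)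

  prime-divisor : ∀ n → 2 ℕ.≤ n → ∃ λ p → Prime p × p ∣ n
  prime-divisor n@(suc (suc _)) _ = go factors isFactorisation factorsPrime
    where
    open PrimeFactorisation (factorise n)
    go : ∀ ps → n ≡ product ps → All Prime ps → ∃ λ p → Prime p × p ∣ n
    go [] () _
    go (p ∷ ps) e (pr All.∷ _) = p , pr , subst (p ∣_) (sym e) (m∣m*n (product ps))
  prime-divisor (suc zero) (s≤s ())

-- The Möbius function

module Moebius where
  open Rationals
  open Sums
  open Division

  -- Trial division removes the smallest prime first. As a relation, the value of μ may be derived
  -- by removing primes in any order, and uniqueness of the value then yields the behaviour of μ at
  -- every prime.
  data IsMu : ℕ → ℤ → Set where
    one    : IsMu 1 1ℤ
    square : ∀ {n p} → Prime p → p ℕ.* p ∣ n → IsMu n 0ℤ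
    factor   : ∀ {n p v} → Prime p → ¬ p ∣ n → IsMu n v → IsMu (p ℕ.* n) (ℤ.- v)

  prime∤1 : ∀ {p} → Prime p → ¬ p ∣ 1
  prime∤1 pr h = ℕ.<⇒≱ (prime≥2 pr) (∣⇒≤ h)

  -- Induction on the derivation: a prime `q ≠ p` removed before `p` can be removed after it, since
  -- the two steps commute; in the `square` case the square of `q` survives in `n`.
  strip : ∀ {m n p v} → IsMu m v → m ≡ p ℕ.* n → Prime p → ¬ p ∣ n → ∃ λ w → v ≡ ℤ.- w × IsMu n w
  strip {n = n} {p} one e pr _ = contradiction (subst (p ∣_) (sym e) (m∣m*n n)) (prime∤1 pr)
  strip {m} {n} {p} (square {p = q} qr h) e pr p∤n = 0ℤ , refl , square qr
      (prime²-cancel qr pr q≢p (subst (q ℕ.* q ∣_) e h))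
    where
    q≢p : q ≢ p
    q≢p refl = p∤n (*-cancelˡ-∣ p {{prime⇒nonZero pr}} (subst (p ℕ.* p ∣_) e h))
  strip {n = n} {p} (factor {n = m′} {p = q} {v = v} qr q∤m d) e pr p∤n with q ℕ.≟ p
  ... | yes refl = v , refl , subst (λ t → IsMu t v) (ℕ.*-cancelˡ-≡ m′ n p {{prime⇒nonZero pr}} e) d
  ... | no q≢p with prime-cancel {n = m′} pr qr (λ r → q≢p (sym r)) (subst (p ∣_) (sym e) (m∣m*n n))
  ... | divides k refl = result (strip d (ℕ.*-comm k p) pr (λ h → p∤n (subst (p ∣_) (sym n≡) (∣n⇒∣m*n q h))))
    where
    n≡ : n ≡ q ℕ.* k
    n≡ = ℕ.*-cancelˡ-≡ n (q ℕ.* k) p {{prime⇒nonZero pr}}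
      (trans (sym e) (trans (sym (ℕ.*-assoc q k p)) (ℕ.*-comm (q ℕ.* k) p)))
    result : (∃ λ w → v ≡ ℤ.- w × IsMu k w) → ∃ λ w → ℤ.- v ≡ ℤ.- w × IsMu n w
    result (w , refl , d′) = ℤ.- w , refl ,
      subst (λ t → IsMu t (ℤ.- w)) (sym n≡) (factor qr (λ h → q∤m (∣m⇒∣m*n p h)) d′)

  IsMu-square : ∀ {n v p} → IsMu n v → Prime p → p ℕ.* p ∣ n → v ≡ 0ℤ
  IsMu-square {p = p} one pr h = contradiction (m*n∣⇒m∣ p p h) (prime∤1 pr)
  IsMu-square (square _ _) _ _ = refl
  IsMu-square {p = p} (factor {n = m} {p = q} {v = v} qr q∤m d) pr h = cong ℤ.-_ (IsMu-square d pr (prime²-cancel pr qr p≢q h))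
    where
    p≢q : p ≢ q
    p≢q refl = q∤m (*-cancelˡ-∣ q {{prime⇒nonZero qr}} h)

  -- `strip` rearranges the second derivation so that it begins with the prime of the first; the
  -- induction continues with the cofactor.
  IsMu-unique : ∀ {n v w} → IsMu n v → IsMu n w → v ≡ w
  IsMu-unique (square pr h) d = sym (IsMu-square d pr h)
  IsMu-unique (factor {n = n} {p = p} pr p∤n d) d′ with strip d′ refl pr p∤n
  ... | w , refl , d″ = cong ℤ.-_ (IsMu-unique d d″)
  IsMu-unique one d′ = unit d′ refl
    where
    unit : ∀ {m w} → IsMu m w → m ≡ 1 → 1ℤ ≡ w
    unit one _ = refl
    unit (square {p = p} pr h) refl = contradiction (m*n∣⇒m∣ p p h) (prime∤1 pr)
    unit (factor {n = n} {p = p} pr _ _) e = contradiction (subst (p ∣_) e (m∣m*n n)) (prime∤1 pr)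

  -- Two invariants. Nontrivial divisors of `n` are at least the candidate `2 + e`, so a candidate
  -- that divides is prime. And `n ≤ f + suc e` says that when the fuel is exhausted the candidate
  -- exceeds `n`, which leaves only `n ≡ 1`.
  muAux-IsMu : ∀ f n e → 1 ℕ.≤ n → n ℕ.≤ f ℕ.+ suc e → (2 ℕ.+ e) Rough n → IsMu n (muAux f n e)
  muAux-IsMu zero (suc zero) e _ _ _ = one
  muAux-IsMu zero (suc (suc n)) e _ n≤ r = contradiction (rough⇒≤ r) (ℕ.<⇒≱ (s≤s n≤))
  muAux-IsMu (suc f) (suc zero) e _ _ _ = one
  muAux-IsMu (suc f) n@(suc (suc n′)) e 1≤n n≤ r with (2 ℕ.+ e) ∣? n
  ... | no d∤n = muAux-IsMu f n (suc e) 1≤n (subst (n ℕ.≤_) (sym (ℕ.+-suc f (suc e))) n≤) (∤⇒rough-suc d∤n r)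
  ... | yes d∣n with ((2 ℕ.+ e) ℕ.* (2 ℕ.+ e)) ∣? n
  ...   | yes dd∣n = square (rough∧∣⇒prime r d∣n) dd∣n
  ...   | no dd∤n = subst (λ t → IsMu t (ℤ.- muAux f (n / (2 ℕ.+ e)) (suc e))) n≡ (factor (rough∧∣⇒prime r d∣n) d∤q
            (muAux-IsMu f q (suc e) 1≤q (ℕ.≤-trans (m/n≤m n d) (subst (n ℕ.≤_) (sym (ℕ.+-suc f (suc e))) n≤))
              (∤⇒rough-suc d∤q (rough∧∣⇒rough r (divides d (sym n≡))))))
    where
    d = 2 ℕ.+ e
    q = n / d
    n≡ : d ℕ.* q ≡ n
    n≡ = m*[n/m]≡n d∣n
    d∤q : ¬ d ∣ q
    d∤q h = dd∤n (subst (d ℕ.* d ∣_) n≡ (*-monoʳ-∣ d h))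
    1≤q : 1 ℕ.≤ q
    1≤q = ℕ.n≢0⇒n>0 λ e → contradiction (trans (sym n≡) (trans (cong (d ℕ.*_) e) (ℕ.*-zeroʳ d))) λ ()

  μ-IsMu : ∀ {n} → 1 ℕ.≤ n → IsMu n (μ n)
  μ-IsMu {n} h = muAux-IsMu n n 0 h (ℕ.m≤m+n n 1) (λ { (hasNonTrivialDivisor {divisor = suc (suc _)} (s≤s (s≤s ())) _) })

  μ-prime-* : ∀ {p n} → Prime p → 1 ℕ.≤ n → ¬ p ∣ n → μ (p ℕ.* n) ≡ ℤ.- μ n
  μ-prime-* {p} {n} pr h p∤n = IsMu-unique (μ-IsMu (ℕ.*-mono-≤ (prime≥1 pr) h)) (factor pr p∤n (μ-IsMu h))

  μ-square : ∀ {p n} → Prime p → 1 ℕ.≤ n → p ℕ.* p ∣ n → μ n ≡ 0ℤ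
  μ-square pr h d = IsMu-square (μ-IsMu h) pr d

  μℚ : ℕ → ℚ
  μℚ n = ι (μ n)

  ∣μ∣≤1 : ∀ {n} → 1 ℕ.≤ n → ∣ μℚ n ∣ ≤ 1ℚ
  ∣μ∣≤1 h = bound (μ-IsMu h)
    where
    bound : ∀ {n v} → IsMu n v → ∣ ι v ∣ ≤ 1ℚ
    bound one = ℚ.≤-reflexive (cong ∣_∣ ι1)
    bound (square _ _) = ≤-resp (sym (cong ∣_∣ ι0)) refl 0≤1
    bound (factor {v = v} _ _ d) = subst (_≤ 1ℚ) (sym (trans (cong ∣_∣ (ι-neg v)) (ℚ.∣-p∣≡∣p∣ (ι v)))) (bound d)

  -- For a prime p dividing n, the divisors d and p * d with p ∤ d cancel each other.
  ∑-divisors-μ : ∀ {n} → 2 ℕ.≤ n → ∑ [1… n ] (λ d → 𝟙 (d ∣? n) * μℚ d) ≡ 0ℚ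
  ∑-divisors-μ {n} 2≤n = trans (∑-cong [1… n ] (λ d _ → split (𝟙 (p ∣? d)) (𝟙 (d ∣? n) * μℚ d)))
      (trans (∑-+ [1… n ] g (λ d → 𝟙 (p ∣? d) * (𝟙 (d ∣? n) * μℚ d)))
      (trans (cong (∑ [1… n ] g +_) (trans (∑-multiples n (λ d → 𝟙 (d ∣? n) * μℚ d) (prime≥1 pr))
         (trans (∑-cong [1… n ÷ p ] (λ m q → shifted m (proj₁ (∈[1…]⁻ (n ÷ p) q))))
         (trans (∑-neg [1… n ÷ p ] g) (cong -_ (sym (∑-extend g (÷≤ n p) beyond)))))))
       (ℚ.+-inverseʳ (∑ [1… n ] g))))
    where
    p = proj₁ (prime-divisor n 2≤n)
    pr = proj₁ (proj₂ (prime-divisor n 2≤n))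
    p∣n = proj₂ (proj₂ (prime-divisor n 2≤n))
    1≤n : 1 ℕ.≤ n
    1≤n = ℕ.<⇒≤ 2≤n
    g : ℕ → ℚ
    g d = (1ℚ - 𝟙 (p ∣? d)) * (𝟙 (d ∣? n) * μℚ d)
    split : ∀ a b → b ≡ (1ℚ - a) * b + a * b
    split a b = Solver.solve (a ∷ b ∷ []) ring
    coprime : ∀ {m} → ¬ p ∣ m → m ∣ n → p ℕ.* m ∣ n
    coprime {m} p∤m (divides k e) with euclidsLemma k m pr (subst (p ∣_) e p∣n)
    ... | inj₂ h = contradiction h p∤m
    ... | inj₁ h = subst (p ℕ.* m ∣_) (sym e) (*-monoˡ-∣ m h)
    zeroˡ : ∀ a → (1ℚ - 1ℚ) * a ≡ 0ℚ
    zeroˡ a = Solver.solve (a ∷ []) ring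
    oneˡ : ∀ a b → a * (- b) ≡ - ((1ℚ - 0ℚ) * (a * b))
    oneˡ a b = Solver.solve (a ∷ b ∷ []) ring
    shifted : ∀ m → 1 ℕ.≤ m → 𝟙 (p ℕ.* m ∣? n) * μℚ (p ℕ.* m) ≡ - g m
    shifted m 1≤m with p ∣? m
    ... | yes p∣m = trans (cong (λ t → 𝟙 (p ℕ.* m ∣? n) * t) (trans (cong ι (μ-square pr (ℕ.*-mono-≤ (prime≥1 pr) 1≤m) (*-monoʳ-∣ p p∣m))) ι0))
      (trans (ℚ.*-zeroʳ (𝟙 (p ℕ.* m ∣? n))) (cong -_ (sym (zeroˡ (𝟙 (m ∣? n) * μℚ m)))))
    ... | no p∤m = trans (cong₂ _*_ (𝟙-cong (p ℕ.* m ∣? n) (m ∣? n) (m*n∣⇒n∣ p m) (coprime p∤m))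
                     (trans (cong ι (μ-prime-* pr 1≤m p∤m)) (ι-neg (μ m)))) (oneˡ (𝟙 (m ∣? n)) (μℚ m))
    beyond : ∀ m → n ÷ p ℕ.< m → m ℕ.≤ n → g m ≡ 0ℚ
    beyond m big m≤n with p ∣? m
    ... | yes _ = zeroˡ (𝟙 (m ∣? n) * μℚ m)
    ... | no p∤m = trans (cong (λ t → (1ℚ - 0ℚ) * (t * μℚ m)) (𝟙-no (m ∣? n) λ m∣n → ℕ.<⇒≱ big
          (*≤⇒≤÷ (prime≥1 pr) (subst (ℕ._≤ n) (ℕ.*-comm p m) (∣⇒≤′ 1≤n (coprime p∤m m∣n))))))
        (trans (cong ((1ℚ - 0ℚ) *_) (ℚ.*-zeroˡ (μℚ m))) (ℚ.*-zeroʳ (1ℚ - 0ℚ)))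

  squarefree⊎square : ∀ {k} → 1 ℕ.≤ k → SquareFree k ⊎ ∃ λ d → 2 ℕ.≤ d × d ℕ.* d ∣ k
  squarefree⊎square {k} 1≤k with ℕ.anyUpTo? (λ d → (2 ℕ.+ d) ℕ.* (2 ℕ.+ d) ∣? k) k
  ... | yes (d , _ , h) = inj₂ (2 ℕ.+ d , s≤s (s≤s z≤n) , h)
  ... | no none = inj₁ sf
    where
    sf : SquareFree k
    sf zero h = contradiction (0∣⇒≡0 h) (ℕ.>⇒≢ 1≤k)
    sf (suc zero) h = refl
    sf (suc (suc d)) h = contradiction (d , ℕ.≤-trans (ℕ.n≤1+n _) (ℕ.≤-trans (ℕ.m≤m*n (2 ℕ.+ d) (2 ℕ.+ d)) (∣⇒≤′ 1≤k h)) , h) none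

  μ-square-divisor : ∀ {k d} → 1 ℕ.≤ k → 2 ℕ.≤ d → d ℕ.* d ∣ k → μ k ≡ 0ℤ
  μ-square-divisor {k} {d} 1≤k 2≤d dd with prime-divisor d 2≤d
  ... | p , pr , p∣d = μ-square pr 1≤k (∣-trans (*-pres-∣ p∣d p∣d) dd)

-- Binomial coefficients: size and prime divisors

module Binomials where
  open import Data.Nat
  open import Data.Nat.Properties
  open import Data.Nat.Tactic.RingSolver using (solve-∀)
  open import Data.List.Relation.Unary.All using ([]; _∷_)
  open import Data.List.Relation.Unary.AllPairs using ([]; _∷_)
  open Division using (prime≥2; prime≥1; prime-cancel; prime-divisor)

  -- The binomial coefficient (j + h choose h).
  binom : ℕ → ℕ → ℕ
  binom zero h = 1
  binom (suc j) zero = 1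
  binom (suc j) (suc h) = binom j (suc h) + binom (suc j) h

  binom-zeroʳ : ∀ j → binom j 0 ≡ 1
  binom-zeroʳ zero = refl
  binom-zeroʳ (suc j) = refl

  binom≥1 : ∀ j h → 1 ≤ binom j h
  binom≥1 zero h = ≤-refl
  binom≥1 (suc j) zero = ≤-refl
  binom≥1 (suc j) (suc h) = ≤-trans (binom≥1 j (suc h)) (m≤m+n _ _)

  binom-! : ∀ j h → binom j h * j ! * h ! ≡ (j + h) !
  binom-! zero h = +-identityʳ (h !)
  binom-! (suc j) zero = trans (*-identityʳ (1 * suc j !)) (trans (*-identityˡ (suc j !)) (cong _! (sym (+-identityʳ (suc j)))))
  binom-! (suc j) (suc h) = trans (eq₁ (binom j (suc h)) (binom (suc j) h) j h (j !) (h !))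
    (trans (cong₂ (λ a b → suc j * a + suc h * b) (binom-! j (suc h)) (trans (binom-! (suc j) h) (cong _! (sym (+-suc j h)))))
    (trans (sym (*-distribʳ-+ ((j + suc h) !) (suc j) (suc h))) (cong (_* (j + suc h) !) (cong suc (refl {x = j + suc h})))))
    where
    eq₁ : ∀ a b j h x y → (a + b) * (suc j * x) * (suc h * y) ≡ suc j * (a * x * (suc h * y)) + suc h * (b * (suc j * x) * y)
    eq₁ = solve-∀

  binom-absorb : ∀ j h → suc h * binom j (suc h) ≡ suc j * binom (suc j) h
  binom-absorb j h = *-cancelʳ-≡ _ _ (j ! * h !) {{m*n≢0 (j !) (h !) {{j !≢0}} {{h !≢0}}}}
    (trans (eq₁ h (binom j (suc h)) (j !) (h !))
    (trans (binom-! j (suc h)) (trans (cong _! (+-suc j h)) (trans (sym (binom-! (suc j) h)) (eq₂ j (binom (suc j) h) (j !) (h !))))))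
    where
    eq₁ : ∀ h b x y → suc h * b * (x * y) ≡ b * x * (suc h * y)
    eq₁ = solve-∀
    eq₂ : ∀ j b x y → b * (suc j * x) * y ≡ suc j * b * (x * y)
    eq₂ = solve-∀

  binom-absorb′ : ∀ j h → suc h * binom j (suc h) ≡ suc (j + h) * binom j h
  binom-absorb′ j h = *-cancelʳ-≡ _ _ (j ! * h !) {{m*n≢0 (j !) (h !) {{j !≢0}} {{h !≢0}}}}
    (trans (eq₁ h (binom j (suc h)) (j !) (h !))
    (trans (binom-! j (suc h)) (trans (cong _! (+-suc j h)) (trans (cong (suc (j + h) *_) (sym (binom-! j h))) (eq₂ (suc (j + h)) (binom j h) (j !) (h !))))))
    where
    eq₁ : ∀ h b x y → suc h * b * (x * y) ≡ b * x * (suc h * y)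
    eq₁ = solve-∀
    eq₂ : ∀ j b x y → j * (b * x * y) ≡ j * b * (x * y)
    eq₂ = solve-∀

  -- The left side is one term in the binomial expansion of `(K + 1) ^ (j + h)`; Pascal's rule gives
  -- the estimate directly by induction.
  binom-upper : ∀ K j h → binom j h * K ^ j ≤ suc K ^ (j + h)
  binom-upper K zero h = subst (_≤ suc K ^ h) (sym (*-identityʳ 1)) (m^n>0 (suc K) h)
  binom-upper K (suc j) zero = begin
    1 * K ^ suc j         ≡⟨ *-identityˡ _ ⟩
    K ^ suc j             ≤⟨ ^-monoˡ-≤ (suc j) (n≤1+n K) ⟩
    suc K ^ suc j         ≡⟨ cong (suc K ^_) (sym (+-identityʳ (suc j))) ⟩
    suc K ^ (suc j + 0)   ∎
    where open ≤-Reasoning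
  binom-upper K (suc j) (suc h) = begin
    (binom j (suc h) + binom (suc j) h) * K ^ suc j                  ≡⟨ eq (binom j (suc h)) (binom (suc j) h) K (K ^ j) ⟩
    K * (binom j (suc h) * K ^ j) + binom (suc j) h * K ^ suc j      ≤⟨ +-mono-≤ (*-monoʳ-≤ K (binom-upper K j (suc h))) (binom-upper K (suc j) h) ⟩
    K * suc K ^ (j + suc h) + suc K ^ suc (j + h)                    ≡⟨ cong (λ t → K * suc K ^ (j + suc h) + suc K ^ t) (sym (+-suc j h)) ⟩
    K * suc K ^ (j + suc h) + suc K ^ (j + suc h)                    ≡⟨ +-comm (K * suc K ^ (j + suc h)) _ ⟩
    suc K ^ (suc j + suc h)                                          ∎
    where
    open ≤-Reasoning
    eq : ∀ a b K z → (a + b) * (K * z) ≡ K * (a * z) + b * (K * z)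
    eq = solve-∀

  binom≤2^ : ∀ j h → binom j h ≤ 2 ^ (j + h)
  binom≤2^ j h = subst (_≤ 2 ^ (j + h)) (trans (cong (binom j h *_) (^-zeroˡ j)) (*-identityʳ _)) (binom-upper 1 j h)

  binom-monoˡ : ∀ j h → binom j h ≤ binom (suc j) h
  binom-monoˡ j zero = ≤-reflexive (binom-zeroʳ j)
  binom-monoˡ j (suc h) = m≤m+n (binom j (suc h)) _

  binom-monoʳ : ∀ j h → binom j h ≤ binom j (suc h)
  binom-monoʳ zero h = ≤-refl
  binom-monoʳ (suc j) h = m≤n+m (binom (suc j) h) (binom j (suc h))

  central-binom : ∀ N → 2 ^ N ≤ binom N N
  central-binom zero = ≤-refl
  central-binom (suc N) = begin
    2 * 2 ^ N                             ≡⟨ cong (2 ^ N +_) (+-identityʳ (2 ^ N)) ⟩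
    2 ^ N + 2 ^ N                         ≤⟨ +-mono-≤ (≤-trans (central-binom N) (binom-monoʳ N N)) (≤-trans (central-binom N) (binom-monoˡ N N)) ⟩
    binom N (suc N) + binom (suc N) N     ∎
    where open ≤-Reasoning

  -- Every prime power dividing this lcm is at most `n`. A binomial coefficient that divides it
  -- inherits the bound, which replaces Legendre's formula for the exponents.
  lcmUpTo : ℕ → ℕ
  lcmUpTo zero = 1
  lcmUpTo (suc n) = lcm (lcmUpTo n) (suc n)

  -- The reciprocals of (j + h + 1) * binom j h form Leibniz's harmonic triangle,
  -- in which every entry is the difference of two entries with smaller h.
  leibniz : ∀ j h → (suc (j + h) * binom j h) ∣ lcmUpTo (suc (j + h))
  leibniz j zero = subst (_∣ lcmUpTo (suc (j + 0))) (trans (sym (*-identityʳ _)) (cong (suc (j + 0) *_) (sym (binom-zeroʳ j))))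
    (n∣lcm[m,n] (lcmUpTo (j + 0)) (suc (j + 0)))
  leibniz j (suc h) with ∣-trans (leibniz j h) (subst (λ t → lcmUpTo (suc (j + h)) ∣ lcmUpTo (suc t)) (sym (+-suc j h)) (m∣lcm[m,n] (lcmUpTo (suc (j + h))) (suc (suc (j + h)))))
  ... | divides q e with subst (λ t → (suc t * binom (suc j) h) ∣ lcmUpTo (suc t)) (sym (+-suc j h)) (leibniz (suc j) h)
  ... | divides q′ e′ = divides (q ∸ q′) (*-cancelʳ-≡ L ((q ∸ q′) * (n * b)) (suc h) (sym (trans lhs rhs)))
    where
    open ≡-Reasoning
    n = suc (j + suc h)
    b = binom j (suc h)
    L = lcmUpTo n
    eq₁ : ∀ d n b h → d * (n * b) * h ≡ d * (n * (b * h))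
    eq₁ = solve-∀
    lhs : (q ∸ q′) * (n * b) * suc h ≡ q * (n * (b * suc h)) ∸ q′ * (n * (b * suc h))
    lhs = trans (eq₁ (q ∸ q′) n b (suc h)) (*-distribʳ-∸ (n * (b * suc h)) q q′)
    eq₂ : ∀ q n x → q * (n * x) ≡ n * (q * x)
    eq₂ = solve-∀
    eq₃ : ∀ q n j x → q * (n * (j * x)) ≡ j * (q * (n * x))
    eq₃ = solve-∀
    first : q * (n * (b * suc h)) ≡ n * L
    first = trans (cong (λ t → q * (n * t)) (trans (*-comm b (suc h)) (binom-absorb′ j h)))
      (trans (eq₂ q n (suc (j + h) * binom j h)) (cong (n *_) (sym e)))
    second : q′ * (n * (b * suc h)) ≡ suc j * L
    second = trans (cong (λ t → q′ * (n * t)) (trans (*-comm b (suc h)) (binom-absorb j h)))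
      (trans (eq₃ q′ n (suc j) (binom (suc j) h)) (cong (suc j *_) (sym e′)))
    rhs : q * (n * (b * suc h)) ∸ q′ * (n * (b * suc h)) ≡ L * suc h
    rhs = begin
      q * (n * (b * suc h)) ∸ q′ * (n * (b * suc h))  ≡⟨ cong₂ _∸_ first second ⟩
      n * L ∸ suc j * L                               ≡⟨ sym (*-distribʳ-∸ L n (suc j)) ⟩
      (n ∸ suc j) * L                                 ≡⟨ cong (_* L) (m+n∸m≡n j (suc h)) ⟩
      suc h * L                                       ≡⟨ *-comm (suc h) L ⟩
      L * suc h                                       ∎

  binom∣lcmUpTo : ∀ j h → binom j (suc h) ∣ lcmUpTo (j + suc h)
  binom∣lcmUpTo j h = subst (λ t → binom j (suc h) ∣ lcmUpTo t) (sym (+-suc j h))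
    (m*n∣⇒n∣ (suc h) (binom j (suc h)) (subst (_∣ lcmUpTo (suc (j + h))) (sym (binom-absorb′ j h)) (leibniz j h)))

  prime-part : ∀ {p} → Prime p → ∀ n → 1 ≤ n → ∃₂ λ i u → n ≡ p ^ i * u × ¬ p ∣ u
  prime-part {p} pr n = go n n ≤-refl
    where
    go : ∀ fuel n → n ≤ fuel → 1 ≤ n → ∃₂ λ i u → n ≡ p ^ i * u × ¬ p ∣ u
    go zero n n≤ 1≤n = contradiction (≤-trans 1≤n n≤) λ ()
    go (suc fuel) n n≤ 1≤n with p ∣? n
    ... | no p∤n = 0 , n , sym (*-identityˡ n) , p∤n
    ... | yes (divides zero e) = contradiction e (>⇒≢ 1≤n)
    ... | yes (divides k@(suc k′) e) with go fuel k (≤-pred (≤-trans (subst (k <_) (sym e) (m<m*n k p (prime≥2 pr))) n≤)) (s≤s z≤n)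
    ... | i , u , e′ , p∤u = suc i , u , trans e (trans (*-comm k p) (trans (cong (p *_) e′) (sym (*-assoc p (p ^ i) u)))) , p∤u

  prime-power-∣ : ∀ {p u} → Prime p → ¬ p ∣ u → ∀ a i → p ^ a ∣ p ^ i * u → a ≤ i
  prime-power-∣ pr p∤u zero i h = z≤n
  prime-power-∣ {p} {u} pr p∤u (suc a) zero h = contradiction (m*n∣⇒m∣ p (p ^ a) (subst (p ^ suc a ∣_) (*-identityˡ u) h)) p∤u
  prime-power-∣ {p} {u} pr p∤u (suc a) (suc i) h = s≤s (prime-power-∣ pr p∤u a i
    (*-cancelˡ-∣ p {{prime⇒nonZero pr}} (subst (p ^ suc a ∣_) (*-assoc p (p ^ i) u) h)))

  -- With `x = p ^ i * u` and `y = p ^ j * v`, the lcm divides `p ^ k * (u * v)` for `k` the larger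
  -- exponent. As `p` does not divide `u * v`, `a` is at most `k`.
  prime-power-∣lcm : ∀ {p} → Prime p → ∀ a x y → 1 ≤ x → 1 ≤ y → p ^ a ∣ lcm x y → p ^ a ∣ x ⊎ p ^ a ∣ y
  prime-power-∣lcm {p} pr a x y 1≤x 1≤y h with prime-part pr x 1≤x | prime-part pr y 1≤y
  ... | i , u , refl , p∤u | j , v , refl , p∤v = choose (≤-total i j)
    where
    p∤uv : ¬ p ∣ u * v
    p∤uv d with euclidsLemma u v pr d
    ... | inj₁ k = p∤u k
    ... | inj₂ k = p∤v k
    pow-∣ : ∀ {m n} → m ≤ n → p ^ m ∣ p ^ n
    pow-∣ {m} {n} m≤n = subst (λ t → p ^ m ∣ p ^ t) (m+[n∸m]≡n m≤n) (subst (p ^ m ∣_) (sym (^-distribˡ-+-* p m (n ∸ m))) (m∣m*n (p ^ (n ∸ m))))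
    common : ∀ {k} → i ≤ k → j ≤ k → p ^ a ∣ p ^ k * (u * v)
    common {k} i≤k j≤k = ∣-trans h (lcm-least (*-pres-∣ (pow-∣ i≤k) (m∣m*n v)) (*-pres-∣ (pow-∣ j≤k) (n∣m*n u)))
    choose : i ≤ j ⊎ j ≤ i → p ^ a ∣ p ^ i * u ⊎ p ^ a ∣ p ^ j * v
    choose (inj₁ i≤j) = inj₂ (∣-trans (pow-∣ (prime-power-∣ pr p∤uv a j (common i≤j ≤-refl))) (m∣m*n v))
    choose (inj₂ j≤i) = inj₁ (∣-trans (pow-∣ (prime-power-∣ pr p∤uv a i (common ≤-refl j≤i))) (m∣m*n u))

  lcmUpTo≥1 : ∀ n → 1 ≤ lcmUpTo n
  lcmUpTo≥1 zero = ≤-refl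
  lcmUpTo≥1 (suc n) = n≢0⇒n>0 λ e → go (lcm-zero e)
    where
    lcm-zero : lcm (lcmUpTo n) (suc n) ≡ 0 → 0 ∣ lcmUpTo n * suc n
    lcm-zero e = subst (_∣ lcmUpTo n * suc n) e (lcm-least {lcmUpTo n} {suc n} (m∣m*n (suc n)) (n∣m*n (lcmUpTo n)))
    go : ¬ 0 ∣ lcmUpTo n * suc n
    go d = >⇒≢ (*-mono-≤ (lcmUpTo≥1 n) (s≤s (z≤n {n}))) (0∣⇒≡0 d)

  prime-power-∣lcmUpTo : ∀ {p} → Prime p → ∀ a n → 1 ≤ n → p ^ a ∣ lcmUpTo n → p ^ a ≤ n
  prime-power-∣lcmUpTo pr a (suc zero) _ h = ∣⇒≤ h
  prime-power-∣lcmUpTo pr a (suc n@(suc _)) _ h =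
    [ (λ k → m≤n⇒m≤1+n (prime-power-∣lcmUpTo pr a n (s≤s z≤n) k)) , ∣⇒≤ ]′
      (prime-power-∣lcm pr a (lcmUpTo n) (suc n) (lcmUpTo≥1 n) (s≤s z≤n) h)

  -- The full power of the first listed prime is a factor of size at most `Y`, and the primes of the
  -- cofactor lie in the rest of the list.
  ≤-by-prime-powers : ∀ {Y} ps Z → 1 ≤ Z → All Prime ps → (∀ {p} → Prime p → p ∣ Z → p ∈ ps) →
    (∀ {p} → Prime p → ∀ a → p ^ a ∣ Z → p ^ a ≤ Y) → Z ≤ Y ^ length ps
  ≤-by-prime-powers [] (suc zero) _ _ _ _ = ≤-refl
  ≤-by-prime-powers [] (suc (suc Z)) _ _ mem _ with prime-divisor (suc (suc Z)) (s≤s (s≤s z≤n))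
  ... | p , pr , d with mem pr d
  ... | ()
  ≤-by-prime-powers {Y} (p ∷ ps) Z 1≤Z (pr ∷ prs) mem pow with prime-part pr Z 1≤Z
  ... | i , u , refl , p∤u = *-mono-≤ (pow pr i (m∣m*n u))
    (≤-by-prime-powers ps u 1≤u prs mem′ (λ qr a d → pow qr a (∣n⇒∣m*n (p ^ i) d)))
    where
    1≤u : 1 ≤ u
    1≤u = n≢0⇒n>0 λ { refl → p∤u (p ∣0) }
    mem′ : ∀ {q} → Prime q → q ∣ u → q ∈ ps
    mem′ qr d with mem qr (∣n⇒∣m*n (p ^ i) d)
    ... | here refl = contradiction d p∤u
    ... | there r = r

  -- The product of distinct prime divisors divides `Z`: after dividing by one of them, the others
  -- still divide the cofactor.
  distinct-primes-bound : ∀ {x} ps Z → 1 ≤ Z → Unique ps → All Prime ps → All (x ≤_) ps → All (_∣ Z) ps → x ^ length ps ≤ Z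
  distinct-primes-bound [] Z 1≤Z _ _ _ _ = 1≤Z
  distinct-primes-bound {x} (p ∷ ps) Z 1≤Z (p∉ ∷ un) (pr ∷ prs) (x≤p ∷ x≤ps) (divides k refl ∷ ds) =
    subst (x ^ suc (length ps) ≤_) (*-comm p k) (*-mono-≤ x≤p (distinct-primes-bound ps k 1≤k un prs x≤ps (cofactor p∉ prs ds)))
    where
    1≤k : 1 ≤ k
    1≤k = n≢0⇒n>0 λ { refl → contradiction 1≤Z λ () }
    cofactor : ∀ {qs} → All (p ≢_) qs → All Prime qs → All (_∣ k * p) qs → All (_∣ k) qs
    cofactor [] [] [] = []
    cofactor {q ∷ _} (n ∷ ns) (qr ∷ qrs) (d ∷ ds) = prime-cancel {n = k} qr pr (λ e → n (sym e)) (subst (q ∣_) (*-comm k p) d) ∷ cofactor ns qrs ds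

  prime∣!⇒≤ : ∀ {p} → Prime p → ∀ n → p ∣ n ! → p ≤ n
  prime∣!⇒≤ pr zero d = contradiction (∣⇒≤ d) (<⇒≱ (prime≥2 pr))
  prime∣!⇒≤ pr (suc n) d with euclidsLemma (suc n) (n !) pr d
  ... | inj₁ k = ∣⇒≤ k
  ... | inj₂ k = m≤n⇒m≤1+n (prime∣!⇒≤ pr n k)

  ≤⇒∣! : ∀ {p} n → 1 ≤ p → p ≤ n → p ∣ n !
  ≤⇒∣! {suc p} n _ h = ∣-trans (m∣m*n (p !)) (m≤n⇒m!∣n! h)

  -- `p` divides `(x + h) !` but neither `x !` nor `h !`, which are factorials of numbers below `p`.
  prime∣binom : ∀ {p} x h → Prime p → h ≤ x → x < p → p ≤ x + h → p ∣ binom x h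
  prime∣binom {p} x h pr h≤x x<p p≤ with euclidsLemma (binom x h * x !) (h !) pr (subst (p ∣_) (sym (binom-! x h)) (≤⇒∣! (x + h) (prime≥1 pr) p≤))
  ... | inj₂ d = contradiction (prime∣!⇒≤ pr h d) (<⇒≱ (≤-<-trans h≤x x<p))
  ... | inj₁ d with euclidsLemma (binom x h) (x !) pr d
  ... | inj₁ k = k
  ... | inj₂ k = contradiction (prime∣!⇒≤ pr x k) (<⇒≱ x<p)

-- Chebyshev's bounds and primes in short intervals

module PrimeCounts where
  open import Data.Nat
  open import Data.Nat.Properties
  open import Data.Nat.Tactic.RingSolver using (solve-∀)
  open Division using (prime≥1)
  open Binomials

  -- The integers of the interval (a, a + n].
  interval : ℕ → ℕ → List ℕ
  interval a zero = []
  interval a (suc n) = suc (a + n) ∷ interval a n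

  ∈-interval⁻ : ∀ {a k} n → k ∈ interval a n → a < k × k ≤ a + n
  ∈-interval⁻ {a} (suc n) (here refl) = s≤s (m≤m+n a n) , ≤-reflexive (sym (+-suc a n))
  ∈-interval⁻ {a} (suc n) (there p) with ∈-interval⁻ n p
  ... | l , u = l , ≤-trans u (+-monoʳ-≤ a (n≤1+n n))

  ∈-interval⁺ : ∀ {a k} n → a < k → k ≤ a + n → k ∈ interval a n
  ∈-interval⁺ {a} zero l u = contradiction (subst (_ ≤_) (+-identityʳ a) u) (<⇒≱ l)
  ∈-interval⁺ {a} {k} (suc n) l u with k ≟ suc (a + n)
  ... | yes refl = here refl
  ... | no k≢ = there (∈-interval⁺ n l (≤-pred (≤∧≢⇒< (subst (k ≤_) (+-suc a n) u) k≢)))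

  length-interval : ∀ a n → length (interval a n) ≡ n
  length-interval a zero = refl
  length-interval a (suc n) = cong suc (length-interval a n)

  interval-++ : ∀ a m n → interval a (m + n) ≡ interval (a + n) m ++ interval a n
  interval-++ a zero n = refl
  interval-++ a (suc m) n = cong₂ _∷_ (cong suc (trans (cong (a +_) (+-comm m n)) (sym (+-assoc a n m)))) (interval-++ a m n)

  interval-unique : ∀ a n → Unique (interval a n)
  interval-unique a zero = AllPairs.[]
  interval-unique a (suc n) = All.tabulate (λ {k} p e → <⇒≱ (≤-reflexive (trans (cong suc (sym (+-identityʳ (a + n)))) (trans (cong suc (+-identityʳ (a + n))) e))) (proj₂ (∈-interval⁻ n p))) AllPairs.∷ interval-unique a n

  primesIn : ℕ → ℕ → List ℕ
  primesIn a n = filter prime? (interval a n)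

  count : ℕ → ℕ → ℕ
  count a n = length (primesIn a n)

  primesIn-prime : ∀ a n → All Prime (primesIn a n)
  primesIn-prime a n = All.all-filter prime? (interval a n)

  primesIn-bounds : ∀ a n → All (λ p → a < p × p ≤ a + n) (primesIn a n)
  primesIn-bounds a n = All.filter⁺ prime? (All.tabulate (∈-interval⁻ n))

  primesIn-unique : ∀ a n → Unique (primesIn a n)
  primesIn-unique a n = Unique.filter⁺ prime? (interval-unique a n)

  count-+ : ∀ a m n → count a (m + n) ≡ count (a + n) m + count a n
  count-+ a m n = trans (cong length (trans (cong (filter prime?) (interval-++ a m n)) (filter-++ prime? (interval (a + n) m) (interval a n))))
    (length-++ (primesIn (a + n) m))

  count≤ : ∀ a n → count a n ≤ n
  count≤ a n = subst (count a n ≤_) (length-interval a n) (length-filter prime? (interval a n))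

  ^-cancelʳ-≤ : ∀ m n → 2 ^ m ≤ 2 ^ n → m ≤ n
  ^-cancelʳ-≤ m n h = ≮⇒≥ λ n<m → <⇒≱ (^-monoʳ-< 2 (s≤s (s≤s z≤n)) n<m) h

  1≤2^ : ∀ n → 1 ≤ 2 ^ n
  1≤2^ n = m^n>0 2 n

  2^-suc : ∀ n → 2 ^ suc n ≡ 2 ^ n + 2 ^ n
  2^-suc n = cong (2 ^ n +_) (+-identityʳ (2 ^ n))

  -- All primes of `(x, x + h]` divide `binom x h` and exceed `2 ^ m`, so `m` times their number is
  -- at most the binary logarithm of the binomial coefficient.
  count-pow : ∀ m x h → h ≤ x → 2 ^ m ≤ x → 2 ^ (m * count x h) ≤ binom x h
  count-pow m x h h≤x x≥ = subst (_≤ binom x h) (^-*-assoc 2 m (count x h))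
    (distinct-primes-bound (primesIn x h) (binom x h) (binom≥1 x h) (primesIn-unique x h) (primesIn-prime x h)
      (All.map (λ b → ≤-trans x≥ (<⇒≤ (proj₁ b))) (primesIn-bounds x h))
      (All.zipWith (λ { (pr , l , u) → prime∣binom x h pr h≤x l u }) (primesIn-prime x h , primesIn-bounds x h)))

  count-dyadic : ∀ m → m * count (2 ^ m) (2 ^ m) ≤ 2 * 2 ^ m
  count-dyadic m = ^-cancelʳ-≤ (m * count (2 ^ m) (2 ^ m)) (2 * 2 ^ m) (≤-trans (count-pow m (2 ^ m) (2 ^ m) ≤-refl ≤-refl)
    (subst (binom (2 ^ m) (2 ^ m) ≤_) (cong (2 ^_) (sym (2^-suc m))) (binom≤2^ (2 ^ m) (2 ^ m))))

  -- With `N = 2 ^ m`, the central coefficient is at least `2 ^ N`, while each of its prime powers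
  -- is at most `2 N = 2 ^ suc m`, because it divides the lcm of the numbers up to `2 N`.
  chebyshev-lower : ∀ m → 2 ^ m ≤ suc m * count 0 (2 ^ suc m)
  chebyshev-lower m = ^-cancelʳ-≤ N (suc m * count 0 (2 ^ suc m)) (≤-trans (central-binom N) (subst (binom N N ≤_) (^-*-assoc 2 (suc m) (count 0 (2 ^ suc m)))
      (≤-by-prime-powers (primesIn 0 (2 ^ suc m)) (binom N N) (binom≥1 N N) (primesIn-prime 0 (2 ^ suc m)) mem pow)))
    where
    N = 2 ^ m
    divides-lcm : ∀ k → 1 ≤ k → binom k k ∣ lcmUpTo (k + k)
    divides-lcm (suc k) _ = binom∣lcmUpTo (suc k) k
    divides-lcmN : binom N N ∣ lcmUpTo (2 ^ suc m)
    divides-lcmN = subst (λ t → binom N N ∣ lcmUpTo t) (sym (2^-suc m)) (divides-lcm N (1≤2^ m))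
    pow : ∀ {p} → Prime p → ∀ a → p ^ a ∣ binom N N → p ^ a ≤ 2 ^ suc m
    pow pr a d = prime-power-∣lcmUpTo pr a (2 ^ suc m) (1≤2^ (suc m)) (∣-trans d divides-lcmN)
    mem : ∀ {p} → Prime p → p ∣ binom N N → p ∈ primesIn 0 (2 ^ suc m)
    mem {p} pr d = ∈-filter⁺ prime? (∈-interval⁺ (2 ^ suc m) (prime≥1 pr)
      (subst (_≤ 2 ^ suc m) (*-identityʳ p) (pow pr 1 (subst (_∣ binom N N) (sym (*-identityʳ p)) d)))) pr

  -- Arithmetic of the induction in `chebyshev-upper`: `B` is `2 ^ m`, `c` counts the primes in
  -- `(B, 2 B]` and `π` those up to `B`. Raising `m` by one adds `c + π`, which `3 ≤ m` keeps below
  -- `2 B`.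
  chebyshev-step : ∀ m B c π → 3 ≤ m → m * c ≤ 2 * B → m * π ≤ 4 * B → suc m * (c + π) ≤ 4 * (2 * B)
  chebyshev-step m B c π 3≤m hc hπ = begin
    suc m * (c + π)             ≡⟨⟩
    c + π + m * (c + π)         ≤⟨ +-mono-≤ (*-cancelˡ-≤ {c + π} {2 * B} 3 three) six ⟩
    2 * B + 6 * B               ≡⟨ eq B ⟩
    4 * (2 * B)                 ∎
    where
    open ≤-Reasoning
    six : m * (c + π) ≤ 6 * B
    six = begin
      m * (c + π)       ≡⟨ *-distribˡ-+ m c π ⟩
      m * c + m * π     ≤⟨ +-mono-≤ hc hπ ⟩
      2 * B + 4 * B     ≡⟨ sym (*-distribʳ-+ B 2 4) ⟩
      6 * B             ∎
    three : 3 * (c + π) ≤ 3 * (2 * B)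
    three = begin
      3 * (c + π)         ≤⟨ *-monoˡ-≤ (c + π) 3≤m ⟩
      m * (c + π)         ≤⟨ six ⟩
      6 * B               ≡⟨ *-assoc 3 2 B ⟩
      3 * (2 * B)         ∎
    eq : ∀ b → 2 * b + 6 * b ≡ 4 * (2 * b)
    eq = solve-∀

  chebyshev-upper : ∀ m → 3 ≤ m → m * count 0 (2 ^ m) ≤ 4 * 2 ^ m
  chebyshev-upper 1 (s≤s ())
  chebyshev-upper 2 (s≤s (s≤s ()))
  chebyshev-upper 3 _ = ≤-trans (*-monoʳ-≤ 3 (count≤ 0 8)) (m≤m+n 24 8)
  chebyshev-upper (suc m@(suc (suc (suc _)))) _ = step m (s≤s (s≤s (s≤s z≤n))) (chebyshev-upper m (s≤s (s≤s (s≤s z≤n))))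
    where
    step : ∀ m → 3 ≤ m → m * count 0 (2 ^ m) ≤ 4 * 2 ^ m → suc m * count 0 (2 ^ suc m) ≤ 4 * 2 ^ suc m
    step m 3≤m ih = subst (λ t → suc m * t ≤ 4 * 2 ^ suc m)
      (trans (sym (count-+ 0 (2 ^ m) (2 ^ m))) (cong (count 0) (sym (2^-suc m))))
      (chebyshev-step m (2 ^ m) (count (2 ^ m) (2 ^ m)) (count 0 (2 ^ m)) 3≤m (count-dyadic m) ih)

  many-primes-step : ∀ m B c π → 5 ≤ m → 2 * (8 * B) ≤ (5 + m) * (c + π) → m * π ≤ 4 * B → 4 * B ≤ m * c
  many-primes-step m B c π 5≤m lower upper = +-cancelʳ-≤ (4 * B) (4 * B) (m * c) (begin
    4 * B + 4 * B              ≡⟨ sym (*-distribʳ-+ B 4 4) ⟩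
    8 * B                      ≤⟨ *-cancelˡ-≤ {8 * B} {m * (c + π)} 2 (begin
      2 * (8 * B)                ≤⟨ lower ⟩
      (5 + m) * (c + π)          ≤⟨ *-monoˡ-≤ (c + π) (+-monoˡ-≤ m 5≤m) ⟩
      (m + m) * (c + π)          ≡⟨ eq m (c + π) ⟩
      2 * (m * (c + π))          ∎) ⟩
    m * (c + π)                ≡⟨ *-distribˡ-+ m c π ⟩
    m * c + m * π              ≤⟨ +-monoʳ-≤ (m * c) upper ⟩
    m * c + 4 * B              ∎)
    where
    open ≤-Reasoning
    eq : ∀ a b → (a + a) * b ≡ 2 * (a * b)
    eq = solve-∀

  -- The ratio 32 is wide enough for the lower bound at its upper end to beat the upper bound at its
  -- lower end. With `B = 2 ^ m` and `5 + m ≤ 2 m`, the primes up to `32 B` number at least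
  -- `8 B / m`, those up to `B` at most `4 B / m`.
  many-primes : ∀ m → 5 ≤ m → 4 * 2 ^ m ≤ m * count (2 ^ m) (31 * 2 ^ m)
  many-primes m 5≤m = many-primes-step m B (count B (31 * B)) (count 0 B) 5≤m
      (subst₂ _≤_ (2^4* m) (cong ((5 + m) *_) (trans (cong (count 0) (2^5* m)) (count-+ 0 (31 * B) B))) (chebyshev-lower (4 + m)))
      (chebyshev-upper m (≤-trans (s≤s (s≤s (s≤s z≤n))) 5≤m))
    where
    B = 2 ^ m
    2^4* : ∀ m → 2 ^ (4 + m) ≡ 2 * (8 * 2 ^ m)
    2^4* m = trans (^-distribˡ-+-* 2 4 m) (*-assoc 2 8 (2 ^ m))
    2^5* : ∀ m → 2 ^ (5 + m) ≡ 31 * 2 ^ m + 2 ^ m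
    2^5* m = trans (^-distribˡ-+-* 2 5 m) (+-comm (2 ^ m) (31 * 2 ^ m))

  -- This is `(1 − 1/(K+1))^m ≥ 1 − m/(K+1)`, cleared of denominators.
  bernoulli : ∀ K m → suc K ^ m * suc K ≤ K ^ m * suc K + m * suc K ^ m
  bernoulli K zero = m≤m+n _ 0
  bernoulli K (suc m) = begin
    suc K * X * suc K                              ≡⟨ eq₁ K X ⟩
    K * (X * suc K) + X * suc K                    ≤⟨ +-monoˡ-≤ (X * suc K) (*-monoʳ-≤ K (bernoulli K m)) ⟩
    K * (K ^ m * suc K + m * X) + X * suc K        ≤⟨ m≤m+n _ (m * X) ⟩
    K * (K ^ m * suc K + m * X) + X * suc K + m * X ≡⟨ eq₂ K X (K ^ m) m ⟩
    K * K ^ m * suc K + suc m * (suc K * X)        ∎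
    where
    open ≤-Reasoning
    X = suc K ^ m
    eq₁ : ∀ k x → suc k * x * suc k ≡ k * (x * suc k) + x * suc k
    eq₁ = solve-∀
    eq₂ : ∀ k x y m → k * (y * suc k + m * x) + x * suc k + m * x ≡ k * y * suc k + suc m * (suc k * x)
    eq₂ = solve-∀

  -- Bernoulli's inequality at half the exponent, squared.
  suc^≤4* : ∀ m → suc (m + m) ^ (m + m) ≤ 4 * (m + m) ^ (m + m)
  suc^≤4* m = begin
    suc K ^ (m + m)            ≡⟨ ^-distribˡ-+-* (suc K) m m ⟩
    suc K ^ m * suc K ^ m      ≤⟨ *-mono-≤ half half ⟩
    2 * K ^ m * (2 * K ^ m)    ≡⟨ eq (K ^ m) ⟩
    4 * (K ^ m * K ^ m)        ≡⟨ cong (4 *_) (sym (^-distribˡ-+-* K m m)) ⟩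
    4 * K ^ (m + m)            ∎
    where
    open ≤-Reasoning
    K = m + m
    eq : ∀ x → 2 * x * (2 * x) ≡ 4 * (x * x)
    eq = solve-∀
    eq₁ : ∀ x m → m * x + (x + m * x) ≡ x * suc (m + m)
    eq₁ = solve-∀
    eq₂ : ∀ y k x m → y * k + m * x + m * x ≡ y * k + (m + m) * x
    eq₂ = solve-∀
    half : suc K ^ m ≤ 2 * K ^ m
    half = *-cancelʳ-≤ (suc K ^ m) (2 * K ^ m) (suc K) (+-cancelʳ-≤ (K * suc K ^ m) _ _ (begin
      suc K ^ m * suc K + K * suc K ^ m                     ≤⟨ m≤m+n _ (suc K ^ m) ⟩
      suc K ^ m * suc K + K * suc K ^ m + suc K ^ m         ≡⟨ eq₃ (suc K ^ m) K ⟩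
      suc K ^ m * suc K + suc K ^ m * suc K                 ≤⟨ +-mono-≤ (bernoulli K m) (bernoulli K m) ⟩
      (K ^ m * suc K + m * suc K ^ m) + (K ^ m * suc K + m * suc K ^ m) ≡⟨ eq₄ (K ^ m) (suc K) m (suc K ^ m) ⟩
      2 * K ^ m * suc K + K * suc K ^ m                     ∎))
      where
      eq₃ : ∀ x k → x * suc k + k * x + x ≡ x * suc k + x * suc k
      eq₃ = solve-∀
      eq₄ : ∀ y k m x → (y * k + m * x) + (y * k + m * x) ≡ 2 * y * k + (m + m) * x
      eq₄ = solve-∀

  ^-distribʳ-* : ∀ n a b → (a * b) ^ n ≡ a ^ n * b ^ n
  ^-distribʳ-* zero a b = refl
  ^-distribʳ-* (suc n) a b = trans (cong (a * b *_) (^-distribʳ-* n a b)) (eq a b (a ^ n) (b ^ n))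
    where
    eq : ∀ a b x y → a * b * (x * y) ≡ a * x * (b * y)
    eq = solve-∀

  -- The integer form of `(1 + 1/K)^x ≤ 4^t` for `x ≤ t K`. Multiplying by `K ^ y` pads the exponent
  -- to `t K`, where `suc^≤4*` can be raised to the power `t`.
  suc^≤4^* : ∀ s t x → x ≤ t * 2 ^ suc s → suc (2 ^ suc s) ^ x ≤ 4 ^ t * (2 ^ suc s) ^ x
  suc^≤4^* s t x h = *-cancelʳ-≤ (suc K ^ x) (4 ^ t * K ^ x) (K ^ y) {{m^n≢0 K y {{m^n≢0 2 (suc s)}}}} (begin
    suc K ^ x * K ^ y       ≤⟨ *-monoʳ-≤ (suc K ^ x) (^-monoˡ-≤ y (n≤1+n K)) ⟩
    suc K ^ x * suc K ^ y   ≡⟨ sym (^-distribˡ-+-* (suc K) x y) ⟩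
    suc K ^ (x + y)         ≡⟨ cong (suc K ^_) (m+[n∸m]≡n h) ⟩
    suc K ^ (t * K)         ≡⟨ cong (suc K ^_) (*-comm t K) ⟩
    suc K ^ (K * t)         ≡⟨ sym (^-*-assoc (suc K) K t) ⟩
    (suc K ^ K) ^ t         ≤⟨ ^-monoˡ-≤ t (subst (λ k → suc k ^ k ≤ 4 * k ^ k) (sym (2^-suc s)) (suc^≤4* (2 ^ s))) ⟩
    (4 * K ^ K) ^ t         ≡⟨ ^-distribʳ-* t 4 (K ^ K) ⟩
    4 ^ t * (K ^ K) ^ t     ≡⟨ cong (4 ^ t *_) (trans (^-*-assoc K K t) (cong (K ^_) (trans (*-comm K t) (sym (m+[n∸m]≡n h))))) ⟩
    4 ^ t * K ^ (x + y)     ≡⟨ cong (4 ^ t *_) (^-distribˡ-+-* K x y) ⟩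
    4 ^ t * (K ^ x * K ^ y) ≡⟨ sym (*-assoc (4 ^ t) (K ^ x) (K ^ y)) ⟩
    4 ^ t * K ^ x * K ^ y   ∎)
    where
    open ≤-Reasoning
    K = 2 ^ suc s
    y = t * K ∸ x

  -- `binom x h` is at most `(1 + 1/K)^x (K + 1)^h`, and the two factors are at most `4 ^ t` and
  -- `2 ^ ((2 + s) * h)`. With `K` near `x / h` this bounds the number of primes by a multiple of
  -- `h log(x/h) / log x`, which makes a short stretch of cells poor in primes.
  short-interval : ∀ m s t x h → h ≤ x → 2 ^ m ≤ x → x ≤ t * 2 ^ suc s → m * count x h ≤ 2 * t + (2 + s) * h
  short-interval m s t x h h≤x x≥ x≤ = ^-cancelʳ-≤ (m * count x h) (2 * t + (2 + s) * h) (≤-trans (count-pow m x h h≤x x≥)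
    (*-cancelʳ-≤ (binom x h) (2 ^ (2 * t + (2 + s) * h)) (K ^ x) {{m^n≢0 K x {{m^n≢0 2 (suc s)}}}} (begin
      binom x h * K ^ x                    ≤⟨ binom-upper K x h ⟩
      suc K ^ (x + h)                      ≡⟨ ^-distribˡ-+-* (suc K) x h ⟩
      suc K ^ x * suc K ^ h                ≤⟨ *-mono-≤ (suc^≤4^* s t x x≤) (^-monoˡ-≤ h (subst (suc K ≤_) (sym (2^-suc (suc s))) (+-monoˡ-≤ K (1≤2^ (suc s))))) ⟩
      4 ^ t * K ^ x * (2 ^ (2 + s)) ^ h    ≡⟨ cong₂ (λ a b → a * K ^ x * b) (^-*-assoc 2 2 t) (^-*-assoc 2 (2 + s) h) ⟩
      2 ^ (2 * t) * K ^ x * 2 ^ ((2 + s) * h)  ≡⟨ eq (2 ^ (2 * t)) (K ^ x) (2 ^ ((2 + s) * h)) ⟩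
      2 ^ (2 * t) * 2 ^ ((2 + s) * h) * K ^ x  ≡⟨ cong (_* K ^ x) (sym (^-distribˡ-+-* 2 (2 * t) ((2 + s) * h))) ⟩
      2 ^ (2 * t + (2 + s) * h) * K ^ x    ∎)))
    where
    open ≤-Reasoning
    K = 2 ^ suc s
    eq : ∀ a b c → a * b * c ≡ a * c * b
    eq = solve-∀

-- Spaced pairs of cells rich in primes

module PopularCells where
  open import Data.Nat
  open import Data.Nat.Properties
  open import Data.Nat.Tactic.RingSolver using (solve-∀)
  open Division using (_÷_; ÷-*≤; <÷-*; *≤⇒≤÷)
  open PrimeCounts

  -- The number of primes in the cells i, …, i + n - 1, where cell i is (G i, G (i + 1)].
  cells : ℕ → ℕ → ℕ → ℕ
  cells G i n = count (G * i) (G * n)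

  cells-+ : ∀ G i m n → cells G i (m + n) ≡ cells G (i + n) m + cells G i n
  cells-+ G i m n = trans (cong (count (G * i)) (*-distribˡ-+ G m n))
    (trans (count-+ (G * i) (G * m) (G * n)) (cong (λ t → count t (G * m) + count (G * i) (G * n)) (sym (*-distribˡ-+ G i n))))

  cells-suc : ∀ G i n → cells G i (suc n) ≡ cells G (suc i) n + cells G i 1
  cells-suc G i n = trans (cong (cells G i) (+-comm 1 n)) (trans (cells-+ G i n 1) (cong (λ t → cells G t n + cells G i 1) (+-comm i 1)))

  module _ (G k d : ℕ) where

    Popular : ℕ → Set
    Popular i = k ≤ cells G i 1

    SpacedPair : ℕ → ℕ → Set
    SpacedPair lo hi = ∃₂ λ a b → lo ≤ a × a + d ≤ b × b < hi × Popular a × Popular b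

    sparse : ∀ n i → (∀ j → j < n → ¬ Popular (i + j)) → cells G i n ≤ n * k
    sparse zero i h = subst (_≤ 0) (cong (count (G * i)) (sym (*-zeroʳ G))) z≤n
    sparse (suc n) i h = subst (_≤ k + n * k) (sym (cells-suc G i n)) (subst (cells G (suc i) n + cells G i 1 ≤_) (+-comm (n * k) k)
      (+-mono-≤ (sparse n (suc i) (λ j j<n p → h (suc j) (s≤s j<n) (subst Popular (sym (+-suc i j)) p)))
        (<⇒≤ (≰⇒> λ p → h 0 (s≤s z≤n) (subst Popular (sym (+-identityʳ i)) p)))))

    module _ (u lo hi : ℕ) (bound : ∀ i → lo ≤ i → i < hi → cells G i d ≤ u) where

      -- If no pair is spaced, all popular cells lie among the `d` cells starting with the first
      -- popular one. Together these hold at most `u` primes, and every other cell at most `k`.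
      block : ∀ n i → lo ≤ i → i + n ≤ hi → SpacedPair i (i + n) ⊎ cells G i n ≤ n * k + u
      block zero i _ _ = inj₂ (subst (_≤ u) (cong (count (G * i)) (sym (*-zeroʳ G))) z≤n)
      block (suc n) i lo≤i i+n≤hi with k ≤? cells G i 1
      ... | no unpopular = shift (block n (suc i) (m≤n⇒m≤1+n lo≤i) (subst (_≤ hi) (+-suc i n) i+n≤hi))
        where
        shift : SpacedPair (suc i) (suc i + n) ⊎ cells G (suc i) n ≤ n * k + u → SpacedPair i (i + suc n) ⊎ cells G i (suc n) ≤ suc n * k + u
        shift (inj₁ (a , b , l , gap , r , pa , pb)) = inj₁ (a , b , <⇒≤ l , gap , subst (b <_) (sym (+-suc i n)) r , pa , pb)
        shift (inj₂ le) = inj₂ (begin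
          cells G i (suc n)                 ≡⟨ cells-suc G i n ⟩
          cells G (suc i) n + cells G i 1   ≤⟨ +-mono-≤ le (<⇒≤ (≰⇒> unpopular)) ⟩
          n * k + u + k                     ≡⟨ eq (n * k) u k ⟩
          suc n * k + u                     ∎)
          where
          open ≤-Reasoning
          eq : ∀ a b c → a + b + c ≡ c + a + b
          eq = solve-∀
      ... | yes popular with anyUpTo? (λ j → (d ≤? j) ×-dec (k ≤? cells G (i + j) 1)) (suc n)
      ... | yes (j , j<n , d≤j , p) = inj₁ (i , i + j , ≤-refl , +-monoʳ-≤ i d≤j , +-monoʳ-< i j<n , popular , p)
      ... | no none with ≤-total d (suc n)
      ... | inj₁ d≤n = inj₂ (begin
          cells G i (suc n)                              ≡⟨ cong (cells G i) (sym (m∸n+n≡m d≤n)) ⟩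
          cells G i (suc n ∸ d + d)                      ≡⟨ cells-+ G i (suc n ∸ d) d ⟩
          cells G (i + d) (suc n ∸ d) + cells G i d      ≤⟨ +-mono-≤ (sparse (suc n ∸ d) (i + d) unpopular) (bound i lo≤i (≤-trans (m<m+n i (s≤s z≤n)) i+n≤hi)) ⟩
          (suc n ∸ d) * k + u                            ≤⟨ +-monoˡ-≤ u (*-monoˡ-≤ k (m∸n≤m (suc n) d)) ⟩
          suc n * k + u                                  ∎)
        where
        open ≤-Reasoning
        unpopular : ∀ j → j < suc n ∸ d → ¬ Popular (i + d + j)
        unpopular j j< p = none (d + j , subst (d + j <_) (m+[n∸m]≡n d≤n) (+-monoʳ-< d j<) , m≤m+n d j , subst Popular (+-assoc i d j) p)
      -- The remaining block is shorter than `d` and is enlarged, because `bound` concerns `d`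
      -- consecutive cells.
      ... | inj₂ n≤d = inj₂ (begin
          cells G i (suc n)                              ≤⟨ m≤n+m _ _ ⟩
          cells G (i + suc n) (d ∸ suc n) + cells G i (suc n) ≡⟨ sym (cells-+ G i (d ∸ suc n) (suc n)) ⟩
          cells G i (d ∸ suc n + suc n)                  ≡⟨ cong (cells G i) (m∸n+n≡m n≤d) ⟩
          cells G i d                                    ≤⟨ bound i lo≤i (≤-trans (m<m+n i (s≤s z≤n)) i+n≤hi) ⟩
          u                                              ≤⟨ m≤n+m u _ ⟩
          suc n * k + u                                  ∎)
        where open ≤-Reasoning

      -- Searching blocks of `D` cells separately is what forces `b < a + D`: both cells of a pair
      -- come from the same block.
      blocks : ∀ D t i → lo ≤ i → i + t * D ≤ hi →
        (∃₂ λ a b → i ≤ a × a + d ≤ b × b < a + D × b < hi × Popular a × Popular b) ⊎ cells G i (t * D) ≤ t * (D * k + u)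
      blocks D zero i _ _ = inj₂ (subst (_≤ 0) (cong (count (G * i)) (sym (*-zeroʳ G))) z≤n)
      blocks D (suc t) i lo≤i le with block D i lo≤i (≤-trans (+-monoʳ-≤ i (m≤m+n D (t * D))) le)
      ... | inj₁ (a , b , l , gap , r , pa , pb) = inj₁ (a , b , l , gap , ≤-trans r (+-monoˡ-≤ D l) ,
              ≤-trans r (≤-trans (+-monoʳ-≤ i (m≤m+n D (t * D))) le) , pa , pb)
      ... | inj₂ first with blocks D t (i + D) (≤-trans lo≤i (m≤m+n i D)) (subst (_≤ hi) (sym (+-assoc i D (t * D))) le)
      ... | inj₁ (a , b , l , rest) = inj₁ (a , b , ≤-trans (m≤m+n i D) l , rest)
      ... | inj₂ others = inj₂ (begin
          cells G i (D + t * D)                     ≡⟨ cong (cells G i) (+-comm D (t * D)) ⟩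
          cells G i (t * D + D)                     ≡⟨ cells-+ G i (t * D) D ⟩
          cells G (i + D) (t * D) + cells G i D     ≤⟨ +-mono-≤ others first ⟩
          t * (D * k + u) + (D * k + u)             ≡⟨ +-comm (t * (D * k + u)) _ ⟩
          suc t * (D * k + u)                       ∎)
        where open ≤-Reasoning

  -- Multiplied by `2 ^ e * (G * d)`, this is the comparison in `um`: 31 comes from the `31 * 2 ^ e`
  -- blocks, `77 + 2 * e` from `short-interval`, and `8192 = 2 * 4096` from `D`. An exponential in
  -- `e` beats a logarithmic loss linear in `e`.
  log-bound : ∀ e → 31 * (77 + 2 * e) < 2 ^ e * 8192
  log-bound zero = ≤ᵇ⇒≤ 2388 8192 tt
  log-bound (suc e) = begin-strict
    31 * (77 + 2 * suc e)          ≡⟨ eq₁ e ⟩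
    31 * (77 + 2 * e) + 62         <⟨ +-mono-<-≤ (log-bound e) (*-mono-≤ (1≤2^ e) (≤ᵇ⇒≤ 62 8192 tt)) ⟩
    2 ^ e * 8192 + 2 ^ e * 8192    ≡⟨ eq₂ (2 ^ e) ⟩
    2 * 2 ^ e * 8192             ∎
    where
    open ≤-Reasoning
    eq₁ : ∀ e → 31 * (77 + 2 * suc e) ≡ 31 * (77 + 2 * e) + 62
    eq₁ = solve-∀
    eq₂ : ∀ x → x * 8192 + x * 8192 ≡ 2 * x * 8192
    eq₂ = solve-∀

  -- The cells with indices in [Q, 32 Q) cover (2 ^ m, 2 ^ (m + 5)]. The ratio Q / d = 2 ^ (2 e + 12) is so large that,
  -- by log-bound, the intervals of d cells around the first popular one cannot hold all primes guaranteed by Chebyshev.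
  module Scale (e r g : ℕ) where
    q m d D Q G k : ℕ
    q = suc (e + e + 11) + r
    m = g + q
    d = 2 ^ r
    D = 2 ^ e * 4096 * d
    Q = 2 ^ q
    G = 2 ^ g
    -- About half of the average that `many-primes` guarantees, namely `4 * 2 ^ m / m` primes in
    -- `31 * Q` cells.
    k = 2 ^ m ÷ (16 * Q * m)

    Q≡ : Q ≡ 2 ^ e * D
    Q≡ = trans (^-distribˡ-+-* 2 (suc (e + e + 11)) r) (trans (cong (λ t → 2 ^ t * d) (trans (sym (+-suc (e + e) 11)) refl))
      (trans (cong (_* d) (trans (^-distribˡ-+-* 2 (e + e) 12) (cong (_* 4096) (^-distribˡ-+-* 2 e e)))) (eq (2 ^ e) d)))
      where
      eq : ∀ E d → E * E * 4096 * d ≡ E * (E * 4096 * d)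
      eq = solve-∀

    GQ≡ : 2 ^ m ≡ G * Q
    GQ≡ = ^-distribˡ-+-* 2 g q

    popular-pair : 5 ≤ m → ∃₂ λ a b → Q ≤ a × a + d ≤ b × b < a + D × b < 32 * Q × k ≤ cells G a 1 × k ≤ cells G b 1
    popular-pair 5≤m = choose (blocks G k d u Q (32 * Q) bound D (31 * 2 ^ e) Q ≤-refl (≤-reflexive (cong (Q +_) tD)))
      where
      open ≤-Reasoning
      -- `77 + 2 * e` is `2 * 32 + (2 + (e + e + 11))`, from `short-interval` with `s = e + e + 11`
      -- and `t = 32 * (G * d)`; here `2 ^ suc s` is the ratio `Q / d`.
      W = (77 + 2 * e) * (G * d)
      u = W ÷ m
      1≤m : 1 ≤ m
      1≤m = ≤-trans (s≤s z≤n) 5≤m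
      tD : 31 * 2 ^ e * D ≡ 31 * Q
      tD = trans (*-assoc 31 (2 ^ e) D) (cong (31 *_) (sym Q≡))
      d≤Q : d ≤ Q
      d≤Q = ^-monoʳ-≤ 2 (m≤n+m r (suc (e + e + 11)))
      h≡ : 32 * (G * Q) ≡ 32 * (G * d) * 2 ^ suc (e + e + 11)
      h≡ = trans (cong (λ t → 32 * (G * t)) (^-distribˡ-+-* 2 (suc (e + e + 11)) r)) (eq G (2 ^ suc (e + e + 11)) d)
        where
        eq : ∀ g x d → 32 * (g * (x * d)) ≡ 32 * (g * d) * x
        eq = solve-∀
      bound : ∀ i → Q ≤ i → i < 32 * Q → cells G i d ≤ u
      bound i Q≤i i<32Q = *≤⇒≤÷ 1≤m (begin
        cells G i d * m                  ≡⟨ *-comm (cells G i d) m ⟩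
        m * cells G i d                  ≤⟨ short-interval m (e + e + 11) (32 * (G * d)) (G * i) (G * d) (*-monoʳ-≤ G (≤-trans d≤Q Q≤i))
                                              (subst (_≤ G * i) (sym GQ≡) (*-monoʳ-≤ G Q≤i))
                                              (subst (G * i ≤_) (trans (eq₀ G Q) h≡) (*-monoʳ-≤ G (<⇒≤ i<32Q))) ⟩
        2 * (32 * (G * d)) + (2 + (e + e + 11)) * (G * d)  ≡⟨ eq₁ (G * d) e ⟩
        W                                ∎)
        where
        eq₀ : ∀ g q → g * (32 * q) ≡ 32 * (g * q)
        eq₀ = solve-∀
        eq₁ : ∀ h e → 2 * (32 * h) + (2 + (e + e + 11)) * h ≡ (77 + 2 * e) * h
        eq₁ = solve-∀
      kQm : 31 * (Q * m * k) ≤ 2 * 2 ^ m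
      kQm = begin
        31 * (Q * m * k)          ≤⟨ *-monoˡ-≤ (Q * m * k) (n≤1+n 31) ⟩
        32 * (Q * m * k)          ≡⟨ eq Q m k ⟩
        2 * (k * (16 * Q * m))    ≤⟨ *-monoʳ-≤ 2 (÷-*≤ (2 ^ m) (16 * Q * m)) ⟩
        2 * 2 ^ m                 ∎
        where
        eq : ∀ q m k → 32 * (q * m * k) ≡ 2 * (k * (16 * q * m))
        eq = solve-∀
      um : 31 * 2 ^ e * (m * u) < 2 * 2 ^ m
      um = begin-strict
        31 * 2 ^ e * (m * u)                       ≤⟨ *-monoʳ-≤ (31 * 2 ^ e) (subst (_≤ W) (*-comm u m) (÷-*≤ W m)) ⟩
        31 * 2 ^ e * ((77 + 2 * e) * (G * d))      ≡⟨ eq₁ (2 ^ e) (77 + 2 * e) (G * d) ⟩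
        31 * (77 + 2 * e) * (2 ^ e * (G * d))      <⟨ *-monoˡ-< (2 ^ e * (G * d)) {{>-nonZero (*-mono-≤ (1≤2^ e) (*-mono-≤ (1≤2^ g) (1≤2^ r)))}} (log-bound e) ⟩
        2 ^ e * 8192 * (2 ^ e * (G * d))           ≡⟨ eq₂ (2 ^ e) G d ⟩
        2 * (G * (2 ^ e * (2 ^ e * 4096 * d)))     ≡⟨ cong (2 *_) (trans (cong (G *_) (sym Q≡)) (sym GQ≡)) ⟩
        2 * 2 ^ m                                  ∎
        where
        eq₁ : ∀ x a y → 31 * x * (a * y) ≡ 31 * a * (x * y)
        eq₁ = solve-∀
        eq₂ : ∀ x g d → x * 8192 * (x * (g * d)) ≡ 2 * (g * (x * (x * 4096 * d)))
        eq₂ = solve-∀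
      -- Weighted by `m`, the term with `k` contributes at most `2 * 2 ^ m` (`kQm`) and the term
      -- with `u` strictly less (`um`), against `4 * 2 ^ m` from `many-primes`.
      too-few : ¬ cells G Q (31 * 2 ^ e * D) ≤ 31 * 2 ^ e * (D * k + u)
      too-few le = <-irrefl refl (begin-strict
        4 * 2 ^ m                                  ≤⟨ many-primes m 5≤m ⟩
        m * count (2 ^ m) (31 * 2 ^ m)             ≡⟨ cong (m *_) (cong₂ count GQ≡ (trans (cong (31 *_) GQ≡) (trans (eq₁ G Q) (cong (G *_) (sym tD))))) ⟩
        m * cells G Q (31 * 2 ^ e * D)             ≤⟨ *-monoʳ-≤ m le ⟩
        m * (31 * 2 ^ e * (D * k + u))             ≡⟨ eq₂ m (2 ^ e) D k u ⟩
        31 * (2 ^ e * D * m * k) + 31 * 2 ^ e * (m * u)  ≡⟨ cong (λ t → 31 * (t * m * k) + 31 * 2 ^ e * (m * u)) (sym Q≡) ⟩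
        31 * (Q * m * k) + 31 * 2 ^ e * (m * u)    <⟨ +-mono-≤-< kQm um ⟩
        2 * 2 ^ m + 2 * 2 ^ m                      ≡⟨ sym (*-distribʳ-+ (2 ^ m) 2 2) ⟩
        4 * 2 ^ m                                  ∎)
        where
        eq₁ : ∀ g q → 31 * (g * q) ≡ g * (31 * q)
        eq₁ = solve-∀
        eq₂ : ∀ m x D k u → m * (31 * x * (D * k + u)) ≡ 31 * (x * D * m * k) + 31 * x * (m * u)
        eq₂ = solve-∀
      choose : (∃₂ λ a b → Q ≤ a × a + d ≤ b × b < a + D × b < 32 * Q × k ≤ cells G a 1 × k ≤ cells G b 1)
        ⊎ cells G Q (31 * 2 ^ e * D) ≤ 31 * 2 ^ e * (D * k + u)
        → ∃₂ λ a b → Q ≤ a × a + d ≤ b × b < a + D × b < 32 * Q × k ≤ cells G a 1 × k ≤ cells G b 1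
      choose (inj₁ pair) = pair
      choose (inj₂ le) = contradiction le too-few

    -- Once `k` is positive, rounding down in its definition costs at most a factor of 2, so 16
    -- becomes 32.
    2^≤32Qmk : 1 ≤ k → 2 ^ m ≤ 32 * Q * m * k
    2^≤32Qmk 1≤k = begin
      2 ^ m                        ≤⟨ <⇒≤ (<÷-* (2 ^ m) 1≤16Qm) ⟩
      suc k * (16 * Q * m)         ≤⟨ *-monoˡ-≤ (16 * Q * m) (+-monoˡ-≤ k 1≤k) ⟩
      (k + k) * (16 * Q * m)       ≡⟨ eq k Q m ⟩
      32 * Q * m * k               ∎
      where
      open ≤-Reasoning
      -- A zero divisor would make `k` zero, since `n ÷ 0` is 0.
      1≤16Qm : 1 ≤ 16 * Q * m
      1≤16Qm = n≢0⇒n>0 λ z → contradiction (subst (1 ≤_) (cong (2 ^ m ÷_) z) 1≤k) λ ()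
      eq : ∀ k q m → (k + k) * (16 * q * m) ≡ 32 * q * m * k
      eq = solve-∀

    -- `q ≤ g` gives `m ≤ 2 g`, so `32 g ≤ 2 ^ g` suffices; this holds from `g = 8` on, with
    -- equality at 8.
    1≤k : 8 ≤ g → q ≤ g → 1 ≤ k
    1≤k 8≤g q≤g = *≤⇒≤÷ (*-mono-≤ (*-mono-≤ (s≤s (z≤n {15})) (1≤2^ q)) (≤-trans (s≤s z≤n) (≤-trans 8≤g (m≤m+n g q)))) (begin
      1 * (16 * Q * m)        ≡⟨ *-identityˡ (16 * Q * m) ⟩
      16 * Q * m              ≤⟨ *-monoʳ-≤ (16 * Q) (+-monoʳ-≤ g q≤g) ⟩
      16 * Q * (g + g)        ≡⟨ eq Q g ⟩
      32 * g * Q              ≤⟨ *-monoˡ-≤ Q (32*≤2^ g 8≤g) ⟩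
      G * Q                   ≡⟨ sym GQ≡ ⟩
      2 ^ m                   ∎)
      where
      open ≤-Reasoning
      eq : ∀ q g → 16 * q * (g + g) ≡ 32 * g * q
      eq = solve-∀
      32*≤2^ : ∀ g → 8 ≤ g → 32 * g ≤ 2 ^ g
      32*≤2^ g 8≤g = subst (λ t → 32 * t ≤ 2 ^ t) (m+[n∸m]≡n 8≤g) (go (g ∸ 8))
        where
        go : ∀ j → 32 * (8 + j) ≤ 2 ^ (8 + j)
        go zero = ≤-refl
        go (suc j) = subst₂ _≤_ (eq′ j) (trans (sym (2^-suc (8 + j))) (cong (2 ^_) (sym (+-suc 8 j))))
          (+-mono-≤ (go j) (≤-trans (≤ᵇ⇒≤ 32 256 tt) (^-monoʳ-≤ 2 (m≤m+n 8 j))))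
          where
          eq′ : ∀ j → 32 * (8 + j) + 32 ≡ 32 * (8 + suc j)
          eq′ = solve-∀

-- The Turán-Kubilius inequality

module TuranKubilius where
  open Rationals
  open Sums
  open Division

  recip : List ℕ → ℚ
  recip ps = ∑ ps inv

  0≤recip : ∀ ps → 0ℚ ≤ recip ps
  0≤recip ps = ∑-nonneg ps (λ p _ → 0≤inv p)

  ω : List ℕ → ℕ → ℚ
  ω ps n = ∑ ps (λ p → 𝟙 (p ∣? n))

  ∑-ω : ∀ X ps → ∑ [1… X ] (ω ps) ≡ ∑ ps (λ p → ∑ [1… X ] (λ n → 𝟙 (p ∣? n)))
  ∑-ω X ps = ∑-swap [1… X ] ps (λ n p → 𝟙 (p ∣? n))

  -- Each floor `X ÷ p` falls short of `X / p` by at most 1, whence the summand `length ps`.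
  ∑-ω-lower : ∀ X ps → All Prime ps → ⟦ X ⟧ * recip ps ≤ ∑ [1… X ] (ω ps) + ⟦ length ps ⟧
  ∑-ω-lower X ps prs = ≤-resp (trans (∑-cong ps (λ p _ → ℚ.*-comm (inv p) ⟦ X ⟧)) (∑-* ps ⟦ X ⟧ inv))
      (trans (∑-+ ps (λ _ → 1ℚ) _) (trans (ℚ.+-comm (∑ ps (λ _ → 1ℚ)) _) (cong₂ _+_ (sym (∑-ω X ps)) (trans (∑-const ps 1ℚ) (ℚ.*-identityʳ ⟦ length ps ⟧)))))
      (∑-mono ps {λ p → inv p * ⟦ X ⟧} {λ p → 1ℚ + ∑ [1… X ] (λ n → 𝟙 (p ∣? n))} bound)
    where
    bound : ∀ p → p ∈ ps → inv p * ⟦ X ⟧ ≤ 1ℚ + ∑ [1… X ] (λ n → 𝟙 (p ∣? n))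
    bound p p∈ = subst (λ t → inv p * ⟦ X ⟧ ≤ 1ℚ + t) (sym (count-multiples X (prime≥1 (All.lookup prs p∈)))) (≤÷+1ℚ X (prime≥1 (All.lookup prs p∈)))

  ÷÷≤ : ∀ X {p q} → 1 ℕ.≤ p → 1 ℕ.≤ q → ⟦ X ÷ p ÷ q ⟧ ≤ inv p * inv q * ⟦ X ⟧
  ÷÷≤ X {p} {q} hp hq = ℚ.≤-trans (÷≤ℚ (X ÷ p) hq)
    (by-diff (0≤* (0≤inv q) (diff (÷≤ℚ X hp))) (eq (inv p) (inv q) ⟦ X ⟧ ⟦ X ÷ p ⟧))
    where
    eq : ∀ a b x y → a * b * x - b * y ≡ b * (a * x - y)
    eq = Solver.solve-∀ ring

  joint-multiples : ∀ X {p q} → Prime p → Prime q → p ≢ q → ∑ [1… X ] (λ n → 𝟙 (p ∣? n) * 𝟙 (q ∣? n)) ≤ inv p * inv q * ⟦ X ⟧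
  joint-multiples X {p} {q} pr qr p≢q = subst (_≤ inv p * inv q * ⟦ X ⟧)
    (sym (trans (∑-multiples X (λ n → 𝟙 (q ∣? n)) (prime≥1 pr))
      (trans (∑-cong [1… X ÷ p ] (λ m _ → 𝟙-cong (q ∣? p ℕ.* m) (q ∣? m) (prime-cancel {n = m} qr pr (λ e → p≢q (sym e))) (∣n⇒∣m*n p)))
        (count-multiples (X ÷ p) (prime≥1 qr)))))
    (÷÷≤ X (prime≥1 pr) (prime≥1 qr))

  𝟙-square : ∀ {P : Set} (d : Dec P) → 𝟙 d * 𝟙 d ≡ 𝟙 d
  𝟙-square (yes _) = ℚ.*-identityˡ 1ℚ
  𝟙-square (no _) = ℚ.*-zeroˡ 0ℚ

  -- A further prime `p` adds its diagonal term, at most `X / p`, and twice the mixed terms.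
  -- Distinct primes divide simultaneously at most `X / (p q)` times, so the mixed terms sum to at
  -- most `X / p` times the reciprocals of the others.
  ∑-ω² : ∀ X ps → All Prime ps → Unique ps → ∑ [1… X ] (λ n → ω ps n * ω ps n) ≤ ⟦ X ⟧ * (recip ps * recip ps + recip ps)
  ∑-ω² X [] _ _ = ℚ.≤-reflexive (trans (∑-zero [1… X ] (λ _ _ → ℚ.*-zeroˡ 0ℚ)) (eq ⟦ X ⟧))
    where
    eq : ∀ x → 0ℚ ≡ x * (0ℚ * 0ℚ + 0ℚ)
    eq = Solver.solve-∀ ring
  ∑-ω² X (p ∷ ps) (pr All.∷ prs) (p∉ AllPairs.∷ un) = subst (_≤ ⟦ X ⟧ * (recip (p ∷ ps) * recip (p ∷ ps) + recip (p ∷ ps))) (sym expand)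
      (by-diff (0≤+ (diff single) (0≤+ (0≤* 0≤2 (diff cross)) (0≤+ (diff (∑-ω² X ps prs un)) (0≤* (0≤⟦⟧ X) (square-nonneg (inv p))))))
        (eq ⟦ X ⟧ (inv p) (recip ps) (∑ [1… X ] e) (∑ [1… X ] (λ n → e n * ω ps n)) (∑ [1… X ] (λ n → ω ps n * ω ps n))))
    where
    e : ℕ → ℚ
    e n = 𝟙 (p ∣? n)
    eq : ∀ x i s a b c → x * ((i + s) * (i + s) + (i + s)) - (a + (2ℚ * b + c)) ≡ (i * x - a) + (2ℚ * (i * x * s - b) + ((x * (s * s + s) - c) + x * (i * i)))
    eq = Solver.solve-∀ ring
    pointwise : ∀ a b → a * a ≡ a → (a + b) * (a + b) ≡ a + (2ℚ * (a * b) + b * b)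
    pointwise a b h = trans (sq a b) (cong (_+ (2ℚ * (a * b) + b * b)) h)
      where
      sq : ∀ a b → (a + b) * (a + b) ≡ a * a + (2ℚ * (a * b) + b * b)
      sq = Solver.solve-∀ ring
    expand : ∑ [1… X ] (λ n → ω (p ∷ ps) n * ω (p ∷ ps) n) ≡ ∑ [1… X ] e + (2ℚ * ∑ [1… X ] (λ n → e n * ω ps n) + ∑ [1… X ] (λ n → ω ps n * ω ps n))
    expand = trans (∑-cong [1… X ] (λ n _ → pointwise (e n) (ω ps n) (𝟙-square (p ∣? n))))
      (trans (∑-+ [1… X ] e (λ n → 2ℚ * (e n * ω ps n) + ω ps n * ω ps n)) (cong (∑ [1… X ] e +_)
        (trans (∑-+ [1… X ] (λ n → 2ℚ * (e n * ω ps n)) (λ n → ω ps n * ω ps n)) (cong (_+ ∑ [1… X ] (λ n → ω ps n * ω ps n)) (∑-* [1… X ] 2ℚ (λ n → e n * ω ps n))))))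
    single : ∑ [1… X ] e ≤ inv p * ⟦ X ⟧
    single = subst (_≤ inv p * ⟦ X ⟧) (sym (count-multiples X (prime≥1 pr))) (÷≤ℚ X (prime≥1 pr))
    cross : ∑ [1… X ] (λ n → e n * ω ps n) ≤ inv p * ⟦ X ⟧ * recip ps
    cross = ≤-resp (sym (trans (∑-cong [1… X ] (λ n _ → sym (∑-* ps (e n) (λ q → 𝟙 (q ∣? n))))) (∑-swap [1… X ] ps (λ n q → e n * 𝟙 (q ∣? n)))))
      (trans (∑-cong ps (λ q _ → comm (inv p) (inv q) ⟦ X ⟧)) (∑-* ps (inv p * ⟦ X ⟧) inv))
      (∑-mono ps {λ q → ∑ [1… X ] (λ n → e n * 𝟙 (q ∣? n))} {λ q → inv p * inv q * ⟦ X ⟧} (λ q q∈ → joint-multiples X pr (All.lookup prs q∈) (All.lookup p∉ q∈)))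
      where
      comm : ∀ a b c → a * b * c ≡ a * c * b
      comm = Solver.solve-∀ ring

  -- In the expanded square the second moment is bounded from above and the first from below. The
  -- main terms `X S²` cancel, and the floors in the first moment leave the term with `length ps`.
  variance : ∀ X ps → All Prime ps → Unique ps →
    ∑ [1… X ] (λ n → (ω ps n - recip ps) * (ω ps n - recip ps)) ≤ ⟦ X ⟧ * recip ps + 2ℚ * (⟦ length ps ⟧ * recip ps)
  variance X ps prs un = subst (_≤ ⟦ X ⟧ * S + 2ℚ * (⟦ length ps ⟧ * S)) (sym expand)
      (by-diff (0≤+ (diff (∑-ω² X ps prs un)) (0≤* (0≤* 0≤2 (0≤recip ps)) (diff (∑-ω-lower X ps prs))))
        (eq ⟦ X ⟧ S ⟦ length ps ⟧ (∑ [1… X ] (ω ps)) (∑ [1… X ] (λ n → ω ps n * ω ps n))))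
    where
    S = recip ps
    eq : ∀ x s k a b → x * s + 2ℚ * (k * s) - (b + (x * (s * s) + (- (2ℚ * s)) * a)) ≡ (x * (s * s + s) - b) + 2ℚ * s * (a + k - x * s)
    eq = Solver.solve-∀ ring
    sq : ∀ a s → (a - s) * (a - s) ≡ a * a + (s * s + (- (2ℚ * s)) * a)
    sq = Solver.solve-∀ ring
    expand : ∑ [1… X ] (λ n → (ω ps n - S) * (ω ps n - S)) ≡ ∑ [1… X ] (λ n → ω ps n * ω ps n) + (⟦ X ⟧ * (S * S) + (- (2ℚ * S)) * ∑ [1… X ] (ω ps))
    expand = trans (∑-cong [1… X ] (λ n _ → sq (ω ps n) S))
      (trans (∑-+ [1… X ] (λ n → ω ps n * ω ps n) (λ n → S * S + (- (2ℚ * S)) * ω ps n)) (cong (∑ [1… X ] (λ n → ω ps n * ω ps n) +_)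
        (trans (∑-+ [1… X ] (λ _ → S * S) (λ n → (- (2ℚ * S)) * ω ps n)) (cong₂ _+_ (trans (∑-const [1… X ] (S * S)) (cong (λ t → ⟦ t ⟧ * (S * S)) (length-[1…] X)))
          (∑-* [1… X ] (- (2ℚ * S)) (ω ps))))))

  -- Cauchy-Schwarz without a square root: `2 S c |z| ≤ c² z² + S²` is summed over `n`. The
  -- hypotheses `c² ≤ S` and `length ps * c² ≤ X` bound `c²` times the variance by `3 S² X`, so the
  -- total is at most `4 S² X`, and dividing by `2 S` leaves the claim.
  deviation : ∀ X ps c → All Prime ps → Unique ps → 1 ℕ.≤ c → ⟦ c ⟧ * ⟦ c ⟧ ≤ recip ps → ⟦ length ps ⟧ * (⟦ c ⟧ * ⟦ c ⟧) ≤ ⟦ X ⟧ →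
    ⟦ c ⟧ * ∑ [1… X ] (λ n → ∣ ω ps n - recip ps ∣) ≤ 2ℚ * (recip ps * ⟦ X ⟧)
  deviation X ps c prs un 1≤c hS hX = *-cancel-≤ (2ℚ * S) 0<2S
      (by-diff (0≤+ (diff summed) (0≤+ (0≤* (0≤* (0≤⟦⟧ c) (0≤⟦⟧ c)) (diff (variance X ps prs un)))
           (0≤+ (0≤* (0≤* 0≤S (0≤⟦⟧ X)) (diff hS)) (0≤+ (0≤* (0≤* 0≤2 0≤S) (diff hX)) (0≤* (0≤* (0≤* 0≤2 0≤S) (0≤⟦⟧ X)) (diff 1≤S))))))
        (eq S ⟦ X ⟧ ⟦ c ⟧ ⟦ length ps ⟧ A V))
    where
    S = recip ps
    z : ℕ → ℚ
    z n = ω ps n - S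
    A = ∑ [1… X ] (λ n → ∣ z n ∣)
    V = ∑ [1… X ] (λ n → z n * z n)
    0≤S : 0ℚ ≤ S
    0≤S = 0≤recip ps
    1≤c² : 1ℚ ≤ ⟦ c ⟧ * ⟦ c ⟧
    1≤c² = by-diff (0≤+ (0≤* (0≤⟦⟧ c) (diff (1≤⟦⟧ 1≤c))) (diff (1≤⟦⟧ 1≤c))) (eq₁ ⟦ c ⟧)
      where
      eq₁ : ∀ x → x * x - 1ℚ ≡ x * (x - 1ℚ) + (x - 1ℚ)
      eq₁ = Solver.solve-∀ ring
    1≤S : 1ℚ ≤ S
    1≤S = ℚ.≤-trans 1≤c² hS
    0<2S : 0ℚ < 2ℚ * S
    0<2S = ℚ.<-≤-trans 0<1 (by-diff (0≤+ (diff 1≤S) 0≤S) (eq₂ S))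
      where
      eq₂ : ∀ s → 2ℚ * s - 1ℚ ≡ s - 1ℚ + s
      eq₂ = Solver.solve-∀ ring
    eq : ∀ s x c k a v → 2ℚ * s * (2ℚ * (s * x)) - 2ℚ * s * (c * a)
        ≡ (c * c * v + x * (s * s) - 2ℚ * (s * c) * a) + (c * c * (x * s + 2ℚ * (k * s) - v) + (s * x * (s - c * c) + (2ℚ * s * (x - k * (c * c)) + 2ℚ * s * x * (s - 1ℚ))))
    eq = Solver.solve-∀ ring
    ∣∣² : ∀ x → ∣ x ∣ * ∣ x ∣ ≡ x * x
    ∣∣² x with ℚ.∣p∣≡p∨∣p∣≡-p x
    ... | inj₁ e = cong₂ _*_ e e
    ... | inj₂ e = trans (cong₂ _*_ e e) (neg² x)
      where
      neg² : ∀ x → - x * - x ≡ x * x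
      neg² = Solver.solve-∀ ring
    am-gm : ∀ n → 2ℚ * (S * ⟦ c ⟧) * ∣ z n ∣ ≤ ⟦ c ⟧ * ⟦ c ⟧ * (z n * z n) + S * S
    am-gm n = subst (λ t → 2ℚ * (S * ⟦ c ⟧) * ∣ z n ∣ ≤ ⟦ c ⟧ * ⟦ c ⟧ * t + S * S) (∣∣² (z n))
      (by-diff (square-nonneg (⟦ c ⟧ * ∣ z n ∣ - S)) (eq₃ S ⟦ c ⟧ ∣ z n ∣))
      where
      eq₃ : ∀ s c a → c * c * (a * a) + s * s - 2ℚ * (s * c) * a ≡ (c * a - s) * (c * a - s)
      eq₃ = Solver.solve-∀ ring
    summed : 2ℚ * (S * ⟦ c ⟧) * A ≤ ⟦ c ⟧ * ⟦ c ⟧ * V + ⟦ X ⟧ * (S * S)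
    summed = ≤-resp (∑-* [1… X ] (2ℚ * (S * ⟦ c ⟧)) (λ n → ∣ z n ∣))
      (trans (∑-+ [1… X ] (λ n → ⟦ c ⟧ * ⟦ c ⟧ * (z n * z n)) (λ _ → S * S)) (cong₂ _+_ (∑-* [1… X ] (⟦ c ⟧ * ⟦ c ⟧) (λ n → z n * z n))
        (trans (∑-const [1… X ] (S * S)) (cong (λ t → ⟦ t ⟧ * (S * S)) (length-[1…] X)))))
      (∑-mono [1… X ] (λ n _ → am-gm n))

  module _ (f : ℕ → ℚ) (∣f∣≤1 : ∀ {n} → 1 ℕ.≤ n → ∣ f n ∣ ≤ 1ℚ)
           (f-prime : ∀ {p n} → Prime p → 1 ℕ.≤ n → ¬ p ∣ n → f (p ℕ.* n) ≡ - f n) where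

    private
      F : ℕ → ℚ
      F X = ∑ [1… X ] f

    -- Replace `S` by `ω` in `S F(X)`, at the cost of `deviation`. The sum of `f n * ω n` runs over
    -- all `f(p m)` with `m ≤ X/p`, and `f(p m) = −f(m)` unless `p` divides `m`. These exceptions
    -- cost `2 X / p²` for each `p`, and `c ≤ p` makes their total `2 S X / c` as well.
    turan-kubilius : ∀ X ps c → All Prime ps → Unique ps → All (c ℕ.≤_) ps → 1 ℕ.≤ c →
      ⟦ c ⟧ * ⟦ c ⟧ ≤ recip ps → ⟦ length ps ⟧ * (⟦ c ⟧ * ⟦ c ⟧) ≤ ⟦ X ⟧ →
      ⟦ c ⟧ * ∣ recip ps * F X + ∑ ps (λ p → F (X ÷ p)) ∣ ≤ 4ℚ * (recip ps * ⟦ X ⟧)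
    turan-kubilius X ps c prs un c≤ 1≤c hS hX =
        by-diff (0≤+ (0≤* (0≤⟦⟧ c) (diff triangle)) (0≤+ (diff (deviation X ps c prs un 1≤c hS hX)) (diff second)))
          (eq ⟦ c ⟧ S ⟦ X ⟧ ∣ S * F X + ∑ ps (λ p → F (X ÷ p)) ∣ A B)
      where
      S = recip ps
      A = ∑ [1… X ] (λ n → ∣ ω ps n - S ∣)
      B = ∑ ps (λ p → 2ℚ * ⟦ X ÷ p ÷ p ⟧)
      eq : ∀ c s x t a b → 4ℚ * (s * x) - c * t ≡ c * (a + b - t) + ((2ℚ * (s * x) - c * a) + (2ℚ * (s * x) - c * b))
      eq = Solver.solve-∀ ring
      second : ⟦ c ⟧ * B ≤ 2ℚ * (S * ⟦ X ⟧)
      second = ≤-resp (∑-* ps ⟦ c ⟧ (λ p → 2ℚ * ⟦ X ÷ p ÷ p ⟧))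
        (trans (∑-* ps 2ℚ (λ p → ⟦ X ⟧ * inv p)) (cong (2ℚ *_) (trans (∑-* ps ⟦ X ⟧ inv) (ℚ.*-comm ⟦ X ⟧ S))))
        (∑-mono ps {λ p → ⟦ c ⟧ * (2ℚ * ⟦ X ÷ p ÷ p ⟧)} {λ p → 2ℚ * (⟦ X ⟧ * inv p)} term)
        where
        term : ∀ p → p ∈ ps → ⟦ c ⟧ * (2ℚ * ⟦ X ÷ p ÷ p ⟧) ≤ 2ℚ * (⟦ X ⟧ * inv p)
        term p p∈ = by-diff (0≤+ (0≤* (0≤* 0≤2 (0≤⟦⟧ c)) (diff (÷÷≤ X 1≤p 1≤p))) (0≤* (0≤* (0≤* 0≤2 (0≤inv p)) (0≤⟦⟧ X)) (diff c/p≤1)))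
          (eq₁ ⟦ c ⟧ (inv p) ⟦ X ⟧ ⟦ X ÷ p ÷ p ⟧)
          where
          1≤p : 1 ℕ.≤ p
          1≤p = prime≥1 (All.lookup prs p∈)
          c/p≤1 : inv p * ⟦ c ⟧ ≤ 1ℚ
          c/p≤1 = subst (inv p * ⟦ c ⟧ ≤_) (inv-inverse 1≤p) (by-diff (0≤* (0≤inv p) (diff (⟦⟧-mono (All.lookup c≤ p∈)))) (eq₂ (inv p) ⟦ p ⟧ ⟦ c ⟧))
            where
            eq₂ : ∀ i p c → i * p - i * c ≡ i * (p - c)
            eq₂ = Solver.solve-∀ ring
          eq₁ : ∀ c i x y → 2ℚ * (x * i) - c * (2ℚ * y) ≡ 2ℚ * c * (i * i * x - y) + 2ℚ * i * x * (1ℚ - i * c)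
          eq₁ = Solver.solve-∀ ring
      split : S * F X + ∑ ps (λ p → F (X ÷ p)) ≡ ∑ [1… X ] (λ n → f n * (S - ω ps n)) + ∑ ps (λ p → ∑ [1… X ÷ p ] (λ m → f (p ℕ.* m) + f m))
      split = trans (cong (_+ ∑ ps (λ p → F (X ÷ p))) (trans (sym (∑-* [1… X ] S f)) (trans (∑-cong [1… X ] (λ n _ → eq₃ S (f n) (ω ps n)))
          (trans (∑-+ [1… X ] (λ n → f n * (S - ω ps n)) (λ n → f n * ω ps n)) (cong (∑ [1… X ] (λ n → f n * (S - ω ps n)) +_) inner)))))
        (trans (ℚ.+-assoc (∑ [1… X ] (λ n → f n * (S - ω ps n))) _ _) (cong (∑ [1… X ] (λ n → f n * (S - ω ps n)) +_)
          (sym (trans (∑-cong ps (λ p _ → ∑-+ [1… X ÷ p ] (λ m → f (p ℕ.* m)) f)) (∑-+ ps (λ p → ∑ [1… X ÷ p ] (λ m → f (p ℕ.* m))) (λ p → F (X ÷ p)))))))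
        where
        eq₃ : ∀ s a u → s * a ≡ a * (s - u) + a * u
        eq₃ = Solver.solve-∀ ring
        inner : ∑ [1… X ] (λ n → f n * ω ps n) ≡ ∑ ps (λ p → ∑ [1… X ÷ p ] (λ m → f (p ℕ.* m)))
        inner = trans (∑-cong [1… X ] (λ n _ → sym (∑-* ps (f n) (λ p → 𝟙 (p ∣? n)))))
          (trans (∑-swap [1… X ] ps (λ n p → f n * 𝟙 (p ∣? n)))
            (∑-cong ps (λ p p∈ → trans (∑-cong [1… X ] (λ n _ → ℚ.*-comm (f n) (𝟙 (p ∣? n)))) (∑-multiples X f (prime≥1 (All.lookup prs p∈))))))
      first≤ : ∣ ∑ [1… X ] (λ n → f n * (S - ω ps n)) ∣ ≤ A
      first≤ = ∑-abs-≤ [1… X ] (λ n n∈ → ≤-resp refl (ℚ.*-identityˡ ∣ ω ps n - S ∣)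
        (∣∣-*-≤ {f n} {S - ω ps n} (∣f∣≤1 (proj₁ (∈[1…]⁻ X n∈))) (ℚ.≤-reflexive (trans (cong ∣_∣ (eq₄ S (ω ps n))) (ℚ.∣-p∣≡∣p∣ (ω ps n - S))))))
        where
        eq₄ : ∀ s u → s - u ≡ - (u - s)
        eq₄ = Solver.solve-∀ ring
      pair≤ : ∀ {p} m → Prime p → 1 ℕ.≤ m → ∣ f (p ℕ.* m) + f m ∣ ≤ 2ℚ * 𝟙 (p ∣? m)
      pair≤ {p} m pr 1≤m with p ∣? m
      ... | yes _ = subst (∣ f (p ℕ.* m) + f m ∣ ≤_) (sym (ℚ.*-identityʳ 2ℚ))
            (ℚ.≤-trans (ℚ.∣p+q∣≤∣p∣+∣q∣ (f (p ℕ.* m)) (f m)) (ℚ.+-mono-≤ (∣f∣≤1 (ℕ.*-mono-≤ (prime≥1 pr) 1≤m)) (∣f∣≤1 1≤m)))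
      ... | no p∤m = ℚ.≤-reflexive (trans (cong ∣_∣ (trans (cong (_+ f m) (f-prime pr 1≤m p∤m)) (ℚ.+-inverseˡ (f m)))) (sym (ℚ.*-zeroʳ 2ℚ)))
      second≤ : ∣ ∑ ps (λ p → ∑ [1… X ÷ p ] (λ m → f (p ℕ.* m) + f m)) ∣ ≤ B
      second≤ = ∑-abs-≤ ps (λ p p∈ → subst (∣ ∑ [1… X ÷ p ] (λ m → f (p ℕ.* m) + f m) ∣ ≤_)
        (trans (∑-* [1… X ÷ p ] 2ℚ (λ m → 𝟙 (p ∣? m))) (cong (2ℚ *_) (count-multiples (X ÷ p) (prime≥1 (All.lookup prs p∈)))))
        (∑-abs-≤ [1… X ÷ p ] (λ m m∈ → pair≤ m (All.lookup prs p∈) (proj₁ (∈[1…]⁻ (X ÷ p) m∈)))))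
      triangle : ∣ S * F X + ∑ ps (λ p → F (X ÷ p)) ∣ ≤ A + B
      triangle = subst (λ t → ∣ t ∣ ≤ A + B) (sym split) (ℚ.≤-trans (ℚ.∣p+q∣≤∣p∣+∣q∣ (∑ [1… X ] (λ n → f n * (S - ω ps n))) (∑ ps (λ p → ∑ [1… X ÷ p ] (λ m → f (p ℕ.* m) + f m)))) (ℚ.+-mono-≤ first≤ second≤))

-- Paired primes of nearly constant ratio with large reciprocal sums

module PrimeFamilies where
  open Rationals
  open Sums
  open Division
  open PrimeCounts
  open PopularCells
  open TuranKubilius using (recip)

  -- The terms from `n + 1` to `2 n` are each at least `1 / (2 n)`, so every doubling adds at least
  -- one half.
  harmonic-lower : ∀ j → ½ * ⟦ j ⟧ ≤ ∑ [1… 2 ℕ.^ j ] inv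
  harmonic-lower zero = subst (_≤ inv 1 + 0ℚ) (sym (trans (cong (½ *_) ι0) (ℚ.*-zeroʳ ½))) (0≤+ (0≤inv 1) ℚ.≤-refl)
  harmonic-lower (suc j) = subst (½ * ⟦ suc j ⟧ ≤_) (sym (trans (cong (λ t → ∑ [1… t ] inv) (2^-suc j)) (∑-split n n inv)))
      (subst (_≤ ∑ [1… n ] inv + ∑ [1… n ] (λ k → inv (n ℕ.+ k))) (sym (trans (cong (½ *_) (⟦⟧-suc j)) (eq ½ ⟦ j ⟧)))
        (ℚ.+-mono-≤ (harmonic-lower j) half))
    where
    n = 2 ℕ.^ j
    eq : ∀ h j → h * (1ℚ + j) ≡ h * j + h
    eq = Solver.solve-∀ ring
    half : ½ ≤ ∑ [1… n ] (λ k → inv (n ℕ.+ k))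
    half = subst (_≤ ∑ [1… n ] (λ k → inv (n ℕ.+ k)))
      (trans (∑-const [1… n ] (inv (n ℕ.+ n))) (trans (cong (λ t → ⟦ t ⟧ * inv (n ℕ.+ n)) (length-[1…] n))
        (halve ⟦ n ⟧ (inv (n ℕ.+ n)) (trans (cong (inv (n ℕ.+ n) *_) (sym (⟦⟧-+ n n))) (inv-inverse (ℕ.≤-trans (1≤2^ j) (ℕ.m≤m+n n n)))))))
      (∑-mono [1… n ] (λ k k∈ → inv-antitone (ℕ.≤-trans (1≤2^ j) (ℕ.m≤m+n n k)) (ℕ.+-monoʳ-≤ n (proj₂ (∈[1…]⁻ n k∈)))))
      where
      halve : ∀ x i → i * (x + x) ≡ 1ℚ → x * i ≡ ½
      halve x i e = trans (eq₁ x i) (trans (cong (½ *_) e) (ℚ.*-identityʳ ½))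
        where
        eq₁ : ∀ x i → x * i ≡ ½ * (i * (x + x))
        eq₁ = Solver.solve-∀ ring

  [1…]-unique : ∀ n → Unique [1… n ]
  [1…]-unique zero = AllPairs.[]
  [1…]-unique (suc n) = All.tabulate (λ k∈ e → ℕ.<⇒≱ (ℕ.≤-reflexive e) (proj₂ (∈[1…]⁻ n k∈))) AllPairs.∷ [1…]-unique n

  ∑-filter : ∀ {A : Set} {P : A → Set} (P? : ∀ x → Dec (P x)) (xs : List A) f → ∑ (filter P? xs) f ≡ ∑ xs (λ x → 𝟙 (P? x) * f x)
  ∑-filter P? [] f = refl
  ∑-filter P? (x ∷ xs) f with P? x
  ... | yes _ = cong₂ _+_ (sym (ℚ.*-identityˡ (f x))) (∑-filter P? xs f)
  ... | no _ = trans (∑-filter P? xs f) (sym (trans (cong (_+ ∑ xs (λ x → 𝟙 (P? x) * f x)) (ℚ.*-zeroˡ (f x))) (ℚ.+-identityˡ _)))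

  map-proj₁-zip : ∀ {A B : Set} (xs : List A) (ys : List B) → length xs ≡ length ys → map proj₁ (zip xs ys) ≡ xs
  map-proj₁-zip [] ys e = refl
  map-proj₁-zip (x ∷ xs) (y ∷ ys) e = cong (x ∷_) (map-proj₁-zip xs ys (ℕ.suc-injective e))

  map-proj₂-zip : ∀ {A B : Set} (xs : List A) (ys : List B) → length xs ≡ length ys → map proj₂ (zip xs ys) ≡ ys
  map-proj₂-zip [] [] e = refl
  map-proj₂-zip (x ∷ xs) (y ∷ ys) e = cong (y ∷_) (map-proj₂-zip xs ys (ℕ.suc-injective e))

  All-zip : ∀ {A B : Set} {P : A → Set} {R : B → Set} {xs ys} → All P xs → All R ys → All (λ z → P (proj₁ z) × R (proj₂ z)) (zip xs ys)
  All-zip All.[] _ = All.[]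
  All-zip (_ All.∷ _) All.[] = All.[]
  All-zip (p All.∷ ps) (q All.∷ qs) = (p , q) All.∷ All-zip ps qs

  -- In `located`, `G` may differ from pair to pair, while `a` and `b` are common to all. As both
  -- indices are at least `Q`, each prime is known up to a relative error 1/Q, so the ratio of a
  -- pair is b/a up to O(1/Q). The bounds `c` and `R` serve the hypotheses of `turan-kubilius`.
  record Family (Q d D c R : ℕ) : Set where
    field
      a b : ℕ
      Q≤a : Q ℕ.≤ a
      a<32Q : a ℕ.< 32 ℕ.* Q
      gap : a ℕ.+ d ℕ.≤ b
      close : b ℕ.< a ℕ.+ D
      pairs : List (ℕ × ℕ)
      prime₁ : All (λ z → Prime (proj₁ z)) pairs
      prime₂ : All (λ z → Prime (proj₂ z)) pairs
      large₁ : All (λ z → c ℕ.≤ proj₁ z) pairs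
      large₂ : All (λ z → c ℕ.≤ proj₂ z) pairs
      located : All (λ z → ∃ λ G → (G ℕ.* a ℕ.< proj₁ z × proj₁ z ℕ.≤ G ℕ.* suc a) × (G ℕ.* b ℕ.< proj₂ z × proj₂ z ℕ.≤ G ℕ.* suc b)) pairs
      unique₁ : Unique (map proj₁ pairs)
      unique₂ : Unique (map proj₂ pairs)
      abundant₁ : ⟦ R ⟧ ≤ recip (map proj₁ pairs)
      abundant₂ : ⟦ R ⟧ ≤ recip (map proj₂ pairs)

  module BuildFamily (e r c R : ℕ) where
    q Q d D N : ℕ
    q = suc (e ℕ.+ e ℕ.+ 11) ℕ.+ r
    Q = 2 ℕ.^ q
    d = 2 ℕ.^ r
    D = 2 ℕ.^ e ℕ.* 4096 ℕ.* d
    -- The summands 8 and `q` meet the hypotheses of `Scale.1≤k`. The summand `c` gives `c ≤ G n`,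
    -- and all primes in cells of positive index exceed `G n`.
    N = 8 ℕ.+ (q ℕ.+ c)

    level : ℕ → ℕ
    level n = N ℕ.+ n

    G m k : ℕ → ℕ
    G n = 2 ℕ.^ level n
    m n = level n ℕ.+ q
    k n = Scale.k e r (level n)

    8≤level : ∀ n → 8 ℕ.≤ level n
    8≤level n = ℕ.≤-trans (ℕ.m≤m+n 8 (q ℕ.+ c)) (ℕ.m≤m+n N n)

    q≤level : ∀ n → q ℕ.≤ level n
    q≤level n = ℕ.≤-trans (ℕ.≤-trans (ℕ.m≤m+n q c) (ℕ.m≤n+m (q ℕ.+ c) 8)) (ℕ.m≤m+n N n)

    c≤G : ∀ n → c ℕ.≤ G n
    c≤G n = ℕ.≤-trans (ℕ.≤-trans (ℕ.≤-trans (ℕ.m≤n+m c q) (ℕ.m≤n+m (q ℕ.+ c) 8)) (ℕ.m≤m+n N n)) (ℕ.<⇒≤ (n<2^n (level n)))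
      where
      n<2^n : ∀ n → n ℕ.< 2 ℕ.^ n
      n<2^n zero = s≤s z≤n
      n<2^n (suc n) = subst (suc (suc n) ℕ.≤_) (sym (2^-suc n)) (ℕ.+-mono-≤ (1≤2^ n) (n<2^n n))

    popular : ∀ n → ∃₂ λ a b → Q ℕ.≤ a × a ℕ.+ d ℕ.≤ b × b ℕ.< a ℕ.+ D × b ℕ.< 32 ℕ.* Q × k n ℕ.≤ cells (G n) a 1 × k n ℕ.≤ cells (G n) b 1
    popular n = Scale.popular-pair e r (level n) (ℕ.≤-trans (ℕ.m≤m+n 5 3) (ℕ.≤-trans (8≤level n) (ℕ.m≤m+n (level n) q)))

    label : ℕ → ℕ × ℕ
    label n = proj₁ (popular n) , proj₁ (proj₂ (popular n))

    labels : List (ℕ × ℕ)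
    labels = cartesianProduct [1… 32 ℕ.* Q ] [1… 32 ℕ.* Q ]

    label∈labels : ∀ n → label n ∈ labels
    label∈labels n = in-range (proj₁ bounds) (proj₁ (proj₂ bounds)) (proj₁ (proj₂ (proj₂ (proj₂ bounds))))
      where
      bounds = proj₂ (proj₂ (popular n))
      in-range : ∀ {a b} → Q ℕ.≤ a → a ℕ.+ d ℕ.≤ b → b ℕ.< 32 ℕ.* Q → (a , b) ∈ labels
      in-range {a} {b} Q≤a gap b< = ∈-cartesianProduct⁺
        (∈[1…]⁺ (32 ℕ.* Q) 1≤a (ℕ.≤-trans a≤b (ℕ.<⇒≤ b<)))
        (∈[1…]⁺ (32 ℕ.* Q) (ℕ.≤-trans 1≤a a≤b) (ℕ.<⇒≤ b<))
        where
        1≤a : 1 ℕ.≤ a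
        1≤a = ℕ.≤-trans (1≤2^ q) Q≤a
        a≤b : a ℕ.≤ b
        a≤b = ℕ.≤-trans (ℕ.m≤m+n a d) gap

    _≟ₗ_ : (x y : ℕ × ℕ) → Dec (x ≡ y)
    _≟ₗ_ = ≡-dec ℕ._≟_ ℕ._≟_

    -- Chosen backwards. A level adds at least `1 / (2048 Q level)` to the reciprocal sum
    -- (`chosen-recip`), so a label of weight `R′` yields `R`. All labels together call for weight
    -- `length labels * R′`; as `1/(N + n) ≥ 1/((N + 1) n)` and the harmonic sum up to `2 ^ j` is at
    -- least `j / 2`, this `j` provides it.
    j T R′ : ℕ
    R′ = Q ℕ.* 2048 ℕ.* R
    j = 2 ℕ.* (suc N ℕ.* (length labels ℕ.* R′))
    T = 2 ℕ.^ j

    weight : ℕ → ℚ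
    weight n = inv (level n)

    1≤level : ∀ n → 1 ℕ.≤ level n
    1≤level n = ℕ.≤-trans (s≤s z≤n) (8≤level n)

    total : ⟦ length labels ⟧ * ⟦ R′ ⟧ ≤ ∑ [1… T ] weight
    total = ℚ.≤-trans (≤inv* {x = ⟦ length labels ⟧ * ⟦ R′ ⟧} {n = suc N} (s≤s z≤n) (subst (_≤ ∑ [1… T ] inv) eq (harmonic-lower j)))
        (subst (_≤ ∑ [1… T ] weight) (∑-* [1… T ] (inv (suc N)) inv) (∑-mono [1… T ] {λ n → inv (suc N) * inv n} {weight} (λ n n∈ →
          subst (_≤ weight n) (inv-* (s≤s z≤n) (proj₁ (∈[1…]⁻ T n∈)))
            (inv-antitone (1≤level n) (ℕ.≤-trans (ℕ.≤-reflexive (ℕ.+-comm N n)) (ℕ.+-monoʳ-≤ n (subst (ℕ._≤ N ℕ.* n) (ℕ.*-identityʳ N) (ℕ.*-monoʳ-≤ N (proj₁ (∈[1…]⁻ T n∈))))))))))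
      where
      eq : ½ * ⟦ j ⟧ ≡ ⟦ suc N ⟧ * (⟦ length labels ⟧ * ⟦ R′ ⟧)
      eq = trans (cong (½ *_) (trans (⟦⟧-+ Z (Z ℕ.+ 0)) (cong (λ t → ⟦ Z ⟧ + ⟦ t ⟧) (ℕ.+-identityʳ Z))))
        (trans (dbl ⟦ Z ⟧) (trans (⟦⟧-* (suc N) (length labels ℕ.* R′)) (cong (⟦ suc N ⟧ *_) (⟦⟧-* (length labels) R′))))
        where
        Z = suc N ℕ.* (length labels ℕ.* R′)
        dbl : ∀ z → ½ * (z + z) ≡ z
        dbl = Solver.solve-∀ ring

    private
      -- Each level votes for its own label with its weight; by `total`, some label receives at
      -- least `R′`.
      best : ∃ λ ℓ → ℓ ∈ labels × ⟦ R′ ⟧ ≤ ∑ [1… T ] (λ n → 𝟙 (label n ≟ₗ ℓ) * weight n)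
      best = average labels ⟦ R′ ⟧ nonempty (ℚ.≤-trans total (subst (∑ [1… T ] weight ≤_) (sym (∑-swap labels [1… T ] (λ ℓ n → 𝟙 (label n ≟ₗ ℓ) * weight n)))
          (∑-mono [1… T ] (λ n _ → subst (_≤ ∑ labels (λ ℓ → 𝟙 (label n ≟ₗ ℓ) * weight n))
            (trans (cong (_* weight n) (𝟙-yes (label n ≟ₗ label n) refl)) (ℚ.*-identityˡ (weight n)))
            (∑-term labels {λ ℓ → 𝟙 (label n ≟ₗ ℓ) * weight n} (λ ℓ _ → 0≤* (0≤𝟙 (label n ≟ₗ ℓ)) (0≤inv (level n))) (label∈labels n))))))
        where
        nonempty : 1 ℕ.≤ length labels
        nonempty = inhabited (label∈labels 0)
          where
          inhabited : ∀ {x} {xs : List (ℕ × ℕ)} → x ∈ xs → 1 ℕ.≤ length xs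
          inhabited (here _) = s≤s z≤n
          inhabited (there _) = s≤s z≤n

    ℓ : ℕ × ℕ
    ℓ = proj₁ best

    a b : ℕ
    a = proj₁ ℓ
    b = proj₂ ℓ

    levels : List ℕ
    levels = filter (λ n → label n ≟ₗ ℓ) [1… T ]

    levels-weight : ⟦ R′ ⟧ ≤ ∑ levels weight
    levels-weight = subst (⟦ R′ ⟧ ≤_) (sym (∑-filter (λ n → label n ≟ₗ ℓ) [1… T ] weight)) (proj₂ (proj₂ best))

    -- Cut to `k n` primes, so that the lists of the two cells have equal length and zipping loses
    -- no prime.
    chosen : ℕ → ℕ → List ℕ
    chosen i n = take (k n) (primesIn (G n ℕ.* i) (G n ℕ.* 1))

    chosen-length : ∀ i n → k n ℕ.≤ cells (G n) i 1 → length (chosen i n) ≡ k n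
    chosen-length i n h = trans (length-take (k n) (primesIn (G n ℕ.* i) (G n ℕ.* 1))) (ℕ.m≤n⇒m⊓n≡m h)

    chosen-prime : ∀ i n → All Prime (chosen i n)
    chosen-prime i n = All.take⁺ (k n) (primesIn-prime (G n ℕ.* i) (G n ℕ.* 1))

    chosen-bounds : ∀ i n → All (λ p → G n ℕ.* i ℕ.< p × p ℕ.≤ G n ℕ.* suc i) (chosen i n)
    chosen-bounds i n = All.map (λ { (l , u) → l , ℕ.≤-trans u (ℕ.≤-reflexive (eq (G n) i)) }) (All.take⁺ (k n) (primesIn-bounds (G n ℕ.* i) (G n ℕ.* 1)))
      where
      eq : ∀ g i → g ℕ.* i ℕ.+ g ℕ.* 1 ≡ g ℕ.* suc i
      eq = ℕ-Solver.solve-∀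

    chosen-unique : ∀ i n → Unique (chosen i n)
    chosen-unique i n = Unique.take⁺ (k n) (primesIn-unique (G n ℕ.* i) (G n ℕ.* 1))

    -- There are `k n` primes, each at most `32 * 2 ^ m n`. Since `2^≤32Qmk` bounds `k n` from below
    -- and `m n ≤ 2 * level n`, the constant is `2048 = 32 * 32 * 2`.
    chosen-recip : ∀ i n → i ℕ.< 32 ℕ.* Q → k n ℕ.≤ cells (G n) i 1 → inv (Q ℕ.* 2048) * weight n ≤ recip (chosen i n)
    chosen-recip i n i< h = ℚ.≤-trans lower
        (subst (_≤ recip (chosen i n)) (trans (∑-const (chosen i n) (inv top)) (cong (λ t → ⟦ t ⟧ * inv top) (chosen-length i n h)))
          (∑-mono (chosen i n) (λ p p∈ → inv-antitone (prime≥1 (All.lookup (chosen-prime i n) p∈))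
            (ℕ.≤-trans (proj₂ (All.lookup (chosen-bounds i n) p∈)) (ℕ.≤-trans (ℕ.*-monoʳ-≤ (G n) i<) (ℕ.≤-reflexive eq₀))))))
      where
      open ℕ.≤-Reasoning
      top = 32 ℕ.* 2 ℕ.^ m n
      eq₀ : G n ℕ.* (32 ℕ.* Q) ≡ top
      eq₀ = trans (eq₁ (G n) Q) (cong (32 ℕ.*_) (sym (ℕ.^-distribˡ-+-* 2 (level n) q)))
        where
        eq₁ : ∀ g q → g ℕ.* (32 ℕ.* q) ≡ 32 ℕ.* (g ℕ.* q)
        eq₁ = ℕ-Solver.solve-∀
      1≤k : 1 ℕ.≤ k n
      1≤k = Scale.1≤k e r (level n) (8≤level n) (q≤level n)
      top≤ : top ℕ.≤ Q ℕ.* 2048 ℕ.* level n ℕ.* k n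
      top≤ = begin
        32 ℕ.* 2 ℕ.^ m n                               ≤⟨ ℕ.*-monoʳ-≤ 32 (Scale.2^≤32Qmk e r (level n) 1≤k) ⟩
        32 ℕ.* (32 ℕ.* Q ℕ.* (level n ℕ.+ q) ℕ.* k n)  ≤⟨ ℕ.*-monoʳ-≤ 32 (ℕ.*-monoˡ-≤ (k n) (ℕ.*-monoʳ-≤ (32 ℕ.* Q) (ℕ.+-monoʳ-≤ (level n) (q≤level n)))) ⟩
        32 ℕ.* (32 ℕ.* Q ℕ.* (level n ℕ.+ level n) ℕ.* k n)  ≡⟨ eq₂ Q (level n) (k n) ⟩
        Q ℕ.* 2048 ℕ.* level n ℕ.* k n                 ∎
        where
        eq₂ : ∀ q l k → 32 ℕ.* (32 ℕ.* q ℕ.* (l ℕ.+ l) ℕ.* k) ≡ q ℕ.* 2048 ℕ.* l ℕ.* k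
        eq₂ = ℕ-Solver.solve-∀
      1≤top : 1 ℕ.≤ top
      1≤top = ℕ.*-mono-≤ (s≤s (z≤n {31})) (1≤2^ (m n))
      1≤2048Q : 1 ℕ.≤ Q ℕ.* 2048
      1≤2048Q = ℕ.*-mono-≤ (1≤2^ q) (s≤s (z≤n {2047}))
      lower : inv (Q ℕ.* 2048) * weight n ≤ ⟦ k n ⟧ * inv top
      lower = subst (_≤ ⟦ k n ⟧ * inv top) (inv-* 1≤2048Q (1≤level n))
        (subst (inv (Q ℕ.* 2048 ℕ.* level n) ≤_) (ℚ.*-comm (inv top) ⟦ k n ⟧) (≤inv* 1≤top
          (subst (_≤ ⟦ k n ⟧) (ℚ.*-comm (inv (Q ℕ.* 2048 ℕ.* level n)) ⟦ top ⟧)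
            (inv*≤ (ℕ.*-mono-≤ 1≤2048Q (1≤level n)) (subst (⟦ top ⟧ ≤_) (⟦⟧-* (Q ℕ.* 2048 ℕ.* level n) (k n)) (⟦⟧-mono top≤))))))


    Facts : ℕ → ℕ × ℕ → Set
    Facts n (a , b) = Q ℕ.≤ a × a ℕ.+ d ℕ.≤ b × b ℕ.< a ℕ.+ D × b ℕ.< 32 ℕ.* Q × k n ℕ.≤ cells (G n) a 1 × k n ℕ.≤ cells (G n) b 1

    facts : ∀ {n} → n ∈ levels → Facts n ℓ
    facts {n} n∈ = subst (Facts n) (All.lookup (All.all-filter (λ n → label n ≟ₗ ℓ) [1… T ]) n∈) (proj₂ (proj₂ (popular n)))

    levels-unique : Unique levels
    levels-unique = Unique.filter⁺ (λ n → label n ≟ₗ ℓ) ([1…]-unique T)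

    gather : ∀ {A : Set} → (ℕ → List A) → List ℕ → List A
    gather f [] = []
    gather f (n ∷ ns) = f n ++ gather f ns

    gather-All : ∀ {A : Set} {P : A → Set} (f : ℕ → List A) ns → (∀ n → n ∈ ns → All P (f n)) → All P (gather f ns)
    gather-All f [] h = All.[]
    gather-All f (n ∷ ns) h = All.++⁺ (h n (here refl)) (gather-All f ns (λ n′ n∈ → h n′ (there n∈)))

    gather-map : ∀ {A B : Set} (g : A → B) (f : ℕ → List A) (f′ : ℕ → List B) ns → (∀ n → n ∈ ns → map g (f n) ≡ f′ n) → map g (gather f ns) ≡ gather f′ ns
    gather-map g f f′ [] h = refl
    gather-map g f f′ (n ∷ ns) h = trans (map-++ g (f n) (gather f ns)) (cong₂ _++_ (h n (here refl)) (gather-map g f f′ ns (λ n′ n∈ → h n′ (there n∈))))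

    gather-∑ : ∀ (f : ℕ → List ℕ) ns h → ∑ (gather f ns) h ≡ ∑ ns (λ n → ∑ (f n) h)
    gather-∑ f [] h = refl
    gather-∑ f (n ∷ ns) h = trans (∑-++ (f n) (gather f ns) h) (cong (∑ (f n) h +_) (gather-∑ f ns h))

    gather-unique : ∀ (f : ℕ → List ℕ) ns → Unique ns → (∀ n → Unique (f n)) →
      (∀ {n n′ p} → n ≢ n′ → p ∈ f n → ¬ p ∈ f n′) → Unique (gather f ns)
    gather-unique f [] _ _ _ = AllPairs.[]
    gather-unique f (n ∷ ns) (n∉ AllPairs.∷ un) uf disj = Unique.++⁺ (uf n) (gather-unique f ns un uf disj) λ (p∈ , p∈′) → outside ns n∉ p∈ p∈′
      where
      outside : ∀ {p} ns → All (n ≢_) ns → p ∈ f n → ¬ p ∈ gather f ns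
      outside (n′ ∷ ns) (n≢ All.∷ n≢s) p∈ p∈′ with ∈-++⁻ (f n′) p∈′
      ... | inj₁ q = disj n≢ p∈ q
      ... | inj₂ q = outside ns n≢s p∈ q

    -- From one level to the next `G` at least doubles, and for `i ≥ 1` the cell `(G i, G (i + 1)]`
    -- ends no later than `2 G i`.
    chosen-disjoint : ∀ i → 1 ℕ.≤ i → ∀ {n n′ p} → n ≢ n′ → p ∈ chosen i n → ¬ p ∈ chosen i n′
    chosen-disjoint i 1≤i {n} {n′} n≢n′ p∈ p∈′ = apart (ℕ.<-cmp n n′)
      where
      separate : ∀ {x y p} → x ℕ.< y → p ∈ chosen i x → ¬ p ∈ chosen i y
      separate {x} {y} {p} x<y p∈ p∈′ = ℕ.<⇒≱ (proj₁ (All.lookup (chosen-bounds i y) p∈′)) (begin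
        p                     ≤⟨ proj₂ (All.lookup (chosen-bounds i x) p∈) ⟩
        G x ℕ.* suc i         ≤⟨ ℕ.*-monoʳ-≤ (G x) (ℕ.+-monoˡ-≤ i 1≤i) ⟩
        G x ℕ.* (i ℕ.+ i)     ≡⟨ eq (G x) i ⟩
        2 ℕ.* G x ℕ.* i       ≤⟨ ℕ.*-monoˡ-≤ i (ℕ.^-monoʳ-≤ 2 (ℕ.≤-trans (ℕ.≤-reflexive (sym (ℕ.+-suc N x))) (ℕ.+-monoʳ-≤ N x<y))) ⟩
        G y ℕ.* i             ∎)
        where
        open ℕ.≤-Reasoning
        eq : ∀ g i → g ℕ.* (i ℕ.+ i) ≡ 2 ℕ.* g ℕ.* i
        eq = ℕ-Solver.solve-∀
      apart : _ → _
      apart (tri< n<n′ _ _) = separate n<n′ p∈ p∈′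
      apart (tri≈ _ n≡n′ _) = n≢n′ n≡n′
      apart (tri> _ _ n′<n) = separate n′<n p∈′ p∈

    family : 1 ℕ.≤ R → Family Q d D c R
    family 1≤R = record
      { a = a ; b = b ; Q≤a = Q≤a ; a<32Q = ℕ.≤-<-trans (ℕ.≤-trans (ℕ.m≤m+n a d) gap) b<32Q ; gap = gap ; close = proj₁ (proj₂ (proj₂ some))
      ; pairs = pairs
      ; prime₁ = gather-All pairsAt levels (λ n _ → All.map proj₁ (All-zip (chosen-prime a n) (chosen-prime b n)))
      ; prime₂ = gather-All pairsAt levels (λ n _ → All.map proj₂ (All-zip (chosen-prime a n) (chosen-prime b n)))
      ; large₁ = gather-All pairsAt levels (λ n _ → All.map proj₁ (All-zip (chosen-large a n 1≤a) (chosen-large b n 1≤b)))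
      ; large₂ = gather-All pairsAt levels (λ n _ → All.map proj₂ (All-zip (chosen-large a n 1≤a) (chosen-large b n 1≤b)))
      ; located = gather-All pairsAt levels (λ n _ → All.map (G n ,_) (All-zip (chosen-bounds a n) (chosen-bounds b n)))
      ; unique₁ = subst Unique (sym map₁) (gather-unique (chosen a) levels levels-unique (chosen-unique a) (chosen-disjoint a 1≤a))
      ; unique₂ = subst Unique (sym map₂) (gather-unique (chosen b) levels levels-unique (chosen-unique b) (chosen-disjoint b 1≤b))
      ; abundant₁ = subst (λ ps → ⟦ R ⟧ ≤ recip ps) (sym map₁) (abundant a (ℕ.≤-<-trans (ℕ.≤-trans (ℕ.m≤m+n a d) gap) b<32Q) (λ n∈ → proj₁ (proj₂ (proj₂ (proj₂ (proj₂ (facts n∈)))))))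
      ; abundant₂ = subst (λ ps → ⟦ R ⟧ ≤ recip ps) (sym map₂) (abundant b b<32Q (λ n∈ → proj₂ (proj₂ (proj₂ (proj₂ (proj₂ (facts n∈)))))))
      }
      where
      pairsAt : ℕ → List (ℕ × ℕ)
      pairsAt n = zip (chosen a n) (chosen b n)
      pairs = gather pairsAt levels
      -- The facts about `a` and `b` are read off at some selected level; an empty selection would
      -- have weight 0, below `R′`.
      member : ∀ ns → ⟦ R′ ⟧ ≤ ∑ ns weight → ∃ λ n → n ∈ ns
      member [] h = contradiction (ℕ.*-mono-≤ (ℕ.*-mono-≤ (1≤2^ q) (s≤s (z≤n {2047}))) 1≤R) (ℕ.<⇒≱ (s≤s (⟦⟧-cancel {R′} {0} (subst (⟦ R′ ⟧ ≤_) (sym ι0) h))))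
      member (n ∷ ns) h = n , here refl
      some : Q ℕ.≤ a × a ℕ.+ d ℕ.≤ b × b ℕ.< a ℕ.+ D × b ℕ.< 32 ℕ.* Q × _
      some = facts (proj₂ (member levels levels-weight))
      Q≤a : Q ℕ.≤ a
      Q≤a = proj₁ some
      gap : a ℕ.+ d ℕ.≤ b
      gap = proj₁ (proj₂ some)
      b<32Q : b ℕ.< 32 ℕ.* Q
      b<32Q = proj₁ (proj₂ (proj₂ (proj₂ some)))
      1≤a : 1 ℕ.≤ a
      1≤a = ℕ.≤-trans (1≤2^ q) Q≤a
      1≤b : 1 ℕ.≤ b
      1≤b = ℕ.≤-trans 1≤a (ℕ.≤-trans (ℕ.m≤m+n a d) gap)
      chosen-large : ∀ i n → 1 ℕ.≤ i → All (c ℕ.≤_) (chosen i n)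
      chosen-large i n 1≤i = All.map (λ { (l , _) → ℕ.≤-trans (c≤G n) (ℕ.≤-trans (ℕ.≤-trans (ℕ.≤-reflexive (sym (ℕ.*-identityʳ (G n)))) (ℕ.*-monoʳ-≤ (G n) 1≤i)) (ℕ.<⇒≤ l)) }) (chosen-bounds i n)
      lengths : ∀ {n} → n ∈ levels → length (chosen a n) ≡ length (chosen b n)
      lengths {n} n∈ = trans (chosen-length a n (proj₁ (proj₂ (proj₂ (proj₂ (proj₂ (facts n∈)))))))
        (sym (chosen-length b n (proj₂ (proj₂ (proj₂ (proj₂ (proj₂ (facts n∈))))))))
      map₁ : map proj₁ pairs ≡ gather (chosen a) levels
      map₁ = gather-map proj₁ pairsAt (chosen a) levels (λ n n∈ → map-proj₁-zip (chosen a n) (chosen b n) (lengths n∈))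
      map₂ : map proj₂ pairs ≡ gather (chosen b) levels
      map₂ = gather-map proj₂ pairsAt (chosen b) levels (λ n n∈ → map-proj₂-zip (chosen a n) (chosen b n) (lengths n∈))
      abundant : ∀ i → i ℕ.< 32 ℕ.* Q → (∀ {n} → n ∈ levels → k n ℕ.≤ cells (G n) i 1) → ⟦ R ⟧ ≤ recip (gather (chosen i) levels)
      abundant i i< h = ℚ.≤-trans (≤inv* {x = ⟦ R ⟧} {n = Q ℕ.* 2048} (ℕ.*-mono-≤ (1≤2^ q) (s≤s (z≤n {2047}))) (subst (_≤ ∑ levels weight) (⟦⟧-* (Q ℕ.* 2048) R) levels-weight))
        (≤-resp (∑-* levels (inv (Q ℕ.* 2048)) weight) (sym (gather-∑ (chosen i) levels inv))
          (∑-mono levels {λ n → inv (Q ℕ.* 2048) * weight n} {λ n → recip (chosen i n)} (λ n n∈ → chosen-recip i n i< (h n∈))))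

-- Comparison of the mean values at X and at X b/a

module Shifts where
  open Rationals
  open Sums
  open Division
  open TuranKubilius
  open PrimeFamilies

  -- The sum 4 + 12 + 3 + 2 in `final`: Turán-Kubilius at `X`; the same at `Y`, whose mass `S′ Y` is
  -- at most `3 S X`; the pairing of the sums; the difference of the masses.
  21ℚ : ℚ
  21ℚ = ℤ.+ 21 ℚ./ 1

  opaque
    unfolding ι

    ⟦21⟧ : ⟦ 21 ⟧ ≡ 21ℚ
    ⟦21⟧ = refl

  0≤21 : 0ℚ ≤ 21ℚ
  0≤21 = ℚ.nonNegative⁻¹ 21ℚ

  module _ {a b Q G p q X Y : ℕ} (1≤Q : 1 ℕ.≤ Q) (Q≤a : Q ℕ.≤ a) (Q≤b : Q ℕ.≤ b)
           (p-lower : G ℕ.* a ℕ.< p) (p-upper : p ℕ.≤ G ℕ.* suc a) (q-lower : G ℕ.* b ℕ.< q) (q-upper : q ℕ.≤ G ℕ.* suc b)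
           (Y-lower : Y ℕ.* a ℕ.≤ X ℕ.* b) (Y-upper : X ℕ.* b ℕ.< suc Y ℕ.* a) where

    private
      open ℕ.≤-Reasoning
      1≤p : 1 ℕ.≤ p
      1≤p = ℕ.≤-trans (s≤s z≤n) p-lower
      1≤q : 1 ℕ.≤ q
      1≤q = ℕ.≤-trans (s≤s z≤n) q-lower

      -- Divided by `Q p q`, this reads `X/p ≤ Y/q + X/(p Q) + 1`. Raising `q` to `G (b + 1)` costs
      -- `X G Q ≤ X q`; replacing `X b` by `(Y + 1) a` costs `Q G a ≤ Q p q`.
      cross₁ : Q ℕ.* (X ℕ.* q) ℕ.≤ Q ℕ.* (Y ℕ.* p) ℕ.+ X ℕ.* q ℕ.+ Q ℕ.* (p ℕ.* q)
      cross₁ = begin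
        Q ℕ.* (X ℕ.* q)                                      ≤⟨ ℕ.*-monoʳ-≤ Q (ℕ.*-monoʳ-≤ X q-upper) ⟩
        Q ℕ.* (X ℕ.* (G ℕ.* suc b))                          ≡⟨ eq₁ Q X G b ⟩
        Q ℕ.* (G ℕ.* (X ℕ.* b)) ℕ.+ X ℕ.* (G ℕ.* Q)          ≤⟨ ℕ.+-mono-≤ (ℕ.*-monoʳ-≤ Q (ℕ.*-monoʳ-≤ G (ℕ.<⇒≤ Y-upper))) (ℕ.*-monoʳ-≤ X (ℕ.≤-trans (ℕ.*-monoʳ-≤ G Q≤b) (ℕ.<⇒≤ q-lower))) ⟩
        Q ℕ.* (G ℕ.* (suc Y ℕ.* a)) ℕ.+ X ℕ.* q              ≡⟨ eq₂ Q G Y a (X ℕ.* q) ⟩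
        Q ℕ.* (Y ℕ.* (G ℕ.* a)) ℕ.+ X ℕ.* q ℕ.+ Q ℕ.* (G ℕ.* a ℕ.* 1)  ≤⟨ ℕ.+-mono-≤ (ℕ.+-monoˡ-≤ (X ℕ.* q) (ℕ.*-monoʳ-≤ Q (ℕ.*-monoʳ-≤ Y (ℕ.<⇒≤ p-lower)))) (ℕ.*-monoʳ-≤ Q (ℕ.*-mono-≤ (ℕ.<⇒≤ p-lower) 1≤q)) ⟩
        Q ℕ.* (Y ℕ.* p) ℕ.+ X ℕ.* q ℕ.+ Q ℕ.* (p ℕ.* q)      ∎
        where
        eq₁ : ∀ Q X G b → Q ℕ.* (X ℕ.* (G ℕ.* suc b)) ≡ Q ℕ.* (G ℕ.* (X ℕ.* b)) ℕ.+ X ℕ.* (G ℕ.* Q)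
        eq₁ = ℕ-Solver.solve-∀
        eq₂ : ∀ Q G Y a z → Q ℕ.* (G ℕ.* (suc Y ℕ.* a)) ℕ.+ z ≡ Q ℕ.* (Y ℕ.* (G ℕ.* a)) ℕ.+ z ℕ.+ Q ℕ.* (G ℕ.* a ℕ.* 1)
        eq₂ = ℕ-Solver.solve-∀

      cross₂ : Q ℕ.* (Y ℕ.* p) ℕ.≤ Q ℕ.* (X ℕ.* q) ℕ.+ X ℕ.* q ℕ.+ Q ℕ.* (p ℕ.* q)
      cross₂ = begin
        Q ℕ.* (Y ℕ.* p)                                  ≤⟨ ℕ.*-monoʳ-≤ Q (ℕ.*-monoʳ-≤ Y p-upper) ⟩
        Q ℕ.* (Y ℕ.* (G ℕ.* suc a))                      ≡⟨ eq₁ Q Y G a ⟩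
        Q ℕ.* (G ℕ.* (Y ℕ.* a)) ℕ.+ G ℕ.* (Y ℕ.* Q)      ≤⟨ ℕ.+-mono-≤ (ℕ.*-monoʳ-≤ Q (ℕ.*-monoʳ-≤ G Y-lower)) (ℕ.*-monoʳ-≤ G (ℕ.≤-trans (ℕ.*-monoʳ-≤ Y Q≤a) Y-lower)) ⟩
        Q ℕ.* (G ℕ.* (X ℕ.* b)) ℕ.+ G ℕ.* (X ℕ.* b)      ≡⟨ eq₂ Q G X b ⟩
        Q ℕ.* (X ℕ.* (G ℕ.* b)) ℕ.+ X ℕ.* (G ℕ.* b)      ≤⟨ ℕ.+-mono-≤ (ℕ.*-monoʳ-≤ Q (ℕ.*-monoʳ-≤ X (ℕ.<⇒≤ q-lower))) (ℕ.*-monoʳ-≤ X (ℕ.<⇒≤ q-lower)) ⟩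
        Q ℕ.* (X ℕ.* q) ℕ.+ X ℕ.* q                      ≤⟨ ℕ.m≤m+n _ _ ⟩
        Q ℕ.* (X ℕ.* q) ℕ.+ X ℕ.* q ℕ.+ Q ℕ.* (p ℕ.* q)  ∎
        where
        eq₁ : ∀ Q Y G a → Q ℕ.* (Y ℕ.* (G ℕ.* suc a)) ≡ Q ℕ.* (G ℕ.* (Y ℕ.* a)) ℕ.+ G ℕ.* (Y ℕ.* Q)
        eq₁ = ℕ-Solver.solve-∀
        eq₂ : ∀ Q G X b → Q ℕ.* (G ℕ.* (X ℕ.* b)) ℕ.+ G ℕ.* (X ℕ.* b) ≡ Q ℕ.* (X ℕ.* (G ℕ.* b)) ℕ.+ X ℕ.* (G ℕ.* b)
        eq₂ = ℕ-Solver.solve-∀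

      cast : ∀ x y → ⟦ Q ℕ.* (x ℕ.* y) ⟧ ≡ ⟦ Q ⟧ * (⟦ x ⟧ * ⟦ y ⟧)
      cast x y = trans (⟦⟧-* Q (x ℕ.* y)) (cong (⟦ Q ⟧ *_) (⟦⟧-* x y))

      castSum : ∀ u v → ⟦ Q ℕ.* (u ℕ.* v) ℕ.+ X ℕ.* q ℕ.+ Q ℕ.* (p ℕ.* q) ⟧ ≡ ⟦ Q ⟧ * (⟦ u ⟧ * ⟦ v ⟧) + ⟦ X ⟧ * ⟦ q ⟧ + ⟦ Q ⟧ * (⟦ p ⟧ * ⟦ q ⟧)
      castSum u v = trans (⟦⟧-+ (Q ℕ.* (u ℕ.* v) ℕ.+ X ℕ.* q) _) (cong₂ _+_ (trans (⟦⟧-+ (Q ℕ.* (u ℕ.* v)) _) (cong₂ _+_ (cast u v) (⟦⟧-* X q))) (cast p q))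

      diff₁ : ⟦ Q ⟧ * (⟦ X ⟧ * ⟦ q ⟧) ≤ ⟦ Q ⟧ * (⟦ Y ⟧ * ⟦ p ⟧) + ⟦ X ⟧ * ⟦ q ⟧ + ⟦ Q ⟧ * (⟦ p ⟧ * ⟦ q ⟧)
      diff₁ = ≤-resp (cast X q) (castSum Y p) (⟦⟧-mono cross₁)
      diff₂ : ⟦ Q ⟧ * (⟦ Y ⟧ * ⟦ p ⟧) ≤ ⟦ Q ⟧ * (⟦ X ⟧ * ⟦ q ⟧) + ⟦ X ⟧ * ⟦ q ⟧ + ⟦ Q ⟧ * (⟦ p ⟧ * ⟦ q ⟧)
      diff₂ = ≤-resp (cast Y p) (castSum X q) (⟦⟧-mono cross₂)

      0≤ijk : 0ℚ ≤ inv p * inv q * inv Q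
      0≤ijk = 0≤* (0≤* (0≤inv p) (0≤inv q)) (0≤inv Q)

      -- The ring solver cannot use that `i P`, `j q` and `k Q` are 1. The identity is therefore
      -- expanded with these products grouped, and `cong₃` replaces them.
      clear : ∀ i j k P q Q X Y → i * P ≡ 1ℚ → j * q ≡ 1ℚ → k * Q ≡ 1ℚ →
        X * i * k + 1ℚ - (X * i - Y * j) ≡ i * j * k * (Q * (Y * P) + X * q + Q * (P * q) - Q * (X * q))
      clear i j k P q Q X Y e₁ e₂ e₃ = sym (trans (expand i j k P q Q X Y) (trans (cong₃ e₁ e₂ e₃) (collect X Y i j k)))
        where
        expand : ∀ i j k P q Q X Y → i * j * k * (Q * (Y * P) + X * q + Q * (P * q) - Q * (X * q)) ≡
          Y * j * ((i * P) * (k * Q)) + X * i * k * (j * q) + (i * P) * (j * q) * (k * Q) - X * i * ((j * q) * (k * Q))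
        expand = Solver.solve-∀ ring
        collect : ∀ X Y i j k → Y * j * (1ℚ * 1ℚ) + X * i * k * 1ℚ + 1ℚ * 1ℚ * 1ℚ - X * i * (1ℚ * 1ℚ) ≡ X * i * k + 1ℚ - (X * i - Y * j)
        collect = Solver.solve-∀ ring
        cong₃ : ∀ {u v w} → u ≡ 1ℚ → v ≡ 1ℚ → w ≡ 1ℚ →
          Y * j * (u * w) + X * i * k * v + u * v * w - X * i * (v * w) ≡ Y * j * (1ℚ * 1ℚ) + X * i * k * 1ℚ + 1ℚ * 1ℚ * 1ℚ - X * i * (1ℚ * 1ℚ)
        cong₃ refl refl refl = refl

      clear′ : ∀ i j k P q Q X Y → i * P ≡ 1ℚ → j * q ≡ 1ℚ → k * Q ≡ 1ℚ →
        X * i * k + 1ℚ - (Y * j - X * i) ≡ i * j * k * (Q * (X * q) + X * q + Q * (P * q) - Q * (Y * P))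
      clear′ i j k P q Q X Y e₁ e₂ e₃ = sym (trans (expand i j k P q Q X Y) (trans (cong₃ e₁ e₂ e₃) (collect X Y i j k)))
        where
        expand : ∀ i j k P q Q X Y → i * j * k * (Q * (X * q) + X * q + Q * (P * q) - Q * (Y * P)) ≡
          X * i * ((j * q) * (k * Q)) + X * i * k * (j * q) + (i * P) * (j * q) * (k * Q) - Y * j * ((i * P) * (k * Q))
        expand = Solver.solve-∀ ring
        collect : ∀ X Y i j k → X * i * (1ℚ * 1ℚ) + X * i * k * 1ℚ + 1ℚ * 1ℚ * 1ℚ - Y * j * (1ℚ * 1ℚ) ≡ X * i * k + 1ℚ - (Y * j - X * i)
        collect = Solver.solve-∀ ring
        cong₃ : ∀ {u v w} → u ≡ 1ℚ → v ≡ 1ℚ → w ≡ 1ℚ →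
          X * i * (v * w) + X * i * k * v + u * v * w - Y * j * (u * w) ≡ X * i * (1ℚ * 1ℚ) + X * i * k * 1ℚ + 1ℚ * 1ℚ * 1ℚ - Y * j * (1ℚ * 1ℚ)
        cong₃ refl refl refl = refl

    quotients-close : ⟦ X ⟧ * inv p - ⟦ Y ⟧ * inv q ≤ ⟦ X ⟧ * inv p * inv Q + 1ℚ
    quotients-close = by-diff (0≤* 0≤ijk (diff diff₁)) (clear (inv p) (inv q) (inv Q) ⟦ p ⟧ ⟦ q ⟧ ⟦ Q ⟧ ⟦ X ⟧ ⟦ Y ⟧ (inv-inverse 1≤p) (inv-inverse 1≤q) (inv-inverse 1≤Q))

    quotients-close′ : ⟦ Y ⟧ * inv q - ⟦ X ⟧ * inv p ≤ ⟦ X ⟧ * inv p * inv Q + 1ℚ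
    quotients-close′ = by-diff (0≤* 0≤ijk (diff diff₂)) (clear′ (inv p) (inv q) (inv Q) ⟦ p ⟧ ⟦ q ⟧ ⟦ Q ⟧ ⟦ X ⟧ ⟦ Y ⟧ (inv-inverse 1≤p) (inv-inverse 1≤q) (inv-inverse 1≤Q))

  module MeanValue (f : ℕ → ℚ) (∣f∣≤1 : ∀ {n} → 1 ℕ.≤ n → ∣ f n ∣ ≤ 1ℚ)
           (f-prime : ∀ {p n} → Prime p → 1 ℕ.≤ n → ¬ p ∣ n → f (p ℕ.* n) ≡ - f n) where

    F A : ℕ → ℚ
    F X = ∑ [1… X ] f
    A X = inv X * F X

    ∣∑∣≤length : ∀ n (g : ℕ → ℚ) → (∀ k → 1 ℕ.≤ k → ∣ g k ∣ ≤ 1ℚ) → ∣ ∑ [1… n ] g ∣ ≤ ⟦ n ⟧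
    ∣∑∣≤length n g h = subst (∣ ∑ [1… n ] g ∣ ≤_) (trans (∑-const [1… n ] 1ℚ) (trans (ℚ.*-identityʳ _) (cong ⟦_⟧ (length-[1…] n))))
      (∑-abs-≤ [1… n ] (λ k k∈ → h k (proj₁ (∈[1…]⁻ n k∈))))

    F-lipschitz : ∀ {m n} → m ℕ.≤ n → ∣ F n - F m ∣ ≤ ⟦ n ⟧ - ⟦ m ⟧
    F-lipschitz {m} {n} m≤n = ≤-resp (cong ∣_∣ (sym eq)) len (∣∑∣≤length (n ℕ.∸ m) (λ k → f (m ℕ.+ k)) (λ k 1≤k → ∣f∣≤1 (ℕ.≤-trans 1≤k (ℕ.m≤n+m k m))))
      where
      cancel : ∀ x y → x + y - x ≡ y
      cancel = Solver.solve-∀ ring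
      eq : F n - F m ≡ ∑ [1… n ℕ.∸ m ] (λ k → f (m ℕ.+ k))
      eq = trans (cong (λ t → F t - F m) (sym (ℕ.m+[n∸m]≡n m≤n))) (trans (cong (_- F m) (∑-split m (n ℕ.∸ m) f)) (cancel (F m) _))
      len : ⟦ n ℕ.∸ m ⟧ ≡ ⟦ n ⟧ - ⟦ m ⟧
      len = sym (trans (cong (λ t → ⟦ t ⟧ - ⟦ m ⟧) (sym (ℕ.m+[n∸m]≡n m≤n))) (trans (cong (_- ⟦ m ⟧) (⟦⟧-+ m (n ℕ.∸ m))) (cancel ⟦ m ⟧ _)))

    F-close : ∀ {m n t} → ⟦ m ⟧ - ⟦ n ⟧ ≤ t → ⟦ n ⟧ - ⟦ m ⟧ ≤ t → ∣ F m - F n ∣ ≤ t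
    F-close {m} {n} {t} h₁ h₂ with ℕ.≤-total m n
    ... | inj₁ m≤n = ℚ.≤-trans (subst (_≤ ⟦ n ⟧ - ⟦ m ⟧) (trans (sym (ℚ.∣-p∣≡∣p∣ (F n - F m))) (cong ∣_∣ (neg (F n) (F m)))) (F-lipschitz m≤n)) h₂
      where
      neg : ∀ x y → - (x - y) ≡ y - x
      neg = Solver.solve-∀ ring
    ... | inj₂ n≤m = ℚ.≤-trans (F-lipschitz n≤m) h₁

    ∣A∣≤1 : ∀ X → ∣ A X ∣ ≤ 1ℚ
    ∣A∣≤1 zero = subst (_≤ 1ℚ) (cong ∣_∣ (sym (ℚ.*-zeroʳ (inv 0)))) 0≤1
    ∣A∣≤1 X@(suc _) = subst (∣ A X ∣ ≤_) (inv-inverse {X} (s≤s z≤n))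
      (∣∣-*-≤ {inv X} {F X} (ℚ.≤-reflexive (ℚ.0≤p⇒∣p∣≡p (0≤inv X))) (∣∑∣≤length X f (λ _ → ∣f∣≤1)))

    F≡XA : ∀ {X} → 1 ℕ.≤ X → F X ≡ ⟦ X ⟧ * A X
    F≡XA {X} h = trans (sym (ℚ.*-identityˡ (F X))) (trans (cong (_* F X) (sym (inv-inverse h))) (eq (inv X) ⟦ X ⟧ (F X)))
      where
      eq : ∀ i x y → i * x * y ≡ x * (i * y)
      eq = Solver.solve-∀ ring

    -- `X (A X − A Z)` equals `(F X − F Z) − (X − Z) A Z`, and each part is at most `X − Z`.
    A-lipschitz : ∀ {Z X} → 1 ℕ.≤ Z → Z ℕ.≤ X → ⟦ X ⟧ * ∣ A X - A Z ∣ ≤ 2ℚ * (⟦ X ⟧ - ⟦ Z ⟧)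
    A-lipschitz {Z} {X} 1≤Z Z≤X = ≤-resp (trans (cong ∣_∣ eq) (trans (ℚ.∣p*q∣≡∣p∣*∣q∣ ⟦ X ⟧ (A X - A Z)) (cong (_* ∣ A X - A Z ∣) (ℚ.0≤p⇒∣p∣≡p (0≤⟦⟧ X))))) (dbl (⟦ X ⟧ - ⟦ Z ⟧))
        (ℚ.≤-trans (ℚ.∣p-q∣≤∣p∣+∣q∣ (F X - F Z) ((⟦ X ⟧ - ⟦ Z ⟧) * A Z))
          (ℚ.+-mono-≤ (F-lipschitz Z≤X) (∣∣-*-≤ {⟦ X ⟧ - ⟦ Z ⟧} {A Z} (ℚ.≤-reflexive (ℚ.0≤p⇒∣p∣≡p (diff (⟦⟧-mono Z≤X)))) (∣A∣≤1 Z))))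
      where
      dbl : ∀ t → t + t * 1ℚ ≡ 2ℚ * t
      dbl = Solver.solve-∀ ring
      alg : ∀ x z a b → x * a - z * b - (x - z) * b ≡ x * (a - b)
      alg = Solver.solve-∀ ring
      eq : F X - F Z - (⟦ X ⟧ - ⟦ Z ⟧) * A Z ≡ ⟦ X ⟧ * (A X - A Z)
      eq = trans (cong₂ (λ s t → s - t - (⟦ X ⟧ - ⟦ Z ⟧) * A Z) (F≡XA (ℕ.≤-trans 1≤Z Z≤X)) (F≡XA 1≤Z)) (alg ⟦ X ⟧ ⟦ Z ⟧ (A X) (A Z))

    module _ {Q d D : ℕ} (1≤Q : 1 ℕ.≤ Q) (fam : Family Q d D Q (Q ℕ.* Q)) where
      open Family fam
      private
        ps qs : List ℕ
        ps = map proj₁ pairs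
        qs = map proj₂ pairs
        S S′ : ℚ
        S = recip ps
        S′ = recip qs
        κ : ℕ
        κ = length pairs
        Q≤b : Q ℕ.≤ b
        Q≤b = ℕ.≤-trans Q≤a (ℕ.≤-trans (ℕ.m≤m+n a d) gap)
        1≤a : 1 ℕ.≤ a
        1≤a = ℕ.≤-trans 1≤Q Q≤a

      -- Meets the length condition of `turan-kubilius` with `c = Q` at `X`, hence also at `Y ≥ X`;
      -- the `suc` makes `X` positive.
      threshold : ℕ
      threshold = suc (κ ℕ.* (Q ℕ.* Q))

      -- By Turán-Kubilius, `S F(X)` and `S′ F(Y)` are nearly the negatives of the sums over `p` and
      -- `q`. Paired primes have `X/p ≈ Y/q`, so the two sums are close, and so are the masses `S X`
      -- and `S′ Y`. Dividing by `S X` compares `A X` with `A Y`.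
      shift : ∀ X → threshold ℕ.≤ X → ⟦ Q ⟧ * ∣ A X - A ((X ℕ.* b) ÷ a) ∣ ≤ 21ℚ
      shift X X≥ = *-cancel-≤ (S * ⟦ X ⟧) 0<SX (≤-resp {z = 21ℚ * (S * ⟦ X ⟧)} eqL (ℚ.*-comm 21ℚ (S * ⟦ X ⟧)) bound)
        where
        Y = (X ℕ.* b) ÷ a
        1≤X : 1 ℕ.≤ X
        1≤X = ℕ.≤-trans (s≤s z≤n) X≥
        X≤Y : X ℕ.≤ Y
        X≤Y = *≤⇒≤÷ 1≤a (ℕ.*-monoʳ-≤ X (ℕ.≤-trans (ℕ.m≤m+n a d) gap))
        1≤Y : 1 ℕ.≤ Y
        1≤Y = ℕ.≤-trans 1≤X X≤Y
        Q² : ⟦ Q ℕ.* Q ⟧ ≡ ⟦ Q ⟧ * ⟦ Q ⟧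
        Q² = ⟦⟧-* Q Q
        enough : ∀ {Z} (zs : List ℕ) → length zs ≡ κ → threshold ℕ.≤ Z → ⟦ length zs ⟧ * (⟦ Q ⟧ * ⟦ Q ⟧) ≤ ⟦ Z ⟧
        enough {Z} zs e h = subst (_≤ ⟦ Z ⟧) (trans (⟦⟧-* κ (Q ℕ.* Q)) (cong₂ _*_ (cong ⟦_⟧ (sym e)) Q²)) (⟦⟧-mono (ℕ.≤-trans (ℕ.n≤1+n _) h))
        tkX : ⟦ Q ⟧ * ∣ S * F X + ∑ ps (λ p → F (X ÷ p)) ∣ ≤ 4ℚ * (S * ⟦ X ⟧)
        tkX = turan-kubilius f ∣f∣≤1 f-prime X ps Q (All.map⁺ prime₁) unique₁ (All.map⁺ large₁) 1≤Q
          (subst (_≤ S) Q² abundant₁) (enough ps (length-map proj₁ pairs) X≥)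
        tkY : ⟦ Q ⟧ * ∣ S′ * F Y + ∑ qs (λ q → F (Y ÷ q)) ∣ ≤ 4ℚ * (S′ * ⟦ Y ⟧)
        tkY = turan-kubilius f ∣f∣≤1 f-prime Y qs Q (All.map⁺ prime₂) unique₂ (All.map⁺ large₂) 1≤Q
          (subst (_≤ S′) Q² abundant₂) (enough qs (length-map proj₂ pairs) (ℕ.≤-trans X≥ X≤Y))
        close₁ : ∀ z → z ∈ pairs → ⟦ X ⟧ * inv (proj₁ z) - ⟦ Y ⟧ * inv (proj₂ z) ≤ ⟦ X ⟧ * inv (proj₁ z) * inv Q + 1ℚ
        close₁ z z∈ with All.lookup located z∈
        ... | G , (pl , pu) , (ql , qu) = quotients-close {a} {b} {Q} {G} {X = X} {Y = Y} 1≤Q Q≤a Q≤b pl pu ql qu (÷-*≤ (X ℕ.* b) a) (<÷-* (X ℕ.* b) 1≤a)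
        close₂ : ∀ z → z ∈ pairs → ⟦ Y ⟧ * inv (proj₂ z) - ⟦ X ⟧ * inv (proj₁ z) ≤ ⟦ X ⟧ * inv (proj₁ z) * inv Q + 1ℚ
        close₂ z z∈ with All.lookup located z∈
        ... | G , (pl , pu) , (ql , qu) = quotients-close′ {a} {b} {Q} {G} {X = X} {Y = Y} 1≤Q Q≤a Q≤b pl pu ql qu (÷-*≤ (X ℕ.* b) a) (<÷-* (X ℕ.* b) 1≤a)
        ∑-linear : ∀ c → ∑ pairs (λ z → ⟦ X ⟧ * inv (proj₁ z) * inv Q + c) ≡ S * ⟦ X ⟧ * inv Q + ⟦ κ ⟧ * c
        ∑-linear c = trans (∑-+ pairs (λ z → ⟦ X ⟧ * inv (proj₁ z) * inv Q) (λ _ → c)) (cong₂ _+_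
          (trans (∑-cong pairs (λ z _ → rot ⟦ X ⟧ (inv (proj₁ z)) (inv Q))) (trans (∑-* pairs (⟦ X ⟧ * inv Q) (λ z → inv (proj₁ z)))
            (trans (cong (⟦ X ⟧ * inv Q *_) (sym (∑-map proj₁ pairs inv))) (rot′ ⟦ X ⟧ (inv Q) S))))
          (∑-const pairs c))
          where
          rot : ∀ x i k → x * i * k ≡ x * k * i
          rot = Solver.solve-∀ ring
          rot′ : ∀ x k s → x * k * s ≡ s * x * k
          rot′ = Solver.solve-∀ ring
        FX FY : ℚ
        FX = ∑ ps (λ p → F (X ÷ p))
        FY = ∑ qs (λ q → F (Y ÷ q))
        -- The constant 2 is the 1 of `quotients-close` plus 1 for the rounding in `X ÷ p` and
        -- `Y ÷ q`.
        sums-close : ∣ FX - FY ∣ ≤ S * ⟦ X ⟧ * inv Q + ⟦ κ ⟧ * 2ℚ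
        sums-close = ≤-resp (cong ∣_∣ (trans (∑-- pairs (λ z → F (X ÷ proj₁ z)) (λ z → F (Y ÷ proj₂ z))) (cong₂ _-_ (sym (∑-map proj₁ pairs (λ p → F (X ÷ p)))) (sym (∑-map proj₂ pairs (λ q → F (Y ÷ q)))))))
          (∑-linear 2ℚ) (∑-abs-≤ pairs {λ z → F (X ÷ proj₁ z) - F (Y ÷ proj₂ z)} (λ z z∈ → term z z∈ (prime≥1 (All.lookup prime₁ z∈)) (prime≥1 (All.lookup prime₂ z∈))))
          where
          term : ∀ z → z ∈ pairs → 1 ℕ.≤ proj₁ z → 1 ℕ.≤ proj₂ z → ∣ F (X ÷ proj₁ z) - F (Y ÷ proj₂ z) ∣ ≤ ⟦ X ⟧ * inv (proj₁ z) * inv Q + 2ℚ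
          term z@(p , q) z∈ 1≤p 1≤q = F-close
            (by-diff (0≤+ (diff (close₁ z z∈)) (0≤+ (diff (÷≤ℚ X 1≤p)) (diff (≤÷+1ℚ Y 1≤q)))) (eq ⟦ X ⟧ ⟦ Y ⟧ (inv p) (inv q) (inv Q) ⟦ X ÷ p ⟧ ⟦ Y ÷ q ⟧))
            (by-diff (0≤+ (diff (close₂ z z∈)) (0≤+ (diff (≤÷+1ℚ X 1≤p)) (diff (÷≤ℚ Y 1≤q)))) (eq′ ⟦ X ⟧ ⟦ Y ⟧ (inv p) (inv q) (inv Q) ⟦ X ÷ p ⟧ ⟦ Y ÷ q ⟧))
            where
            eq : ∀ x y i j k u v → x * i * k + 2ℚ - (u - v) ≡ (x * i * k + 1ℚ - (x * i - y * j)) + ((i * x - u) + (1ℚ + v - j * y))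
            eq = Solver.solve-∀ ring
            eq′ : ∀ x y i j k u v → x * i * k + 2ℚ - (v - u) ≡ (x * i * k + 1ℚ - (y * j - x * i)) + ((1ℚ + u - i * x) + (j * y - v))
            eq′ = Solver.solve-∀ ring
        SX≡ : ∑ pairs (λ z → ⟦ X ⟧ * inv (proj₁ z)) ≡ S * ⟦ X ⟧
        SX≡ = trans (∑-* pairs ⟦ X ⟧ (λ z → inv (proj₁ z))) (trans (cong (⟦ X ⟧ *_) (sym (∑-map proj₁ pairs inv))) (ℚ.*-comm ⟦ X ⟧ S))
        S′Y≡ : ∑ pairs (λ z → ⟦ Y ⟧ * inv (proj₂ z)) ≡ S′ * ⟦ Y ⟧
        S′Y≡ = trans (∑-* pairs ⟦ Y ⟧ (λ z → inv (proj₂ z))) (trans (cong (⟦ Y ⟧ *_) (sym (∑-map proj₂ pairs inv))) (ℚ.*-comm ⟦ Y ⟧ S′))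
        masses₁ : S * ⟦ X ⟧ - S′ * ⟦ Y ⟧ ≤ S * ⟦ X ⟧ * inv Q + ⟦ κ ⟧ * 1ℚ
        masses₁ = ≤-resp (trans (∑-- pairs (λ z → ⟦ X ⟧ * inv (proj₁ z)) (λ z → ⟦ Y ⟧ * inv (proj₂ z))) (cong₂ _-_ SX≡ S′Y≡)) (∑-linear 1ℚ) (∑-mono pairs close₁)
        masses₂ : S′ * ⟦ Y ⟧ - S * ⟦ X ⟧ ≤ S * ⟦ X ⟧ * inv Q + ⟦ κ ⟧ * 1ℚ
        masses₂ = ≤-resp (trans (∑-- pairs (λ z → ⟦ Y ⟧ * inv (proj₂ z)) (λ z → ⟦ X ⟧ * inv (proj₁ z))) (cong₂ _-_ S′Y≡ SX≡)) (∑-linear 1ℚ) (∑-mono pairs close₂)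
        1≤q : 1ℚ ≤ ⟦ Q ⟧
        1≤q = 1≤⟦⟧ 1≤Q
        1≤S : 1ℚ ≤ S
        1≤S = ℚ.≤-trans (1≤⟦⟧ (ℕ.*-mono-≤ 1≤Q 1≤Q)) abundant₁
        0<SX : 0ℚ < S * ⟦ X ⟧
        0<SX = ℚ.<-≤-trans 0<1 (by-diff (0≤+ (0≤* (diff 1≤S) (0≤⟦⟧ X)) (diff (1≤⟦⟧ 1≤X))) (eq₂ S ⟦ X ⟧))
          where
          eq₂ : ∀ s x → s * x - 1ℚ ≡ (s - 1ℚ) * x + (x - 1ℚ)
          eq₂ = Solver.solve-∀ ring
        κQ≤SX : ⟦ κ ⟧ * ⟦ Q ⟧ ≤ S * ⟦ X ⟧
        κQ≤SX = by-diff (0≤+ (0≤* (diff 1≤S) (0≤⟦⟧ X)) (0≤+ (diff (enough ps (length-map proj₁ pairs) X≥)) (0≤* (0≤* (0≤⟦⟧ (length ps)) (0≤⟦⟧ Q)) (diff 1≤q))))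
          (trans (cong (λ t → S * ⟦ X ⟧ - ⟦ t ⟧ * ⟦ Q ⟧) (sym (length-map proj₁ pairs))) (eq₃ S ⟦ X ⟧ ⟦ length ps ⟧ ⟦ Q ⟧))
          where
          eq₃ : ∀ s x k q → s * x - k * q ≡ (s - 1ℚ) * x + ((x - k * (q * q)) + k * q * (q - 1ℚ))
          eq₃ = Solver.solve-∀ ring
        eqL : ⟦ Q ⟧ * ∣ S * ⟦ X ⟧ * (A X - A Y) ∣ ≡ S * ⟦ X ⟧ * (⟦ Q ⟧ * ∣ A X - A Y ∣)
        eqL = trans (cong (⟦ Q ⟧ *_) (trans (ℚ.∣p*q∣≡∣p∣*∣q∣ (S * ⟦ X ⟧) (A X - A Y)) (cong (_* ∣ A X - A Y ∣) (ℚ.0≤p⇒∣p∣≡p (ℚ.<⇒≤ 0<SX)))))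
          (perm ⟦ Q ⟧ (S * ⟦ X ⟧) ∣ A X - A Y ∣)
          where
          perm : ∀ q s t → q * (s * t) ≡ s * (q * t)
          perm = Solver.solve-∀ ring
        U V W T : ℚ
        U = S * F X + FX
        V = S′ * F Y + FY
        W = FX - FY
        T = S * ⟦ X ⟧ - S′ * ⟦ Y ⟧
        decompose : S * ⟦ X ⟧ * (A X - A Y) ≡ U - V - (W + T * A Y)
        decompose = sym (trans (cong₂ (λ s t → S * s + FX - (S′ * t + FY) - (FX - FY + T * A Y)) (F≡XA 1≤X) (F≡XA 1≤Y)) (alg S ⟦ X ⟧ S′ ⟦ Y ⟧ (A X) (A Y) FX FY))
          where
          alg : ∀ s x s′ y a b u v → s * (x * a) + u - (s′ * (y * b) + v) - (u - v + (s * x - s′ * y) * b) ≡ s * x * (a - b)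
          alg = Solver.solve-∀ ring
        T-abs : ∣ T ∣ ≤ S * ⟦ X ⟧ * inv Q + ⟦ κ ⟧ * 1ℚ
        T-abs = abs≤ masses₁ (subst (_≤ S * ⟦ X ⟧ * inv Q + ⟦ κ ⟧ * 1ℚ) (neg (S * ⟦ X ⟧) (S′ * ⟦ Y ⟧)) masses₂)
          where
          neg : ∀ x y → y - x ≡ - (x - y)
          neg = Solver.solve-∀ ring
        triangle : ∣ S * ⟦ X ⟧ * (A X - A Y) ∣ ≤ ∣ U ∣ + ∣ V ∣ + (∣ W ∣ + ∣ T ∣)
        triangle = subst (λ t → ∣ t ∣ ≤ ∣ U ∣ + ∣ V ∣ + (∣ W ∣ + ∣ T ∣)) (sym decompose)
          (ℚ.≤-trans (ℚ.∣p-q∣≤∣p∣+∣q∣ (U - V) (W + T * A Y)) (ℚ.+-mono-≤ (ℚ.∣p-q∣≤∣p∣+∣q∣ U V)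
            (ℚ.≤-trans (ℚ.∣p+q∣≤∣p∣+∣q∣ W (T * A Y)) (ℚ.+-monoʳ-≤ ∣ W ∣ (subst (∣ T * A Y ∣ ≤_) (ℚ.*-identityʳ ∣ T ∣) (∣∣-*-≤ {T} {A Y} ℚ.≤-refl (∣A∣≤1 Y)))))))
        bound : ⟦ Q ⟧ * ∣ S * ⟦ X ⟧ * (A X - A Y) ∣ ≤ 21ℚ * (S * ⟦ X ⟧)
        bound = final ⟦ Q ⟧ (inv Q) (S * ⟦ X ⟧) (S′ * ⟦ Y ⟧) ⟦ κ ⟧ (∣ U ∣) (∣ V ∣) (∣ W ∣) (∣ T ∣) (∣ S * ⟦ X ⟧ * (A X - A Y) ∣)
            (trans (ℚ.*-comm ⟦ Q ⟧ (inv Q)) (inv-inverse 1≤Q)) (0≤⟦⟧ Q) 1≤q (0≤⟦⟧ κ) (ℚ.<⇒≤ 0<SX) triangle tkX tkY sums-close T-abs masses₂ κQ≤SX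
          where
          scaled : ∀ q i s k c w → q * i ≡ 1ℚ → 0ℚ ≤ q → w ≤ s * i + k * c → q * w ≤ s + c * (k * q)
          scaled q i s k c w e 0≤q h = subst (λ r → q * w ≤ r + c * (k * q)) (trans (cong (s *_) e) (ℚ.*-identityʳ s)) (by-diff (0≤* 0≤q (diff h)) (eq q i s k c w))
            where
            eq : ∀ q i s k c w → s * (q * i) + c * (k * q) - q * w ≡ q * (s * i + k * c - w)
            eq = Solver.solve-∀ ring
          final : ∀ q i s s′ k u v w t z → q * i ≡ 1ℚ → 0ℚ ≤ q → 1ℚ ≤ q → 0ℚ ≤ k → 0ℚ ≤ s → z ≤ u + v + (w + t) → q * u ≤ 4ℚ * s → q * v ≤ 4ℚ * s′ →
            w ≤ s * i + k * 2ℚ → t ≤ s * i + k * 1ℚ → s′ - s ≤ s * i + k * 1ℚ → k * q ≤ s → q * z ≤ 21ℚ * s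
          final q i s s′ k u v w t z e 0≤q 1≤q 0≤k 0≤s hz hu hv hw ht hs hk =
              by-diff (0≤+ (0≤* 0≤q (diff hz)) (0≤+ (diff hu) (0≤+ (diff hv) (0≤+ (diff (scaled q i s k 2ℚ w e 0≤q hw)) (0≤+ (diff (scaled q i s k 1ℚ t e 0≤q ht))
                  (0≤+ (0≤* (0≤* 0≤2 0≤2) (diff s′≤)) (0≤* 3≥0 (diff hk))))))))
                (alg q s s′ k u v w t z)
            where
            3≥0 : 0ℚ ≤ 3ℚ
            3≥0 = 0≤+ 0≤1 0≤2
            s′≤ : s′ ≤ 3ℚ * s
            s′≤ = *-cancel-≤ q (ℚ.<-≤-trans 0<1 1≤q) (by-diff (0≤+ (diff (scaled q i s k 1ℚ (s′ - s) e 0≤q hs)) (0≤+ (diff hk) (0≤* (0≤* 0≤2 0≤s) (diff 1≤q)))) (eq q s s′ k))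
              where
              eq : ∀ q s s′ k → q * (3ℚ * s) - q * s′ ≡ (s + 1ℚ * (k * q) - q * (s′ - s)) + ((s - k * q) + 2ℚ * s * (q - 1ℚ))
              eq = Solver.solve-∀ ring
            alg : ∀ q s s′ k u v w t z → 21ℚ * s - q * z ≡
              q * (u + v + (w + t) - z) + ((4ℚ * s - q * u) + ((4ℚ * s′ - q * v) + ((s + 2ℚ * (k * q) - q * w) + ((s + 1ℚ * (k * q) - q * t) + (2ℚ * 2ℚ * (3ℚ * s - s′) + 3ℚ * (s - k * q))))))
            alg = Solver.solve-∀ ring

-- Chains of shifts and vanishing of the mean value

module MeanValues where
  open Rationals
  open Sums
  open Division
  open PrimeCounts using (1≤2^; 2^-suc)
  open PopularCells using (module Scale)
  open TuranKubilius
  open PrimeFamilies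
  open Shifts

  upper-bound : ∀ (ns : List ℕ) → ∃ λ B → All (ℕ._≤ B) ns
  upper-bound [] = 0 , All.[]
  upper-bound (n ∷ ns) with upper-bound ns
  ... | B , h = n ℕ.+ B , ℕ.m≤m+n n B All.∷ All.map (λ le → ℕ.≤-trans le (ℕ.m≤n+m B n)) h

  n≤2^n : ∀ n → n ℕ.≤ 2 ℕ.^ n
  n≤2^n zero = z≤n
  n≤2^n (suc n) = subst (suc n ℕ.≤_) (sym (2^-suc n)) (ℕ.+-mono-≤ (1≤2^ n) (n≤2^n n))

  module MeanZero (f : ℕ → ℚ) (∣f∣≤1 : ∀ {n} → 1 ℕ.≤ n → ∣ f n ∣ ≤ 1ℚ)
           (f-prime : ∀ {p n} → Prime p → 1 ℕ.≤ n → ¬ p ∣ n → f (p ℕ.* n) ≡ - f n) where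
    open MeanValue f ∣f∣≤1 f-prime

    -- The two factorisations pin down the ratio: `Q ≡ E * D` with `b < a + D` and `Q ≤ a` gives
    -- `b/a < 1 + 1/E`, while `32 * Q ≡ W * d` with `a + d ≤ b` and `a < 32 * Q` gives
    -- `b/a > 1 + 1/W`.
    module Chain {Q d D : ℕ} (E W : ℕ) (1≤E : 1 ℕ.≤ E) (1≤D : 1 ℕ.≤ D) (1≤d : 1 ℕ.≤ d) (Q≡ED : Q ≡ E ℕ.* D) (32Q≡Wd : 32 ℕ.* Q ≡ W ℕ.* d)
             (fam : Family Q d D Q (Q ℕ.* Q)) where
      open Family fam

      1≤Q : 1 ℕ.≤ Q
      1≤Q = subst (1 ℕ.≤_) (sym Q≡ED) (ℕ.*-mono-≤ 1≤E 1≤D)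

      θ : ℕ
      θ = threshold 1≤Q fam

      next : ℕ → ℕ
      next Z = (Z ℕ.* b) ÷ a

      1≤a : 1 ℕ.≤ a
      1≤a = ℕ.≤-trans 1≤Q Q≤a

      near : ∀ Z X → Z ℕ.≤ X → X ℕ.≤ next Z → (X ℕ.∸ Z) ℕ.* E ℕ.≤ Z
      near Z X Z≤X X≤Y = ℕ.*-cancelʳ-≤ ((X ℕ.∸ Z) ℕ.* E) Z D {{ℕ.>-nonZero 1≤D}} (begin
        (X ℕ.∸ Z) ℕ.* E ℕ.* D        ≡⟨ trans (ℕ.*-assoc (X ℕ.∸ Z) E D) (cong ((X ℕ.∸ Z) ℕ.*_) (sym Q≡ED)) ⟩
        (X ℕ.∸ Z) ℕ.* Q              ≤⟨ ℕ.*-monoʳ-≤ (X ℕ.∸ Z) Q≤a ⟩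
        (X ℕ.∸ Z) ℕ.* a              ≤⟨ ℕ.+-cancelˡ-≤ (Z ℕ.* a) ((X ℕ.∸ Z) ℕ.* a) (Z ℕ.* D) (begin
          Z ℕ.* a ℕ.+ (X ℕ.∸ Z) ℕ.* a   ≡⟨ trans (sym (ℕ.*-distribʳ-+ a Z (X ℕ.∸ Z))) (cong (ℕ._* a) (ℕ.m+[n∸m]≡n Z≤X)) ⟩
          X ℕ.* a                       ≤⟨ ℕ.*-monoˡ-≤ a X≤Y ⟩
          next Z ℕ.* a                  ≤⟨ ÷-*≤ (Z ℕ.* b) a ⟩
          Z ℕ.* b                       ≤⟨ ℕ.*-monoʳ-≤ Z (ℕ.<⇒≤ close) ⟩
          Z ℕ.* (a ℕ.+ D)               ≡⟨ ℕ.*-distribˡ-+ Z a D ⟩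
          Z ℕ.* a ℕ.+ Z ℕ.* D           ∎) ⟩
        Z ℕ.* D                      ∎)
        where open ℕ.≤-Reasoning

      -- Before rounding a step gains at least `Z / W ≥ suc u`; the spare unit pays for the floor in
      -- `next`.
      growth : ∀ Z u → W ℕ.* suc u ℕ.≤ Z → Z ℕ.+ u ℕ.≤ next Z
      growth Z u h = ℕ.≮⇒≥ λ Y<Z+u → ℕ.<⇒≱ (Z<Wu Y<Z+u) (ℕ.≤-trans (ℕ.*-monoʳ-≤ W (ℕ.n≤1+n u)) h)
        where
        open ℕ.≤-Reasoning
        Z<Wu : next Z ℕ.< Z ℕ.+ u → Z ℕ.< W ℕ.* u
        Z<Wu lt = ℕ.*-cancelʳ-< d Z (W ℕ.* u) (ℕ.+-cancelˡ-< (Z ℕ.* a) (Z ℕ.* d) (W ℕ.* u ℕ.* d) (begin-strict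
          Z ℕ.* a ℕ.+ Z ℕ.* d           ≡⟨ sym (ℕ.*-distribˡ-+ Z a d) ⟩
          Z ℕ.* (a ℕ.+ d)               ≤⟨ ℕ.*-monoʳ-≤ Z gap ⟩
          Z ℕ.* b                       <⟨ <÷-* (Z ℕ.* b) 1≤a ⟩
          suc (next Z) ℕ.* a            ≤⟨ ℕ.*-monoˡ-≤ a lt ⟩
          (Z ℕ.+ u) ℕ.* a               ≡⟨ ℕ.*-distribʳ-+ a Z u ⟩
          Z ℕ.* a ℕ.+ u ℕ.* a           ≤⟨ ℕ.+-monoʳ-≤ (Z ℕ.* a) (ℕ.*-monoʳ-≤ u (ℕ.<⇒≤ a<32Q)) ⟩
          Z ℕ.* a ℕ.+ u ℕ.* (32 ℕ.* Q)  ≡⟨ cong (Z ℕ.* a ℕ.+_) (trans (cong (u ℕ.*_) 32Q≡Wd) (eq u W d)) ⟩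
          Z ℕ.* a ℕ.+ W ℕ.* u ℕ.* d     ∎))
          where
          eq : ∀ u W d → u ℕ.* (W ℕ.* d) ≡ W ℕ.* u ℕ.* d
          eq = ℕ-Solver.solve-∀

      -- The cost, scaled by `Q`, of a last incomplete step, which covers at most a proportion
      -- `1 / E` and is handled by `A-lipschitz`.
      slack : ℚ
      slack = 2ℚ * (⟦ Q ⟧ * inv E)

      0≤slack : 0ℚ ≤ slack
      0≤slack = 0≤* 0≤2 (0≤* (0≤⟦⟧ Q) (0≤inv E))

      near-A : ∀ Z X → 1 ℕ.≤ Z → Z ℕ.≤ X → X ℕ.≤ next Z → ⟦ Q ⟧ * ∣ A X - A Z ∣ ≤ slack
      near-A Z X 1≤Z Z≤X X≤Y = *-cancel-≤ ⟦ X ⟧ (0<⟦⟧ (ℕ.≤-trans 1≤Z Z≤X))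
        (by-diff (0≤+ (0≤* (0≤⟦⟧ Q) (diff (A-lipschitz 1≤Z Z≤X))) (0≤* (0≤* 0≤2 (0≤⟦⟧ Q)) (diff gap≤))) (eq ⟦ Q ⟧ ⟦ X ⟧ (inv E) (∣ A X - A Z ∣) ⟦ Z ⟧))
        where
        gap≤ : ⟦ X ⟧ - ⟦ Z ⟧ ≤ inv E * ⟦ X ⟧
        gap≤ = ≤inv* 1≤E (≤-resp (trans (⟦⟧-* (X ℕ.∸ Z) E) (trans (ℚ.*-comm _ ⟦ E ⟧) (cong (⟦ E ⟧ *_) sub))) refl (⟦⟧-mono (ℕ.≤-trans (near Z X Z≤X X≤Y) Z≤X)))
          where
          cancel : ∀ x y → x + y - x ≡ y
          cancel = Solver.solve-∀ ring
          sub : ⟦ X ℕ.∸ Z ⟧ ≡ ⟦ X ⟧ - ⟦ Z ⟧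
          sub = sym (trans (cong (λ t → ⟦ t ⟧ - ⟦ Z ⟧) (sym (ℕ.m+[n∸m]≡n Z≤X))) (trans (cong (_- ⟦ Z ⟧) (⟦⟧-+ Z (X ℕ.∸ Z))) (cancel ⟦ Z ⟧ _)))
        eq : ∀ q x i t z → x * (2ℚ * (q * i)) - x * (q * t) ≡ q * (2ℚ * (x - z) - x * t) + 2ℚ * q * (i * x - (x - z))
        eq = Solver.solve-∀ ring

      -- Every step from `Z` to `next Z` advances by at least `u` and costs 21 after scaling by `Q`.
      -- The conditions on `Z` persist as it grows, so `u` stays fixed, and at most `l` steps bring
      -- `X` within one step.
      chain : ∀ l u Z X → θ ℕ.≤ Z → W ℕ.* suc u ℕ.≤ Z → Z ℕ.≤ X → X ℕ.≤ Z ℕ.+ l ℕ.* u → ⟦ Q ⟧ * ∣ A X - A Z ∣ ≤ ⟦ l ⟧ * 21ℚ + slack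
      chain zero u Z X θ≤Z Wu≤Z Z≤X X≤ = ≤-resp (sym zeroL) refl (0≤+ (0≤* (0≤⟦⟧ 0) 0≤21) 0≤slack)
        where
        zeroL : ⟦ Q ⟧ * ∣ A X - A Z ∣ ≡ 0ℚ
        zeroL = trans (cong (λ t → ⟦ Q ⟧ * ∣ A t - A Z ∣) (ℕ.≤-antisym (subst (X ℕ.≤_) (ℕ.+-identityʳ Z) X≤) Z≤X)) (trans (cong (λ t → ⟦ Q ⟧ * ∣ t ∣) (ℚ.+-inverseʳ (A Z))) (ℚ.*-zeroʳ ⟦ Q ⟧))
      chain (suc l) u Z X θ≤Z Wu≤Z Z≤X X≤ = go (ℕ.≤-total X Y)
        where
        Y : ℕ
        Y = next Z
        1≤Z : 1 ℕ.≤ Z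
        1≤Z = ℕ.≤-trans (s≤s z≤n) θ≤Z
        Z+u≤Y : Z ℕ.+ u ℕ.≤ Y
        Z+u≤Y = growth Z u Wu≤Z
        Z≤Y : Z ℕ.≤ Y
        Z≤Y = ℕ.≤-trans (ℕ.m≤m+n Z u) Z+u≤Y
        go : X ℕ.≤ Y ⊎ Y ℕ.≤ X → ⟦ Q ⟧ * ∣ A X - A Z ∣ ≤ ⟦ suc l ⟧ * 21ℚ + slack
        go (inj₁ X≤Y) = by-diff (0≤+ (diff (near-A Z X 1≤Z Z≤X X≤Y)) (0≤* (0≤⟦⟧ (suc l)) 0≤21)) (eq (⟦ Q ⟧ * ∣ A X - A Z ∣) slack (⟦ suc l ⟧ * 21ℚ))
          where
          eq : ∀ t s k → k + s - t ≡ (s - t) + k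
          eq = Solver.solve-∀ ring
        go (inj₂ Y≤X) = by-diff (0≤+ (diff (chain l u Y X (ℕ.≤-trans θ≤Z Z≤Y) (ℕ.≤-trans Wu≤Z Z≤Y) Y≤X X≤′)) (0≤+ (diff (shift 1≤Q fam Z θ≤Z)) (0≤* (0≤⟦⟧ Q) (diff triangle))))
            (trans (cong (λ t → t * 21ℚ + slack - ⟦ Q ⟧ * ∣ A X - A Z ∣) (⟦⟧-suc l)) (eq ⟦ Q ⟧ ⟦ l ⟧ slack (∣ A X - A Z ∣) (∣ A X - A Y ∣) (∣ A Z - A Y ∣)))
          where
          X≤′ : X ℕ.≤ Y ℕ.+ l ℕ.* u
          X≤′ = ℕ.≤-trans X≤ (ℕ.≤-trans (ℕ.≤-reflexive (sym (ℕ.+-assoc Z u (l ℕ.* u)))) (ℕ.+-monoˡ-≤ (l ℕ.* u) Z+u≤Y))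
          triangle : ∣ A X - A Z ∣ ≤ ∣ A X - A Y ∣ + ∣ A Z - A Y ∣
          triangle = subst (λ t → ∣ t ∣ ≤ ∣ A X - A Y ∣ + ∣ A Z - A Y ∣) (tele (A X) (A Y) (A Z)) (ℚ.∣p-q∣≤∣p∣+∣q∣ (A X - A Y) (A Z - A Y))
            where
            tele : ∀ x y z → x - y - (z - y) ≡ x - z
            tele = Solver.solve-∀ ring
          eq : ∀ q l s t u v → (1ℚ + l) * 21ℚ + s - q * t ≡ (l * 21ℚ + s - q * u) + ((21ℚ - q * v) + q * (u + v - t))
          eq = Solver.solve-∀ ring

      module _ (1≤W : 1 ℕ.≤ W) (ps : List ℕ) (prs : All Prime ps) (un : Unique ps) (E≤ : All (E ℕ.≤_) ps) (rich : ⟦ E ℕ.* E ⟧ ≤ recip ps)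
               (B : ℕ) (≤B : All (ℕ._≤ B) ps) (Q-large : W ℕ.* B ℕ.* E ℕ.* 126 ℕ.≤ Q) where

        S : ℚ
        S = recip ps

        -- For `p ≤ B` the first summand ensures `θ + 2 W ≤ X ÷ p`, which a chain starting at
        -- `X ÷ p` requires; the second is the length condition of `turan-kubilius`.
        κ X₀ : ℕ
        κ = length ps
        X₀ = suc (B ℕ.* (θ ℕ.+ 2 ℕ.* W) ℕ.+ κ ℕ.* (E ℕ.* E))

        -- Take `u = Z ÷ W − 1` for `Z = X ÷ p`, which is at least 1. Then `X ≤ 2 Z p` and
        -- `Z ≤ (u + 2) W ≤ 3 u W`, whence the factor 6.
        reach : ∀ X p → 1 ℕ.≤ p → 2 ℕ.* W ℕ.≤ X ÷ p → ∃ λ u → W ℕ.* suc u ℕ.≤ X ÷ p × X ℕ.≤ X ÷ p ℕ.+ W ℕ.* p ℕ.* 6 ℕ.* u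
        reach X p 1≤p 2W≤Z = find (Z ÷ W) (subst (ℕ._≤ Z) (ℕ.*-comm (Z ÷ W) W) (÷-*≤ Z W)) (<÷-* Z 1≤W) (*≤⇒≤÷ 1≤W 2W≤Z)
          where
          open ℕ.≤-Reasoning
          Z = X ÷ p
          1≤Z : 1 ℕ.≤ Z
          1≤Z = ℕ.≤-trans (ℕ.*-mono-≤ (s≤s (z≤n {1})) 1≤W) 2W≤Z
          find : ∀ v → W ℕ.* v ℕ.≤ Z → Z ℕ.< suc v ℕ.* W → 2 ℕ.≤ v → ∃ λ u → W ℕ.* suc u ℕ.≤ Z × X ℕ.≤ Z ℕ.+ W ℕ.* p ℕ.* 6 ℕ.* u
          find (suc zero) _ _ (s≤s ())
          find (suc u@(suc u′)) lo hi _ = u , lo , (begin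
            X                                  ≤⟨ ℕ.<⇒≤ (<÷-* X 1≤p) ⟩
            suc Z ℕ.* p                        ≤⟨ ℕ.*-monoˡ-≤ p (ℕ.+-monoˡ-≤ Z 1≤Z) ⟩
            (Z ℕ.+ Z) ℕ.* p                    ≤⟨ ℕ.*-monoˡ-≤ p (ℕ.+-mono-≤ (ℕ.<⇒≤ hi) (ℕ.<⇒≤ hi)) ⟩
            (suc (suc u) ℕ.* W ℕ.+ suc (suc u) ℕ.* W) ℕ.* p   ≤⟨ ℕ.m≤m+n _ (4 ℕ.* u′ ℕ.* W ℕ.* p) ⟩
            (suc (suc u) ℕ.* W ℕ.+ suc (suc u) ℕ.* W) ℕ.* p ℕ.+ 4 ℕ.* u′ ℕ.* W ℕ.* p  ≡⟨ eq u′ W p ⟩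
            W ℕ.* p ℕ.* 6 ℕ.* u                ≤⟨ ℕ.m≤n+m _ Z ⟩
            Z ℕ.+ W ℕ.* p ℕ.* 6 ℕ.* u          ∎)
            where
            eq : ∀ v W p → (suc (suc (suc v)) ℕ.* W ℕ.+ suc (suc (suc v)) ℕ.* W) ℕ.* p ℕ.+ 4 ℕ.* v ℕ.* W ℕ.* p ≡ W ℕ.* p ℕ.* 6 ℕ.* suc v
            eq = ℕ-Solver.solve-∀

        -- The chain from `X ÷ p` has at most `6 W p ≤ 6 W B` steps of cost 21/Q. As `126 = 6 * 21`,
        -- `Q-large` limits their total to 1/E; the incomplete step adds 2/E.
        stable : ∀ X → X₀ ℕ.≤ X → ∀ p → p ∈ ps → ∣ A X - A (X ÷ p) ∣ ≤ 3ℚ * inv E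
        stable X X≥ p p∈ = *-cancel-≤ ⟦ Q ⟧ (0<⟦⟧ 1≤Q) (by-diff (0≤+ (diff chained) (diff l≤)) (eq ⟦ Q ⟧ (inv E) (∣ A X - A Z ∣) (⟦ l ⟧ * 21ℚ)))
          where
          Z l u : ℕ
          Z = X ÷ p
          l = W ℕ.* p ℕ.* 6
          1≤p : 1 ℕ.≤ p
          1≤p = prime≥1 (All.lookup prs p∈)
          Z-large : θ ℕ.+ 2 ℕ.* W ℕ.≤ Z
          Z-large = *≤⇒≤÷ 1≤p (ℕ.≤-trans (ℕ.≤-trans (ℕ.≤-reflexive (ℕ.*-comm (θ ℕ.+ 2 ℕ.* W) p)) (ℕ.*-monoˡ-≤ (θ ℕ.+ 2 ℕ.* W) (All.lookup ≤B p∈)))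
            (ℕ.≤-trans (ℕ.≤-trans (ℕ.m≤m+n _ (κ ℕ.* (E ℕ.* E))) (ℕ.n≤1+n _)) X≥))
          reached = reach X p 1≤p (ℕ.≤-trans (ℕ.m≤n+m (2 ℕ.* W) θ) Z-large)
          u = proj₁ reached
          chained : ⟦ Q ⟧ * ∣ A X - A Z ∣ ≤ ⟦ l ⟧ * 21ℚ + slack
          chained = chain l u Z X (ℕ.≤-trans (ℕ.m≤m+n θ (2 ℕ.* W)) Z-large) (proj₁ (proj₂ reached)) (÷≤ X p) (proj₂ (proj₂ reached))
          l≤ : ⟦ l ⟧ * 21ℚ ≤ inv E * ⟦ Q ⟧
          l≤ = ≤inv* 1≤E (≤-resp (trans (⟦⟧-* E (l ℕ.* 21)) (cong (⟦ E ⟧ *_) (trans (⟦⟧-* l 21) (cong (⟦ l ⟧ *_) ⟦21⟧)))) refl (⟦⟧-mono (begin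
              E ℕ.* (l ℕ.* 21)                ≡⟨ eq₁ E W p ⟩
              W ℕ.* p ℕ.* E ℕ.* 126           ≤⟨ ℕ.*-monoˡ-≤ 126 (ℕ.*-monoˡ-≤ E (ℕ.*-monoʳ-≤ W (All.lookup ≤B p∈))) ⟩
              W ℕ.* B ℕ.* E ℕ.* 126           ≤⟨ Q-large ⟩
              Q                               ∎)))
            where
            open ℕ.≤-Reasoning
            eq₁ : ∀ E W p → E ℕ.* (W ℕ.* p ℕ.* 6 ℕ.* 21) ≡ W ℕ.* p ℕ.* E ℕ.* 126
            eq₁ = ℕ-Solver.solve-∀
          eq : ∀ q i t k → q * (3ℚ * i) - q * t ≡ (k + 2ℚ * (q * i) - q * t) + (i * q - k)
          eq = Solver.solve-∀ ring

        -- Turán-Kubilius says that `S F(X)` nearly cancels the sum of the `F(X/p)`, whereas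
        -- stability makes that sum nearly `S X A(X) = S F(X)`. So `2 S X A(X)` is small: in units
        -- of `S X / E` the errors are 4 from Turán-Kubilius, 3 from stability and 1 from floors.
        decay : ∀ X → X₀ ℕ.≤ X → ⟦ E ⟧ * ∣ A X ∣ ≤ 4ℚ
        decay X X≥ = *-cancel-≤ (2ℚ * (S * ⟦ X ⟧)) 0<2SX (by-diff (0≤+ (0≤* (0≤⟦⟧ E) (diff triangle)) (0≤+ (diff tk) (0≤+ (diff scaled) (diff κE≤))))
            (eq ⟦ E ⟧ (S * ⟦ X ⟧) (∣ A X ∣) (∣ U ∣) (∣ V ∣) ⟦ κ ⟧))
          where
          1≤X : 1 ℕ.≤ X
          1≤X = ℕ.≤-trans (s≤s z≤n) X≥
          FX U V : ℚ
          FX = ∑ ps (λ p → F (X ÷ p))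
          U = S * F X + FX
          V = FX - S * ⟦ X ⟧ * A X
          E² : ⟦ E ℕ.* E ⟧ ≡ ⟦ E ⟧ * ⟦ E ⟧
          E² = ⟦⟧-* E E
          κE²≤X : ⟦ κ ⟧ * (⟦ E ⟧ * ⟦ E ⟧) ≤ ⟦ X ⟧
          κE²≤X = subst (_≤ ⟦ X ⟧) (trans (⟦⟧-* κ (E ℕ.* E)) (cong (⟦ κ ⟧ *_) E²)) (⟦⟧-mono (ℕ.≤-trans (ℕ.≤-trans (ℕ.m≤n+m _ (B ℕ.* (θ ℕ.+ 2 ℕ.* W))) (ℕ.n≤1+n _)) X≥))
          tk : ⟦ E ⟧ * ∣ U ∣ ≤ 4ℚ * (S * ⟦ X ⟧)
          tk = turan-kubilius f ∣f∣≤1 f-prime X ps E prs un E≤ 1≤E (subst (_≤ S) E² rich) κE²≤X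
          1≤S : 1ℚ ≤ S
          1≤S = ℚ.≤-trans (1≤⟦⟧ (ℕ.*-mono-≤ 1≤E 1≤E)) rich
          1≤SX : 1ℚ ≤ S * ⟦ X ⟧
          1≤SX = by-diff (0≤+ (0≤* (diff 1≤S) (0≤⟦⟧ X)) (diff (1≤⟦⟧ 1≤X))) (eq₂ S ⟦ X ⟧)
            where
            eq₂ : ∀ s x → s * x - 1ℚ ≡ (s - 1ℚ) * x + (x - 1ℚ)
            eq₂ = Solver.solve-∀ ring
          0<2SX : 0ℚ < 2ℚ * (S * ⟦ X ⟧)
          0<2SX = ℚ.<-≤-trans 0<1 (by-diff (0≤+ (diff 1≤SX) (0≤+ 0≤1 (diff 1≤SX))) (eq₂ (S * ⟦ X ⟧)))
            where
            eq₂ : ∀ s → 2ℚ * s - 1ℚ ≡ (s - 1ℚ) + (1ℚ + (s - 1ℚ))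
            eq₂ = Solver.solve-∀ ring
          κE≤ : ⟦ κ ⟧ * ⟦ E ⟧ ≤ S * ⟦ X ⟧
          κE≤ = by-diff (0≤+ (0≤* (diff 1≤S) (0≤⟦⟧ X)) (0≤+ (diff κE²≤X) (0≤* (0≤* (0≤⟦⟧ κ) (0≤⟦⟧ E)) (diff (1≤⟦⟧ 1≤E))))) (eq₃ S ⟦ X ⟧ ⟦ κ ⟧ ⟦ E ⟧)
            where
            eq₃ : ∀ s x k q → s * x - k * q ≡ (s - 1ℚ) * x + ((x - k * (q * q)) + k * q * (q - 1ℚ))
            eq₃ = Solver.solve-∀ ring
          -- Write `F(X ÷ p)` as `Z A(Z)` with `Z = X ÷ p`. Replacing `A(Z)` by `A(X)` costs
          -- `3 Z / E`, and replacing `Z` by `X / p` costs at most 1.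
          V-abs : ∣ V ∣ ≤ S * ⟦ X ⟧ * (3ℚ * inv E) + ⟦ κ ⟧ * 1ℚ
          V-abs = ≤-resp (cong ∣_∣ (trans (∑-- ps (λ p → F (X ÷ p)) (λ p → ⟦ X ⟧ * A X * inv p)) (cong (λ t → FX - t) (trans (∑-* ps (⟦ X ⟧ * A X) inv) (rot ⟦ X ⟧ (A X) S)))))
              (trans (∑-+ ps (λ p → ⟦ X ⟧ * (3ℚ * inv E) * inv p) (λ _ → 1ℚ)) (cong₂ _+_ (trans (∑-* ps (⟦ X ⟧ * (3ℚ * inv E)) inv) (rot ⟦ X ⟧ (3ℚ * inv E) S)) (∑-const ps 1ℚ)))
              (∑-abs-≤ ps {λ p → F (X ÷ p) - ⟦ X ⟧ * A X * inv p} term)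
            where
            rot : ∀ x a s → x * a * s ≡ s * x * a
            rot = Solver.solve-∀ ring
            term : ∀ p → p ∈ ps → ∣ F (X ÷ p) - ⟦ X ⟧ * A X * inv p ∣ ≤ ⟦ X ⟧ * (3ℚ * inv E) * inv p + 1ℚ
            term p p∈ = subst (λ t → ∣ t ∣ ≤ ⟦ X ⟧ * (3ℚ * inv E) * inv p + 1ℚ) (sym decompose)
                (ℚ.≤-trans (ℚ.∣p-q∣≤∣p∣+∣q∣ (⟦ Z ⟧ * (A Z - A X)) ((inv p * ⟦ X ⟧ - ⟦ Z ⟧) * A X))
                  (ℚ.+-mono-≤ first
                    (subst (∣ (inv p * ⟦ X ⟧ - ⟦ Z ⟧) * A X ∣ ≤_) (ℚ.*-identityˡ 1ℚ) (∣∣-*-≤ {inv p * ⟦ X ⟧ - ⟦ Z ⟧} {A X} fraction (∣A∣≤1 X)))))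
              where
              Z = X ÷ p
              1≤p : 1 ℕ.≤ p
              1≤p = prime≥1 (All.lookup prs p∈)
              1≤Z : 1 ℕ.≤ Z
              1≤Z = *≤⇒≤÷ 1≤p (ℕ.≤-trans (ℕ.≤-reflexive (ℕ.*-identityˡ p)) (ℕ.≤-trans (All.lookup ≤B p∈) (ℕ.≤-trans B≤ X≥)))
                where
                B≤ : B ℕ.≤ X₀
                B≤ = ℕ.≤-trans (ℕ.≤-trans (ℕ.≤-reflexive (sym (ℕ.*-identityʳ B))) (ℕ.*-monoʳ-≤ B (s≤s (z≤n {κ′}))))
                  (ℕ.≤-trans (ℕ.m≤m+n _ (κ ℕ.* (E ℕ.* E))) (ℕ.n≤1+n _))
                  where κ′ = length pairs ℕ.* (Q ℕ.* Q) ℕ.+ 2 ℕ.* W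
              stable′ : ∣ A Z - A X ∣ ≤ 3ℚ * inv E
              stable′ = subst (_≤ 3ℚ * inv E) (trans (sym (ℚ.∣-p∣≡∣p∣ (A X - A Z))) (cong ∣_∣ (neg (A X) (A Z)))) (stable X X≥ p p∈)
                where
                neg : ∀ x y → - (x - y) ≡ y - x
                neg = Solver.solve-∀ ring
              fraction : ∣ inv p * ⟦ X ⟧ - ⟦ Z ⟧ ∣ ≤ 1ℚ
              fraction = ≤-resp (sym (ℚ.0≤p⇒∣p∣≡p (diff (÷≤ℚ X 1≤p)))) refl (by-diff (diff (≤÷+1ℚ X 1≤p)) (eq₅ (inv p * ⟦ X ⟧) ⟦ Z ⟧))
                where
                eq₅ : ∀ a z → 1ℚ - (a - z) ≡ 1ℚ + z - a
                eq₅ = Solver.solve-∀ ring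
              eq₄ : ∀ z c x i → x * c * i - z * c ≡ (i * x - z) * c
              eq₄ = Solver.solve-∀ ring
              first : ∣ ⟦ Z ⟧ * (A Z - A X) ∣ ≤ ⟦ X ⟧ * (3ℚ * inv E) * inv p
              first = ℚ.≤-trans (∣∣-*-≤ {⟦ Z ⟧} {A Z - A X} (ℚ.≤-reflexive (ℚ.0≤p⇒∣p∣≡p (0≤⟦⟧ Z))) stable′)
                (by-diff (0≤* (diff (÷≤ℚ X 1≤p)) (0≤* (0≤+ 0≤1 0≤2) (0≤inv E))) (eq₄ ⟦ Z ⟧ (3ℚ * inv E) ⟦ X ⟧ (inv p)))
              decompose : F Z - ⟦ X ⟧ * A X * inv p ≡ ⟦ Z ⟧ * (A Z - A X) - (inv p * ⟦ X ⟧ - ⟦ Z ⟧) * A X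
              decompose = trans (cong (_- ⟦ X ⟧ * A X * inv p) (F≡XA 1≤Z)) (alg ⟦ Z ⟧ (A Z) ⟦ X ⟧ (A X) (inv p))
                where
                alg : ∀ z b x a i → z * b - x * a * i ≡ z * (b - a) - (i * x - z) * a
                alg = Solver.solve-∀ ring
          scaled : ⟦ E ⟧ * ∣ V ∣ ≤ S * ⟦ X ⟧ * 3ℚ + ⟦ κ ⟧ * ⟦ E ⟧
          scaled = subst (λ t → ⟦ E ⟧ * ∣ V ∣ ≤ S * ⟦ X ⟧ * (3ℚ * t) + ⟦ κ ⟧ * ⟦ E ⟧) (inv-inverse 1≤E) (by-diff (0≤* (0≤⟦⟧ E) (diff V-abs)) (eq₆ ⟦ E ⟧ (inv E) (S * ⟦ X ⟧) ⟦ κ ⟧ (∣ V ∣)))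
            where
            eq₆ : ∀ q i s k v → s * (3ℚ * (i * q)) + k * q - q * v ≡ q * (s * (3ℚ * i) + k * 1ℚ - v)
            eq₆ = Solver.solve-∀ ring
          triangle : 2ℚ * (S * ⟦ X ⟧) * ∣ A X ∣ ≤ ∣ U ∣ + ∣ V ∣
          triangle = ≤-resp (trans (cong ∣_∣ (trans (cong (λ t → S * t + FX - V) (F≡XA 1≤X)) (alg S ⟦ X ⟧ (A X) FX)))
              (trans (ℚ.∣p*q∣≡∣p∣*∣q∣ (2ℚ * (S * ⟦ X ⟧)) (A X)) (cong (_* ∣ A X ∣) (ℚ.0≤p⇒∣p∣≡p (ℚ.<⇒≤ 0<2SX)))))
            refl (ℚ.∣p-q∣≤∣p∣+∣q∣ U V)
            where
            alg : ∀ s x a g → s * (x * a) + g - (g - s * x * a) ≡ 2ℚ * (s * x) * a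
            alg = Solver.solve-∀ ring
          eq : ∀ q s a u v k → 2ℚ * s * 4ℚ - 2ℚ * s * (q * a) ≡ q * (u + v - 2ℚ * s * a) + ((4ℚ * s - q * u) + ((s * 3ℚ + k * q - q * v) + (s - k * q)))
          eq = Solver.solve-∀ ring

    -- The base family is fixed before r: a chain from x/p to x has O(W p) steps of error O(1/Q), and r makes Q large.
    mean-value-zero : ∀ e → ∃ λ X₀ → ∀ X → X₀ ℕ.≤ X → ⟦ 2 ℕ.^ e ⟧ * ∣ F X ∣ ≤ 4ℚ * ⟦ X ⟧
    mean-value-zero e = start , λ X X≥ → subst (λ t → ⟦ E ⟧ * t ≤ 4ℚ * ⟦ X ⟧) (∣F∣ X (ℕ.≤-trans (s≤s z≤n) X≥))
        (by-diff (0≤* (0≤⟦⟧ X) (diff (bound X X≥))) (eq ⟦ E ⟧ ⟦ X ⟧ (∣ A X ∣)))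
      where
      E W : ℕ
      E = 2 ℕ.^ e
      W = E ℕ.* E ℕ.* 4096 ℕ.* 32
      1≤E : 1 ℕ.≤ E
      1≤E = 1≤2^ e
      base = BuildFamily.family e 0 E (E ℕ.* E) (ℕ.*-mono-≤ 1≤E 1≤E)
      ps : List ℕ
      ps = map proj₁ (Family.pairs base)
      B r : ℕ
      B = proj₁ (upper-bound ps)
      r = W ℕ.* B ℕ.* E ℕ.* 126
      q Q d D : ℕ
      q = suc (e ℕ.+ e ℕ.+ 11) ℕ.+ r
      Q = 2 ℕ.^ q
      d = 2 ℕ.^ r
      D = 2 ℕ.^ e ℕ.* 4096 ℕ.* d
      Q≡ED : Q ≡ E ℕ.* D
      Q≡ED = Scale.Q≡ e r 0
      32Q≡Wd : 32 ℕ.* Q ≡ W ℕ.* d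
      32Q≡Wd = trans (cong (32 ℕ.*_) Q≡ED) (eq₁ E d)
        where
        eq₁ : ∀ E d → 32 ℕ.* (E ℕ.* (E ℕ.* 4096 ℕ.* d)) ≡ E ℕ.* E ℕ.* 4096 ℕ.* 32 ℕ.* d
        eq₁ = ℕ-Solver.solve-∀
      1≤QQ : 1 ℕ.≤ Q ℕ.* Q
      1≤QQ = ℕ.*-mono-≤ (1≤2^ q) (1≤2^ q)
      fam : Family Q d D Q (Q ℕ.* Q)
      fam = BuildFamily.family e r Q (Q ℕ.* Q) 1≤QQ
      1≤D : 1 ℕ.≤ D
      1≤D = ℕ.*-mono-≤ (ℕ.*-mono-≤ 1≤E (s≤s (z≤n {4095}))) (1≤2^ r)
      1≤W : 1 ℕ.≤ W
      1≤W = ℕ.*-mono-≤ (ℕ.*-mono-≤ (ℕ.*-mono-≤ 1≤E 1≤E) (s≤s (z≤n {4095}))) (s≤s (z≤n {31}))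
      r≤Q : r ℕ.≤ Q
      r≤Q = ℕ.≤-trans (n≤2^n r) (ℕ.^-monoʳ-≤ 2 (ℕ.m≤n+m r (suc (e ℕ.+ e ℕ.+ 11))))
      start : ℕ
      start = Chain.X₀ E W 1≤E 1≤D (1≤2^ r) Q≡ED 32Q≡Wd fam 1≤W ps (All.map⁺ (Family.prime₁ base)) (Family.unique₁ base) (All.map⁺ (Family.large₁ base)) (Family.abundant₁ base) B (proj₂ (upper-bound ps)) r≤Q
      bound : ∀ X → start ℕ.≤ X → ⟦ E ⟧ * ∣ A X ∣ ≤ 4ℚ
      bound = Chain.decay E W 1≤E 1≤D (1≤2^ r) Q≡ED 32Q≡Wd fam 1≤W ps (All.map⁺ (Family.prime₁ base)) (Family.unique₁ base) (All.map⁺ (Family.large₁ base)) (Family.abundant₁ base) B (proj₂ (upper-bound ps)) r≤Q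
      ∣F∣ : ∀ X → 1 ℕ.≤ X → ⟦ X ⟧ * ∣ A X ∣ ≡ ∣ F X ∣
      ∣F∣ X 1≤X = sym (trans (cong ∣_∣ (F≡XA 1≤X)) (trans (ℚ.∣p*q∣≡∣p∣*∣q∣ ⟦ X ⟧ (A X)) (cong (_* ∣ A X ∣) (ℚ.0≤p⇒∣p∣≡p (0≤⟦⟧ X)))))
      eq : ∀ e x a → 4ℚ * x - e * (x * a) ≡ x * (4ℚ - e * a)
      eq = Solver.solve-∀ ring

-- Dirichlet convolutions and the coefficients c(n)

module Convolutions where
  open Rationals
  open Sums
  open Division
  open Moebius

  ∑-single : ∀ {n k} (g : ℕ → ℚ) → 1 ℕ.≤ k → k ℕ.≤ n → (∀ j → 1 ℕ.≤ j → j ℕ.≤ n → j ≢ k → g j ≡ 0ℚ) → ∑ [1… n ] g ≡ g k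
  ∑-single {zero} g 1≤k k≤n h = contradiction (ℕ.≤-trans 1≤k k≤n) λ ()
  ∑-single {suc n} {k} g 1≤k k≤n h with k ℕ.≟ suc n
  ... | yes refl = trans (cong (g (suc n) +_) (∑-zero [1… n ] (λ j j∈ → h j (proj₁ (∈[1…]⁻ n j∈)) (ℕ.m≤n⇒m≤1+n (proj₂ (∈[1…]⁻ n j∈))) (ℕ.<⇒≢ (s≤s (proj₂ (∈[1…]⁻ n j∈))))))) (ℚ.+-identityʳ (g (suc n)))
  ... | no k≢ = trans (cong₂ _+_ (h (suc n) (s≤s z≤n) ℕ.≤-refl (λ e → k≢ (sym e)))
      (∑-single g 1≤k (ℕ.≤-pred (ℕ.≤∧≢⇒< k≤n k≢)) (λ j 1≤j j≤n → h j 1≤j (ℕ.m≤n⇒m≤1+n j≤n)))) (ℚ.+-identityˡ (g k))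

  _⋆_ : (ℕ → ℚ) → (ℕ → ℚ) → ℕ → ℚ
  (u ⋆ φ) n = ∑ [1… n ] (λ k → 𝟙 (k ∣? n) * (u k * φ (n ÷ k)))

  -- Both sides sum `u k * φ m` over the pairs with `k m ≤ x`, grouped by `k` or by the product.
  ∑-⋆ : ∀ (u φ : ℕ → ℚ) x → ∑ [1… x ] (λ k → u k * ∑ [1… x ÷ k ] φ) ≡ ∑ [1… x ] (u ⋆ φ)
  ∑-⋆ u φ x = trans (∑-cong [1… x ] (λ k k∈ → row k (proj₁ (∈[1…]⁻ x k∈))))
      (trans (∑-swap [1… x ] [1… x ] (λ k n → 𝟙 (k ∣? n) * (u k * φ (n ÷ k))))
        (∑-cong [1… x ] (λ n n∈ → ∑-extend (λ k → 𝟙 (k ∣? n) * (u k * φ (n ÷ k))) (proj₂ (∈[1…]⁻ x n∈)) (λ k n<k _ →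
          trans (cong (_* (u k * φ (n ÷ k))) (𝟙-no (k ∣? n) (λ d → ℕ.<⇒≱ n<k (∣⇒≤′ (proj₁ (∈[1…]⁻ x n∈)) d)))) (ℚ.*-zeroˡ (u k * φ (n ÷ k)))))))
    where
    row : ∀ k → 1 ℕ.≤ k → u k * ∑ [1… x ÷ k ] φ ≡ ∑ [1… x ] (λ n → 𝟙 (k ∣? n) * (u k * φ (n ÷ k)))
    row k 1≤k = trans (sym (∑-* [1… x ÷ k ] (u k) φ)) (trans
      (∑-cong [1… x ÷ k ] (λ m _ → cong (λ t → u k * φ t) (sym (trans (cong (_÷ k) (ℕ.*-comm k m)) (*÷ m 1≤k)))))
      (sym (∑-multiples x (λ n → u k * φ (n ÷ k)) 1≤k)))

  cofactor : ∀ {k n} → 1 ℕ.≤ k → k ∣ n → n ≡ (n ÷ k) ℕ.* k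
  cofactor {k} 1≤k (divides q refl) = cong (ℕ._* k) (sym (*÷ q 1≤k))

  inv-cofactor : ∀ {k n} → 1 ℕ.≤ k → 1 ℕ.≤ n → k ∣ n → inv k * inv (n ÷ k) ≡ inv n
  inv-cofactor {k} {n} 1≤k 1≤n d = trans (ℚ.*-comm (inv k) (inv (n ÷ k))) (sym (trans (cong inv (cofactor 1≤k d)) (inv-* 1≤q 1≤k)))
    where
    1≤q : 1 ℕ.≤ n ÷ k
    1≤q = *≤⇒≤÷ 1≤k (subst (ℕ._≤ n) (sym (ℕ.*-identityˡ k)) (∣⇒≤′ 1≤n d))

  μ/ : ℕ → ℚ
  μ/ k = μℚ k * inv k

  μℚ1 : μℚ 1 ≡ 1ℚ
  μℚ1 = ι1

  ∑-unit : ∀ {x} (g : ℕ → ℚ) → 1 ℕ.≤ x → g 1 ≡ 1ℚ → (∀ n → 2 ℕ.≤ n → g n ≡ 0ℚ) → ∑ [1… x ] g ≡ 1ℚ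
  ∑-unit g 1≤x e h = trans (∑-single g ℕ.≤-refl 1≤x (λ { zero () ; (suc zero) _ _ n≢1 → contradiction refl n≢1 ; n@(suc (suc _)) _ _ _ → h n (s≤s (s≤s z≤n)) })) e

  ∑-μ-divisors : ∀ n → ∑ [1… n ] (λ k → 𝟙 (k ∣? n) * (μℚ k * 1ℚ)) ≡ ∑ [1… n ] (λ k → 𝟙 (k ∣? n) * μℚ k)
  ∑-μ-divisors n = ∑-cong [1… n ] (λ k _ → cong (𝟙 (k ∣? n) *_) (ℚ.*-identityʳ (μℚ k)))

  one-one : 𝟙 (1 ∣? 1) * μℚ 1 + 0ℚ ≡ 1ℚ
  one-one = trans (ℚ.+-identityʳ _) (trans (cong₂ _*_ (𝟙-yes (1 ∣? 1) ∣-refl) μℚ1) (ℚ.*-identityˡ 1ℚ))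

  ∑-μ-floor : ∀ {x} → 1 ℕ.≤ x → ∑ [1… x ] (λ k → μℚ k * ⟦ x ÷ k ⟧) ≡ 1ℚ
  ∑-μ-floor {x} 1≤x = trans (∑-cong [1… x ] (λ k _ → cong (μℚ k *_) (sym (trans (∑-const [1… x ÷ k ] 1ℚ) (trans (ℚ.*-identityʳ _) (cong ⟦_⟧ (length-[1…] (x ÷ k))))))))
    (trans (∑-⋆ μℚ (λ _ → 1ℚ) x) (∑-unit (μℚ ⋆ (λ _ → 1ℚ)) 1≤x (trans (∑-μ-divisors 1) one-one) (λ n 2≤n → trans (∑-μ-divisors n) (∑-divisors-μ 2≤n))))

  H : ℕ → ℚ
  H n = ∑ [1… n ] inv

  -- A divisor `k` of `n` contributes `μ(k)/k` times `k/n`, so the convolution at `n` is `1/n` times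
  -- the divisor sum of μ, which vanishes unless `n` is 1.
  ∑-μ-H : ∀ {x} → 1 ℕ.≤ x → ∑ [1… x ] (λ k → μ/ k * H (x ÷ k)) ≡ 1ℚ
  ∑-μ-H {x} 1≤x = trans (∑-⋆ μ/ inv x) (∑-unit (μ/ ⋆ inv) 1≤x
      (trans (scaled 1 (s≤s z≤n)) (trans (cong₂ _*_ inv-1 one-one) (ℚ.*-identityˡ 1ℚ)))
      (λ n 2≤n → trans (scaled n (ℕ.<⇒≤ 2≤n)) (trans (cong (inv n *_) (∑-divisors-μ 2≤n)) (ℚ.*-zeroʳ (inv n)))))
    where
    scaled : ∀ n → 1 ℕ.≤ n → (μ/ ⋆ inv) n ≡ inv n * ∑ [1… n ] (λ k → 𝟙 (k ∣? n) * μℚ k)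
    scaled n 1≤n = trans (∑-cong [1… n ] (λ k k∈ → term k (proj₁ (∈[1…]⁻ n k∈)))) (∑-* [1… n ] (inv n) (λ k → 𝟙 (k ∣? n) * μℚ k))
      where
      assoc : ∀ a b c → a * b * c ≡ b * c * a
      assoc = Solver.solve-∀ ring
      term : ∀ k → 1 ℕ.≤ k → 𝟙 (k ∣? n) * (μ/ k * inv (n ÷ k)) ≡ inv n * (𝟙 (k ∣? n) * μℚ k)
      term k 1≤k with k ∣? n
      ... | no _ = zeros (μ/ k * inv (n ÷ k)) (inv n) (μℚ k)
        where
        zeros : ∀ a b c → 0ℚ * a ≡ b * (0ℚ * c)
        zeros = Solver.solve-∀ ring
      ... | yes d = trans (cong (1ℚ *_) (trans (assoc (μℚ k) (inv k) (inv (n ÷ k))) (cong (_* μℚ k) (inv-cofactor 1≤k 1≤n d)))) (ones (inv n) (μℚ k))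
        where
        ones : ∀ a b → 1ℚ * (a * b) ≡ a * (1ℚ * b)
        ones = Solver.solve-∀ ring

  square-< : ∀ r → r ℕ.* r ℕ.< suc r ℕ.* suc r
  square-< r = ℕ.*-mono-< (ℕ.n<1+n r) (ℕ.n<1+n r)

  isqrt : ℕ → ℕ
  isqrt zero = zero
  isqrt (suc n) with suc (isqrt n) ℕ.* suc (isqrt n) ℕ.≤? suc n
  ... | yes _ = suc (isqrt n)
  ... | no _ = isqrt n

  isqrt-lower : ∀ n → isqrt n ℕ.* isqrt n ℕ.≤ n
  isqrt-lower zero = z≤n
  isqrt-lower (suc n) with suc (isqrt n) ℕ.* suc (isqrt n) ℕ.≤? suc n
  ... | yes h = h
  ... | no _ = ℕ.m≤n⇒m≤1+n (isqrt-lower n)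

  isqrt-upper : ∀ n → n ℕ.< suc (isqrt n) ℕ.* suc (isqrt n)
  isqrt-upper zero = s≤s z≤n
  isqrt-upper (suc n) with suc (isqrt n) ℕ.* suc (isqrt n) ℕ.≤? suc n
  ... | yes h = ℕ.≤-<-trans (isqrt-upper n) (square-< (suc (isqrt n)))
  ... | no h = ℕ.≰⇒> h

  square-cancel-≤ : ∀ {m n} → m ℕ.* m ℕ.< suc n ℕ.* suc n → m ℕ.≤ n
  square-cancel-≤ {m} {n} h = ℕ.≮⇒≥ λ n<m → ℕ.<⇒≱ h (ℕ.*-mono-≤ n<m n<m)

  isqrt-unique : ∀ {n r} → r ℕ.* r ℕ.≤ n → n ℕ.< suc r ℕ.* suc r → isqrt n ≡ r
  isqrt-unique {n} {r} lo hi = ℕ.≤-antisym (square-cancel-≤ (ℕ.≤-<-trans (isqrt-lower n) hi)) (square-cancel-≤ (ℕ.≤-<-trans lo (isqrt-upper n)))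

  isqrt-square : ∀ m → isqrt (m ℕ.* m) ≡ m
  isqrt-square m = isqrt-unique ℕ.≤-refl (square-< m)

  isqrt-mono : ∀ {m n} → m ℕ.≤ n → isqrt m ℕ.≤ isqrt n
  isqrt-mono {m} {n} h = square-cancel-≤ (ℕ.≤-<-trans (ℕ.≤-trans (isqrt-lower m) h) (isqrt-upper n))

  1≤isqrt : ∀ {n} → 1 ℕ.≤ n → 1 ℕ.≤ isqrt n
  1≤isqrt {n} h = isqrt-mono h

  square? : ∀ n → Dec (isqrt n ℕ.* isqrt n ≡ n)
  square? n = isqrt n ℕ.* isqrt n ℕ.≟ n

  -- The function m² ↦ m divided by its argument: 1/m at m², and 0 off the squares.
  invsqrt : ℕ → ℚ
  invsqrt n = 𝟙 (square? n) * inv (isqrt n)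

  ∑-invsqrt : ∀ n → ∑ [1… n ] invsqrt ≡ H (isqrt n)
  ∑-invsqrt zero = refl
  ∑-invsqrt (suc n) = step (suc (isqrt n) ℕ.* suc (isqrt n) ℕ.≤? suc n)
    where
    r = isqrt n
    step : Dec (suc r ℕ.* suc r ℕ.≤ suc n) → invsqrt (suc n) + ∑ [1… n ] invsqrt ≡ H (isqrt (suc n))
    step (yes h) = trans (cong₂ _+_ head (∑-invsqrt n)) (cong H (sym e))
      where
      e : isqrt (suc n) ≡ suc r
      e = isqrt-unique h (ℕ.≤-<-trans (isqrt-upper n) (square-< (suc (isqrt n))))
      head : invsqrt (suc n) ≡ inv (suc r)
      head = trans (cong₂ _*_ (𝟙-yes (square? (suc n)) (trans (cong₂ ℕ._*_ e e) (ℕ.≤-antisym h (isqrt-upper n)))) (cong inv e)) (ℚ.*-identityˡ (inv (suc r)))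
    step (no h) = trans (cong₂ _+_ head (∑-invsqrt n)) (trans (ℚ.+-identityˡ (H r)) (cong H (sym e)))
      where
      e : isqrt (suc n) ≡ r
      e = isqrt-unique (ℕ.m≤n⇒m≤1+n (isqrt-lower n)) (ℕ.≰⇒> h)
      head : invsqrt (suc n) ≡ 0ℚ
      head = trans (cong (_* inv (isqrt (suc n))) (𝟙-no (square? (suc n)) λ s → ℕ.<⇒≢ (s≤s (isqrt-lower n)) (trans (cong₂ ℕ._*_ (sym e) (sym e)) s))) (ℚ.*-zeroˡ (inv (isqrt (suc n))))

  square-part : ∀ n → 1 ℕ.≤ n → ∃₂ λ m k → n ≡ m ℕ.* m ℕ.* k × SquareFree k
  square-part n 1≤n = go n n ℕ.≤-refl 1≤n
    where
    go : ∀ fuel n → n ℕ.≤ fuel → 1 ℕ.≤ n → ∃₂ λ m k → n ≡ m ℕ.* m ℕ.* k × SquareFree k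
    go zero n n≤ 1≤n = contradiction (ℕ.≤-trans 1≤n n≤) λ ()
    go (suc fuel) n n≤ 1≤n with squarefree⊎square 1≤n
    ... | inj₁ sf = 1 , n , sym (ℕ.+-identityʳ n) , sf
    ... | inj₂ (d , 2≤d , divides zero e) = contradiction e (ℕ.>⇒≢ 1≤n)
    ... | inj₂ (d , 2≤d , divides q@(suc q′) e) with go fuel q (ℕ.≤-pred (ℕ.≤-trans (subst (q ℕ.<_) (sym e) (ℕ.m<m*n q (d ℕ.* d) (ℕ.*-mono-≤ (ℕ.<⇒≤ 2≤d) 2≤d))) n≤)) (s≤s z≤n)
    ... | m , k , e′ , sf = d ℕ.* m , k , trans e (trans (cong (ℕ._* (d ℕ.* d)) e′) (eq d m k)) , sf
      where
      eq : ∀ d m k → m ℕ.* m ℕ.* k ℕ.* (d ℕ.* d) ≡ d ℕ.* m ℕ.* (d ℕ.* m) ℕ.* k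
      eq = ℕ-Solver.solve-∀

  -- Coprimality first gives `b ∣ k`. Writing `k = b q` and cancelling one `b` from the equation,
  -- the same argument gives `b ∣ q`.
  coprime-square-∣ : ∀ {a b} k k′ → 1 ℕ.≤ b → Coprime b a → b ℕ.* b ℕ.* k′ ≡ a ℕ.* a ℕ.* k → b ℕ.* b ∣ k
  coprime-square-∣ {a} {b} k k′ 1≤b co e with coprime-divisor co (coprime-divisor co (divides (b ℕ.* k′) (trans (sym (ℕ.*-assoc a a k)) (trans (sym e) (eq b k′)))))
    where
    eq : ∀ b k → b ℕ.* b ℕ.* k ≡ b ℕ.* k ℕ.* b
    eq = ℕ-Solver.solve-∀
  ... | divides q refl = subst (b ℕ.* b ∣_) (ℕ.*-comm b q) (*-monoʳ-∣ b
          (coprime-divisor co (coprime-divisor co (divides k′ (ℕ.*-cancelˡ-≡ (a ℕ.* (a ℕ.* q)) (k′ ℕ.* b) b {{ℕ.>-nonZero 1≤b}} (trans (eq₁ a b q) (trans (sym e) (eq₂ b k′))))))))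
    where
    eq₁ : ∀ a b q → b ℕ.* (a ℕ.* (a ℕ.* q)) ≡ a ℕ.* a ℕ.* (q ℕ.* b)
    eq₁ = ℕ-Solver.solve-∀
    eq₂ : ∀ b k → b ℕ.* b ℕ.* k ≡ b ℕ.* (k ℕ.* b)
    eq₂ = ℕ-Solver.solve-∀

  -- After division by the gcd of `m` and `m′`, the equation is `a² k = b² k′` with coprime `a` and
  -- `b`. Then `b²` divides `k` and `a²` divides `k′`, so both are 1.
  squarefree-part-unique : ∀ {m m′ k k′} → SquareFree k → SquareFree k′ → 1 ℕ.≤ m → 1 ℕ.≤ m′ → m ℕ.* m ℕ.* k ≡ m′ ℕ.* m′ ℕ.* k′ → k ≡ k′
  squarefree-part-unique {m} {m′} {k} {k′} sf sf′ 1≤m 1≤m′ e = finish (gcd[m,n]∣m m m′) (gcd[m,n]∣n m m′)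
    where
    g = gcd m m′
    finish : g ∣ m → g ∣ m′ → k ≡ k′
    finish (divides a ea) (divides b eb) = conclude (sf b (coprime-square-∣ {a} {b} k k′ (pos ea′ 1≤m′) (Coprime.sym co) (sym e′))) (sf′ a (coprime-square-∣ {b} {a} k′ k (pos ea 1≤m) co e′))
      where
      ea′ = eb
      pos : ∀ {x y z} → x ≡ y ℕ.* z → 1 ℕ.≤ x → 1 ℕ.≤ y
      pos {y = zero} refl ()
      pos {y = suc y} _ _ = s≤s z≤n
      1≤g : 1 ℕ.≤ g
      1≤g = pos {z = a} (trans ea (ℕ.*-comm a g)) 1≤m
      co : Coprime a b
      co {i} (divides s es , divides t et) = ∣1⇒≡1 (*-cancelʳ-∣ g {{ℕ.>-nonZero 1≤g}} (subst (i ℕ.* g ∣_) (sym (ℕ.*-identityˡ g))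
        (gcd-greatest (divides s (trans ea (trans (cong (ℕ._* g) es) (ℕ.*-assoc s i g)))) (divides t (trans eb (trans (cong (ℕ._* g) et) (ℕ.*-assoc t i g)))))))
      e′ : a ℕ.* a ℕ.* k ≡ b ℕ.* b ℕ.* k′
      e′ = ℕ.*-cancelˡ-≡ _ _ (g ℕ.* g) {{ℕ.>-nonZero (ℕ.*-mono-≤ 1≤g 1≤g)}}
        (trans (eq g a k) (trans (trans (cong (λ t → t ℕ.* t ℕ.* k) (sym ea)) (trans e (cong (λ t → t ℕ.* t ℕ.* k′) eb))) (sym (eq g b k′))))
        where
        eq : ∀ g a k → g ℕ.* g ℕ.* (a ℕ.* a ℕ.* k) ≡ a ℕ.* g ℕ.* (a ℕ.* g) ℕ.* k
        eq = ℕ-Solver.solve-∀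
      conclude : b ≡ 1 → a ≡ 1 → k ≡ k′
      conclude refl refl = trans (sym (ℕ.+-identityʳ k)) (trans e′ (ℕ.+-identityʳ k′))

  module _ (c : ℕ → ℤ) (c-spec : ∀ m k → SquareFree k → c (m ℕ.* m ℕ.* k) ≡ (ℤ.+ m) ℤ.* μ k) where

    -- A divisor can contribute only if it is squarefree and its cofactor is a square. By
    -- `squarefree-part-unique` it is then `k₀`, whose term is `μ(k₀)/(k₀ m) = c(n)/n`.
    c-convolution : ∀ n → 1 ℕ.≤ n → ι (c n) * inv n ≡ (μ/ ⋆ invsqrt) n
    c-convolution n 1≤n with square-part n 1≤n
    ... | m , k₀ , refl , sf = sym (trans (∑-single term 1≤k₀ k₀≤n other) main)
      where
      term : ℕ → ℚ
      term k = 𝟙 (k ∣? n) * (μ/ k * invsqrt (n ÷ k))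
      k₀∣n : k₀ ∣ n
      k₀∣n = n∣m*n (m ℕ.* m)
      1≤k₀ : 1 ℕ.≤ k₀
      1≤k₀ = ℕ.n≢0⇒n>0 λ { refl → contradiction (subst (1 ℕ.≤_) (ℕ.*-zeroʳ (m ℕ.* m)) 1≤n) λ () }
      1≤m : 1 ℕ.≤ m
      1≤m = ℕ.n≢0⇒n>0 λ { refl → contradiction 1≤n λ () }
      k₀≤n : k₀ ℕ.≤ n
      k₀≤n = ∣⇒≤′ 1≤n k₀∣n
      invsqrt-square : invsqrt (m ℕ.* m) ≡ inv m
      invsqrt-square = trans (cong₂ _*_ (𝟙-yes (square? (m ℕ.* m)) (cong₂ ℕ._*_ (isqrt-square m) (isqrt-square m))) (cong inv (isqrt-square m))) (ℚ.*-identityˡ (inv m))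
      main : term k₀ ≡ ι (c n) * inv n
      main = trans (cong₂ (λ s t → s * (μ/ k₀ * t)) (𝟙-yes (k₀ ∣? n) k₀∣n) (trans (cong invsqrt (*÷ (m ℕ.* m) 1≤k₀)) invsqrt-square))
        (sym (trans (cong₂ _*_ (trans (cong ι (c-spec m k₀ sf)) (ι-* (ℤ.+ m) (μ k₀))) (trans (inv-* (ℕ.*-mono-≤ 1≤m 1≤m) 1≤k₀) (cong (_* inv k₀) (inv-* 1≤m 1≤m))))
          (trans (alg₁ ⟦ m ⟧ (inv m) (μℚ k₀) (inv k₀)) (trans (cong (_* (μℚ k₀ * inv k₀ * inv m)) (inv-inverse 1≤m)) refl))))
        where
        alg₁ : ∀ m i u k → m * u * (i * i * k) ≡ i * m * (u * k * i)
        alg₁ = Solver.solve-∀ ring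
      other : ∀ j → 1 ℕ.≤ j → j ℕ.≤ n → j ≢ k₀ → term j ≡ 0ℚ
      other j 1≤j j≤n j≢k₀ with j ∣? n
      ... | no _ = ℚ.*-zeroˡ (μ/ j * invsqrt (n ÷ j))
      ... | yes d with square? (n ÷ j)
      ... | no _ = zeros (μ/ j) (inv (isqrt (n ÷ j)))
        where
        zeros : ∀ a b → 1ℚ * (a * (0ℚ * b)) ≡ 0ℚ
        zeros = Solver.solve-∀ ring
      ... | yes s with squarefree⊎square 1≤j
      ... | inj₁ sf′ = contradiction (squarefree-part-unique sf′ sf 1≤r 1≤m (sym e)) j≢k₀
        where
        r = isqrt (n ÷ j)
        e : n ≡ r ℕ.* r ℕ.* j
        e = trans (cofactor 1≤j d) (cong (ℕ._* j) (sym s))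
        1≤r : 1 ℕ.≤ r
        1≤r = 1≤isqrt (*≤⇒≤÷ 1≤j (subst (ℕ._≤ n) (sym (ℕ.*-identityˡ j)) j≤n))
      ... | inj₂ (t , 2≤t , tt∣j) = trans (cong (λ v → 1ℚ * (v * inv j * (1ℚ * inv (isqrt (n ÷ j))))) (trans (cong ι (μ-square-divisor 1≤j 2≤t tt∣j)) ι0)) (zeros (inv j) (inv (isqrt (n ÷ j))))
        where
        zeros : ∀ a b → 1ℚ * (0ℚ * a * (1ℚ * b)) ≡ 0ℚ
        zeros = Solver.solve-∀ ring

    partialSum≡ : ∀ x → partialSum c x ≡ ∑ [1… x ] (λ k → μ/ k * H (isqrt (x ÷ k)))
    partialSum≡ x = trans (go x) (trans (∑-cong [1… x ] (λ n n∈ → c-convolution n (proj₁ (∈[1…]⁻ x n∈)))) (trans (sym (∑-⋆ μ/ invsqrt x))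
        (∑-cong [1… x ] (λ k _ → cong (μ/ k *_) (∑-invsqrt (x ÷ k))))))
      where
      go : ∀ x → partialSum c x ≡ ∑ [1… x ] (λ n → ι (c n) * inv n)
      go zero = refl
      go (suc x) = trans (cong₂ _+_ (go x) (/-as-inv (c (suc x)) x)) (ℚ.+-comm (∑ [1… x ] (λ n → ι (c n) * inv n)) _)

-- Harmonic numbers at n and at its square root

module HarmonicNumbers where
  open Rationals
  open Sums
  open Convolutions

  0≤3 : 0ℚ ≤ 3ℚ
  0≤3 = 0≤+ 0≤1 0≤2

  0≤4 : 0ℚ ≤ 4ℚ
  0≤4 = 0≤+ 0≤2 0≤2

  *-mono-≤ : ∀ {a b c d} → 0ℚ ≤ a → 0ℚ ≤ c → a ≤ b → c ≤ d → a * c ≤ b * d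
  *-mono-≤ {a} {b} {c} {d} 0≤a 0≤c h k = by-diff (0≤+ (0≤* (diff h) (0≤+ 0≤c (diff k))) (0≤* 0≤a (diff k))) (eq a b c d)
    where
    eq : ∀ a b c d → b * d - a * c ≡ (b - a) * (c + (d - c)) + a * (d - c)
    eq = Solver.solve-∀ ring

  ∣∣-triangle : ∀ {x y a b} → ∣ x ∣ ≤ a → ∣ y ∣ ≤ b → ∣ x + y ∣ ≤ a + b
  ∣∣-triangle {x} {y} h k = ℚ.≤-trans (ℚ.∣p+q∣≤∣p∣+∣q∣ x y) (ℚ.+-mono-≤ h k)

  inv-suc : ∀ {n} → 1 ℕ.≤ n → inv n - inv (suc n) ≡ inv n * inv (suc n)
  inv-suc {n} 1≤n = alg (inv n) (inv (suc n)) ⟦ n ⟧ (inv-inverse 1≤n) (trans (cong (inv (suc n) *_) (sym (⟦⟧-suc n))) (inv-inverse (s≤s z≤n)))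
    where
    alg : ∀ i j N → i * N ≡ 1ℚ → j * (1ℚ + N) ≡ 1ℚ → i - j ≡ i * j
    alg i j N e₁ e₂ = trans (cong₂ _-_ (trans (sym (ℚ.*-identityʳ i)) (cong (i *_) (sym e₂))) (trans (sym (ℚ.*-identityʳ j)) (cong (j *_) (sym e₁)))) (ring₁ i j N)
      where
      ring₁ : ∀ i j N → i * (j * (1ℚ + N)) - j * (i * N) ≡ i * j
      ring₁ = Solver.solve-∀ ring

  inv≤1 : ∀ {n} → 1 ℕ.≤ n → inv n ≤ 1ℚ
  inv≤1 {n} h = subst (inv n ≤_) inv-1 (inv-antitone ℕ.≤-refl h)

  -- Feeds an equation to the ring solver: its identity may contain a multiple of `a - b`, which is
  -- removed here.
  +-vanish : ∀ {x a b} c → a ≡ b → x + c * (a - b) ≡ x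
  +-vanish {x} {a} c refl = eq x a c
    where
    eq : ∀ x a c → x + c * (a - a) ≡ x
    eq = Solver.solve-∀ ring

  -- Telescoping, by `1/(n+1)² ≤ 1/n − 1/(n+1)`.
  ∑-inv²-tail : ∀ J t → 1 ℕ.≤ J → ∑ [1… t ] (λ m → inv (J ℕ.+ m) * inv (J ℕ.+ m)) ≤ inv J - inv (J ℕ.+ t)
  ∑-inv²-tail J zero 1≤J = ℚ.≤-reflexive (sym (trans (cong (λ t → inv J - inv t) (ℕ.+-identityʳ J)) (ℚ.+-inverseʳ (inv J))))
  ∑-inv²-tail J (suc t) 1≤J = subst (λ s → inv s * inv s + ∑ [1… t ] (λ m → inv (J ℕ.+ m) * inv (J ℕ.+ m)) ≤ inv J - inv s) (sym (ℕ.+-suc J t))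
    (by-diff (0≤+ (diff (∑-inv²-tail J t 1≤J)) (0≤* (0≤inv (suc n)) (diff (inv-antitone 1≤n (ℕ.n≤1+n n)))))
      (trans (eq (inv J) (inv n) (inv (suc n)) (∑ [1… t ] (λ m → inv (J ℕ.+ m) * inv (J ℕ.+ m)))) (+-vanish 1ℚ (inv-suc 1≤n))))
    where
    n = J ℕ.+ t
    1≤n : 1 ℕ.≤ n
    1≤n = ℕ.≤-trans 1≤J (ℕ.m≤m+n J t)
    eq : ∀ u i j s → u - j - (j * j + s) ≡ (u - i - s) + j * (i - j) + 1ℚ * ((i - j) - i * j)
    eq = Solver.solve-∀ ring

  H-gap : ℕ → ℕ → ℚ
  H-gap m t = ∑ [1… t ] (λ k → inv (m ℕ.+ k))

  H-+ : ∀ m t → H (m ℕ.+ t) ≡ H m + H-gap m t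
  H-+ m t = ∑-split m t inv

  H-gap-upper : ∀ m t → 1 ℕ.≤ m → H-gap m t ≤ ⟦ t ⟧ * inv m
  H-gap-upper m t 1≤m = subst (H-gap m t ≤_) (trans (∑-const [1… t ] (inv m)) (cong (λ s → ⟦ s ⟧ * inv m) (length-[1…] t)))
    (∑-mono [1… t ] (λ k _ → inv-antitone 1≤m (ℕ.m≤m+n m k)))

  H-gap-lower : ∀ m t → 1 ℕ.≤ m → ⟦ t ⟧ * inv (m ℕ.+ t) ≤ H-gap m t
  H-gap-lower m t 1≤m = subst (_≤ H-gap m t) (trans (∑-const [1… t ] (inv (m ℕ.+ t))) (cong (λ s → ⟦ s ⟧ * inv (m ℕ.+ t)) (length-[1…] t)))
    (∑-mono [1… t ] (λ k k∈ → inv-antitone (ℕ.≤-trans 1≤m (ℕ.m≤m+n m k)) (ℕ.+-monoʳ-≤ m (proj₂ (∈[1…]⁻ t k∈)))))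

  0≤H : ∀ n → 0ℚ ≤ H n
  0≤H n = ∑-nonneg [1… n ] (λ k _ → 0≤inv k)

  H-mono : ∀ {m n} → m ℕ.≤ n → H m ≤ H n
  H-mono h = ∑-range-mono inv h (λ k _ _ → 0≤inv k)

  H≤ : ∀ n → H n ≤ ⟦ n ⟧
  H≤ n = subst (H n ≤_) (trans (∑-const [1… n ] 1ℚ) (trans (ℚ.*-identityʳ _) (cong ⟦_⟧ (length-[1…] n))))
    (∑-mono [1… n ] (λ k k∈ → inv≤1 (proj₁ (∈[1…]⁻ n k∈))))

  -- The value of `δH` at the square `n * n`. The logarithms in the two harmonic numbers cancel, and
  -- the sequence tends to half of Euler's constant.
  Γ : ℕ → ℚ
  Γ n = H n - ½ * H (n ℕ.* n)

  -- The difference is `1/(n+1)` minus half the sum of the `2n + 1` reciprocals between `n²` and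
  -- `(n+1)²`. That sum lies between `2j − j²` and `2i + i²` for `i = 1/n` and `j = 1/(n+1)`, so the
  -- difference is O(1/n²), written in the telescoping form `2 (i − j)`.
  Γ-step : ∀ n → 1 ℕ.≤ n → ∣ Γ (suc n) - Γ n ∣ ≤ 2ℚ * (inv n - inv (suc n))
  Γ-step n 1≤n = abs≤
      (subst (_≤ 2ℚ * (i - j)) (sym diff≡) (subst (λ r → j - ½ * s ≤ 2ℚ * r) (sym i-j)
        (by-diff (0≤+ (0≤* 0≤½ (diff s-lower)) (0≤+ (0≤* (0≤* 0≤½ (0≤inv (suc n))) (diff j≤i)) (0≤* (0≤+ 0≤1 0≤½) (0≤* (0≤inv n) (0≤inv (suc n)))))) (eq₁ i j s))))
      (subst (_≤ 2ℚ * (i - j)) (cong -_ (sym diff≡)) (subst (λ r → - (j - ½ * s) ≤ 2ℚ * r) (sym i-j)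
        (by-diff (0≤+ (0≤* 0≤½ (diff s-upper)) (0≤* (0≤* 0≤½ (0≤* (0≤inv n) (0≤inv (suc n)))) (diff (inv≤1 1≤n))))
          (trans (eq₂ i j s) (+-vanish (1ℚ + ½ * i) (sym i-j))))))
    where
    i = inv n
    j = inv (suc n)
    t = suc (n ℕ.+ n)
    s = H-gap (n ℕ.* n) t
    1≤n² : 1 ℕ.≤ n ℕ.* n
    1≤n² = ℕ.*-mono-≤ 1≤n 1≤n
    i-j : i - j ≡ i * j
    i-j = inv-suc 1≤n
    j≤i : j ≤ i
    j≤i = inv-antitone 1≤n (ℕ.n≤1+n n)
    next-square : n ℕ.* n ℕ.+ t ≡ suc n ℕ.* suc n
    next-square = eq n
      where
      eq : ∀ n → n ℕ.* n ℕ.+ suc (n ℕ.+ n) ≡ suc n ℕ.* suc n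
      eq = ℕ-Solver.solve-∀
    diff≡ : Γ (suc n) - Γ n ≡ j - ½ * s
    diff≡ = trans (cong (λ r → j + H n - ½ * r - Γ n) (trans (cong H (sym next-square)) (H-+ (n ℕ.* n) t))) (alg j (H n) (H (n ℕ.* n)) s)
      where
      alg : ∀ j h q s → j + h - ½ * (q + s) - (h - ½ * q) ≡ j - ½ * s
      alg = Solver.solve-∀ ring
    N = ⟦ n ⟧
    t≡ : ⟦ t ⟧ ≡ 1ℚ + (N + N)
    t≡ = trans (⟦⟧-suc (n ℕ.+ n)) (cong (1ℚ +_) (⟦⟧-+ n n))
    j-inverse : j * (1ℚ + N) ≡ 1ℚ
    j-inverse = trans (cong (j *_) (sym (⟦⟧-suc n))) (inv-inverse (s≤s z≤n))
    s-lower : 2ℚ * j - j * j ≤ s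
    s-lower = subst (_≤ s) (trans (cong₂ _*_ t≡ (trans (cong inv next-square) (inv-* (s≤s z≤n) (s≤s z≤n)))) (trans (eq N j) (cong (λ r → 2ℚ * r * j - j * j) j-inverse)))
        (H-gap-lower (n ℕ.* n) t 1≤n²)
      where
      eq : ∀ N j → (1ℚ + (N + N)) * (j * j) ≡ 2ℚ * (j * (1ℚ + N)) * j - j * j
      eq = Solver.solve-∀ ring
    s-upper : s ≤ 2ℚ * i + i * i
    s-upper = subst (s ≤_) (trans (cong₂ _*_ t≡ (inv-* 1≤n 1≤n)) (trans (eq N i) (cong (λ r → 2ℚ * r * i + i * i) (inv-inverse 1≤n))))
        (H-gap-upper (n ℕ.* n) t 1≤n²)
      where
      eq : ∀ N i → (1ℚ + (N + N)) * (i * i) ≡ 2ℚ * (i * N) * i + i * i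
      eq = Solver.solve-∀ ring
    eq₁ : ∀ i j s → 2ℚ * (i * j) - (j - ½ * s) ≡ ½ * (s - (2ℚ * j - j * j)) + (½ * j * (i - j) + (1ℚ + ½) * (i * j))
    eq₁ = Solver.solve-∀ ring
    eq₂ : ∀ i j s → 2ℚ * (i * j) - (- (j - ½ * s)) ≡ ½ * (2ℚ * i + i * i - s) + ½ * (i * j) * (1ℚ - i) + (1ℚ + ½ * i) * (i * j - (i - j))
    eq₂ = Solver.solve-∀ ring

  Γ-close : ∀ m d → 1 ℕ.≤ m → ∣ Γ (m ℕ.+ d) - Γ m ∣ ≤ 2ℚ * (inv m - inv (m ℕ.+ d))
  Γ-close m zero 1≤m = ℚ.≤-reflexive (subst (λ n → ∣ Γ n - Γ m ∣ ≡ 2ℚ * (inv m - inv n)) (sym (ℕ.+-identityʳ m))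
    (trans (cong ∣_∣ (ℚ.+-inverseʳ (Γ m))) (sym (trans (cong (2ℚ *_) (ℚ.+-inverseʳ (inv m))) (ℚ.*-zeroʳ 2ℚ)))))
  Γ-close m (suc d) 1≤m = subst (λ n → ∣ Γ n - Γ m ∣ ≤ 2ℚ * (inv m - inv n)) (sym (ℕ.+-suc m d))
    (≤-resp (cong ∣_∣ (tele (Γ (suc n)) (Γ n) (Γ m))) (tele′ (inv m) (inv n) (inv (suc n)))
      (∣∣-triangle {Γ (suc n) - Γ n} {Γ n - Γ m} (Γ-step n (ℕ.≤-trans 1≤m (ℕ.m≤m+n m d))) (Γ-close m d 1≤m)))
    where
    n = m ℕ.+ d
    tele : ∀ a b c → a - b + (b - c) ≡ a - c
    tele = Solver.solve-∀ ring
    tele′ : ∀ a b c → 2ℚ * (b - c) + 2ℚ * (a - b) ≡ 2ℚ * (a - c)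
    tele′ = Solver.solve-∀ ring

  Γ-cauchy : ∀ {m n} → 1 ℕ.≤ m → m ℕ.≤ n → ∣ Γ n - Γ m ∣ ≤ 2ℚ * inv m
  Γ-cauchy {m} {n} 1≤m m≤n = ℚ.≤-trans (subst (λ k → ∣ Γ k - Γ m ∣ ≤ 2ℚ * (inv m - inv k)) (ℕ.m+[n∸m]≡n m≤n) (Γ-close m (n ℕ.∸ m) 1≤m))
    (by-diff (0≤* 0≤2 (0≤inv n)) (eq (inv m) (inv n)))
    where
    eq : ∀ a b → 2ℚ * a - 2ℚ * (a - b) ≡ 2ℚ * b
    eq = Solver.solve-∀ ring

  ∣Γ∣≤3 : ∀ n → 1 ℕ.≤ n → ∣ Γ n ∣ ≤ 3ℚ
  ∣Γ∣≤3 n 1≤n = ≤-resp (cong ∣_∣ (tele (Γ n) (Γ 1))) refl (ℚ.≤-trans (∣∣-triangle {Γ n - Γ 1} {Γ 1} (Γ-cauchy ℕ.≤-refl 1≤n) first)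
      (subst (λ t → 2ℚ * t + 1ℚ ≤ 3ℚ) (sym inv-1) (ℚ.≤-reflexive refl)))
    where
    tele : ∀ a b → a - b + b ≡ a
    tele = Solver.solve-∀ ring
    first : ∣ Γ 1 ∣ ≤ 1ℚ
    first = subst (_≤ 1ℚ) (sym (trans (cong (λ t → ∣ t + 0ℚ - ½ * (t + 0ℚ) ∣) inv-1) refl)) (by-diff 0≤½ refl)

  δH : ℕ → ℚ
  δH v = H (isqrt v) - ½ * H v

  -- With `r = isqrt v`, at most `2 r` integers lie in `(r², v]`. Half the sum of their reciprocals,
  -- each at most `1/r²`, is at most `1/r`.
  δH≈Γ : ∀ v → 1 ℕ.≤ v → ∣ δH v - Γ (isqrt v) ∣ ≤ inv (isqrt v)
  δH≈Γ v 1≤v = subst (_≤ inv r) (sym (trans (cong ∣_∣ h-Γ) (trans (ℚ.∣-p∣≡∣p∣ (½ * H-gap (r ℕ.* r) t)) (ℚ.0≤p⇒∣p∣≡p (0≤* 0≤½ 0≤gap)))))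
      (by-diff (0≤+ (0≤* 0≤½ (diff (H-gap-upper (r ℕ.* r) t (ℕ.*-mono-≤ 1≤r 1≤r)))) (0≤* (0≤* 0≤½ (0≤inv (r ℕ.* r))) (diff t≤)))
        (trans (eq (inv r) (inv (r ℕ.* r)) ⟦ t ⟧ ⟦ r ⟧ (H-gap (r ℕ.* r) t)) (+-vanish 1ℚ inv-r)))
    where
    r = isqrt v
    t = v ℕ.∸ r ℕ.* r
    1≤r : 1 ℕ.≤ r
    1≤r = 1≤isqrt 1≤v
    v≡ : r ℕ.* r ℕ.+ t ≡ v
    v≡ = ℕ.m+[n∸m]≡n (isqrt-lower v)
    0≤gap : 0ℚ ≤ H-gap (r ℕ.* r) t
    0≤gap = ∑-nonneg [1… t ] (λ k _ → 0≤inv (r ℕ.* r ℕ.+ k))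
    h-Γ : δH v - Γ r ≡ - (½ * H-gap (r ℕ.* r) t)
    h-Γ = trans (cong (λ s → H r - ½ * s - Γ r) (trans (cong H (sym v≡)) (H-+ (r ℕ.* r) t))) (alg (H r) (H (r ℕ.* r)) (H-gap (r ℕ.* r) t))
      where
      alg : ∀ a b g → a - ½ * (b + g) - (a - ½ * b) ≡ - (½ * g)
      alg = Solver.solve-∀ ring
    t≤ : ⟦ t ⟧ ≤ 2ℚ * ⟦ r ⟧
    t≤ = subst (⟦ t ⟧ ≤_) (trans (⟦⟧-+ r r) (dbl ⟦ r ⟧)) (⟦⟧-mono (ℕ.≤-pred (ℕ.+-cancelˡ-< (r ℕ.* r) t (suc (r ℕ.+ r))
        (subst₂ ℕ._<_ (sym v≡) (sq r) (isqrt-upper v)))))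
      where
      dbl : ∀ x → x + x ≡ 2ℚ * x
      dbl = Solver.solve-∀ ring
      sq : ∀ r → suc r ℕ.* suc r ≡ r ℕ.* r ℕ.+ suc (r ℕ.+ r)
      sq = ℕ-Solver.solve-∀
    inv-r : inv r ≡ inv (r ℕ.* r) * ⟦ r ⟧
    inv-r = sym (trans (cong (_* ⟦ r ⟧) (inv-* 1≤r 1≤r)) (trans (ℚ.*-assoc (inv r) (inv r) ⟦ r ⟧) (trans (cong (inv r *_) (inv-inverse 1≤r)) (ℚ.*-identityʳ (inv r)))))
    eq : ∀ i q t r g → i - ½ * g ≡ ½ * (t * q - g) + ½ * q * (2ℚ * r - t) + 1ℚ * (i - q * r)
    eq = Solver.solve-∀ ring

  δH≈γ : ∀ {v x} → 1 ℕ.≤ v → v ℕ.≤ x → ∣ δH v - Γ (isqrt x) ∣ ≤ 3ℚ * inv (isqrt v)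
  δH≈γ {v} {x} 1≤v v≤x = ≤-resp (cong ∣_∣ (tele (δH v) (Γ (isqrt v)) (Γ (isqrt x)))) (sum (inv (isqrt v)))
      (∣∣-triangle {δH v - Γ (isqrt v)} { - (Γ (isqrt x) - Γ (isqrt v))} (δH≈Γ v 1≤v)
        (subst (_≤ 2ℚ * inv (isqrt v)) (sym (ℚ.∣-p∣≡∣p∣ (Γ (isqrt x) - Γ (isqrt v)))) (Γ-cauchy (1≤isqrt 1≤v) (isqrt-mono v≤x))))
    where
    tele : ∀ a b c → a - b + (- (c - b)) ≡ a - c
    tele = Solver.solve-∀ ring
    sum : ∀ i → i + 2ℚ * i ≡ 3ℚ * i
    sum = Solver.solve-∀ ring

-- Axer's splitting and the final error bound

module Summation where
  open Rationals
  open Sums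
  open Division
  open Moebius
  open PrimeCounts using (1≤2^)
  open MeanValues
  open Convolutions
  open HarmonicNumbers

  module _ (g φ : ℕ → ℚ) (y : ℕ) (φ-anti : ∀ k → 1 ℕ.≤ k → φ (suc k) ≤ φ k) (0≤φ : ∀ k → 0ℚ ≤ φ k) (E : ℚ) where

    private
      M : ℕ → ℚ
      M X = ∑ [1… X ] g

      T : ℕ → ℚ
      T l = ∑ [1… l ] (λ k → g (y ℕ.+ k) * φ (y ℕ.+ k))

      -- Abel summation as an induction that keeps the boundary term `M φ` apart. Each new index
      -- adds `M n * (φ n − φ (suc n))`; since `φ` decreases, the bounds of these terms telescope.
      -- One `φ (suc y)` on the right comes from `M y`, the other from the telescoping.
      remainder : ∀ l → (∀ k → y ℕ.≤ k → k ℕ.≤ y ℕ.+ suc l → ∣ M k ∣ ≤ E) →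
        ∣ T (suc l) - M (suc (y ℕ.+ l)) * φ (suc (y ℕ.+ l)) ∣ ≤ E * (2ℚ * φ (suc y) - φ (suc (y ℕ.+ l)))
      remainder zero bound = subst (λ t → ∣ g t * φ t + 0ℚ - M (suc (y ℕ.+ 0)) * φ (suc (y ℕ.+ 0)) ∣ ≤ E * (2ℚ * φ (suc y) - φ (suc (y ℕ.+ 0)))) (sym (ℕ.+-suc y 0))
          (subst (λ n → ∣ g (suc n) * φ (suc n) + 0ℚ - M (suc n) * φ (suc n) ∣ ≤ E * (2ℚ * φ (suc y) - φ (suc n))) (sym (ℕ.+-identityʳ y)) base)
        where
        alg : ∀ a f m → a * f + 0ℚ - (a + m) * f ≡ (- m) * f
        alg = Solver.solve-∀ ring
        alg′ : ∀ e f → e * f ≡ e * (2ℚ * f - f)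
        alg′ = Solver.solve-∀ ring
        base : ∣ g (suc y) * φ (suc y) + 0ℚ - M (suc y) * φ (suc y) ∣ ≤ E * (2ℚ * φ (suc y) - φ (suc y))
        base = ≤-resp (cong ∣_∣ (sym (alg (g (suc y)) (φ (suc y)) (M y)))) (alg′ E (φ (suc y)))
          (∣∣-*-≤ { - M y} {φ (suc y)} (subst (_≤ E) (sym (ℚ.∣-p∣≡∣p∣ (M y))) (bound y ℕ.≤-refl (ℕ.m≤m+n y 1))) (ℚ.≤-reflexive (ℚ.0≤p⇒∣p∣≡p (0≤φ (suc y)))))
      remainder (suc l) bound = subst (λ t → ∣ g t * φ t + T (suc l) - M (suc (y ℕ.+ suc l)) * φ (suc (y ℕ.+ suc l)) ∣ ≤ E * (2ℚ * φ (suc y) - φ (suc (y ℕ.+ suc l)))) (sym (ℕ.+-suc y (suc l)))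
          (subst (λ n → ∣ g (suc n) * φ (suc n) + T (suc l) - M (suc n) * φ (suc n) ∣ ≤ E * (2ℚ * φ (suc y) - φ (suc n))) (sym (ℕ.+-suc y l)) step)
        where
        n = suc (y ℕ.+ l)
        alg : ∀ t m f a f′ → t - m * f + m * (f - f′) ≡ a * f′ + t - (a + m) * f′
        alg = Solver.solve-∀ ring
        alg′ : ∀ e u f f′ → e * (u - f) + e * (f - f′) ≡ e * (u - f′)
        alg′ = Solver.solve-∀ ring
        n≤ : n ℕ.≤ y ℕ.+ suc (suc l)
        n≤ = ℕ.≤-trans (ℕ.≤-reflexive (sym (ℕ.+-suc y l))) (ℕ.+-monoʳ-≤ y (ℕ.n≤1+n (suc l)))
        step : ∣ g (suc n) * φ (suc n) + T (suc l) - M (suc n) * φ (suc n) ∣ ≤ E * (2ℚ * φ (suc y) - φ (suc n))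
        step = ≤-resp (cong ∣_∣ (alg (T (suc l)) (M n) (φ n) (g (suc n)) (φ (suc n)))) (alg′ E (2ℚ * φ (suc y)) (φ n) (φ (suc n)))
          (∣∣-triangle {T (suc l) - M n * φ n} {M n * (φ n - φ (suc n))} (remainder l (λ k y≤k k≤ → bound k y≤k (ℕ.≤-trans k≤ (ℕ.+-monoʳ-≤ y (ℕ.n≤1+n (suc l))))))
            (∣∣-*-≤ {M n} {φ n - φ (suc n)} (bound n (ℕ.≤-trans (ℕ.m≤m+n y l) (ℕ.n≤1+n _)) n≤) (ℚ.≤-reflexive (ℚ.0≤p⇒∣p∣≡p (diff (φ-anti n (s≤s z≤n)))))))

    abel : ∀ l → (∀ k → y ℕ.≤ k → k ℕ.≤ y ℕ.+ l → ∣ M k ∣ ≤ E) → ∣ T l ∣ ≤ E * (2ℚ * φ (suc y))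
    abel zero bound = 0≤* (ℚ.≤-trans (ℚ.0≤∣p∣ (M y)) (bound y ℕ.≤-refl (ℕ.m≤m+n y 0))) (0≤* 0≤2 (0≤φ (suc y)))
    abel (suc l) bound = ≤-resp (cong ∣_∣ (alg (T (suc l)) (M n * φ n))) (alg′ E (2ℚ * φ (suc y)) (φ n))
        (∣∣-triangle {T (suc l) - M n * φ n} {M n * φ n} (remainder l bound)
          (∣∣-*-≤ {M n} {φ n} (bound n (ℕ.≤-trans (ℕ.m≤m+n y l) (ℕ.n≤1+n _)) (ℕ.≤-reflexive (sym (ℕ.+-suc y l)))) (ℚ.≤-reflexive (ℚ.0≤p⇒∣p∣≡p (0≤φ n)))))
      where
      n = suc (y ℕ.+ l)
      alg : ∀ t m → t - m + m ≡ t
      alg = Solver.solve-∀ ring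
      alg′ : ∀ e u f → e * (u - f) + e * f ≡ e * u
      alg′ = Solver.solve-∀ ring

  ∑-indicator-≤ : ∀ y w → ∑ [1… y ] (λ k → 𝟙 (k ℕ.≤? w)) ≤ ⟦ w ⟧
  ∑-indicator-≤ y w with ℕ.≤-total y w
  ... | inj₁ y≤w = ℚ.≤-trans (∑-≤-length y) (⟦⟧-mono y≤w)
    where
    ∑-≤-length : ∀ y → ∑ [1… y ] (λ k → 𝟙 (k ℕ.≤? w)) ≤ ⟦ y ⟧
    ∑-≤-length y = subst (∑ [1… y ] (λ k → 𝟙 (k ℕ.≤? w)) ≤_) (trans (∑-const [1… y ] 1ℚ) (trans (ℚ.*-identityʳ _) (cong ⟦_⟧ (length-[1…] y)))) (∑-mono [1… y ] (λ k _ → 𝟙≤1 (k ℕ.≤? w)))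
  ... | inj₂ w≤y = subst (_≤ ⟦ w ⟧) (sym (∑-extend (λ k → 𝟙 (k ℕ.≤? w)) w≤y (λ k w<k _ → 𝟙-no (k ℕ.≤? w) (ℕ.<⇒≱ w<k))))
      (subst (∑ [1… w ] (λ k → 𝟙 (k ℕ.≤? w)) ≤_) (trans (∑-const [1… w ] 1ℚ) (trans (ℚ.*-identityʳ _) (cong ⟦_⟧ (length-[1…] w)))) (∑-mono [1… w ] (λ k _ → 𝟙≤1 (k ℕ.≤? w))))

  -- Counting the pairs (k, n) with n² k ≤ x and k ≤ y, separately for n ≤ J and n > J.
  ∑-isqrt : ∀ x y J → 1 ℕ.≤ J → ∑ [1… y ] (λ k → ⟦ isqrt (x ÷ k) ⟧) ≤ ⟦ y ⟧ * ⟦ J ⟧ + ⟦ x ⟧ * inv J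
  ∑-isqrt x y J 1≤J = ℚ.≤-trans (∑-mono [1… y ] {λ k → ⟦ isqrt (x ÷ k) ⟧} {λ k → ⟦ J ⟧ + ∑ [1… x ] (λ m → χ k m)} (λ k k∈ → pointwise k (proj₁ (∈[1…]⁻ y k∈))))
      (subst (_≤ ⟦ y ⟧ * ⟦ J ⟧ + ⟦ x ⟧ * inv J) (sym total) (ℚ.+-monoʳ-≤ (⟦ y ⟧ * ⟦ J ⟧)
        (ℚ.≤-trans (∑-mono [1… x ] {λ m → ∑ [1… y ] (λ k → χ k m)} {λ m → ⟦ x ⟧ * (inv (J ℕ.+ m) * inv (J ℕ.+ m))} column)
          (subst (_≤ ⟦ x ⟧ * inv J) (sym (∑-* [1… x ] ⟦ x ⟧ (λ m → inv (J ℕ.+ m) * inv (J ℕ.+ m))))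
            (by-diff (0≤* (0≤⟦⟧ x) (0≤+ (diff (∑-inv²-tail J x 1≤J)) (0≤inv (J ℕ.+ x)))) (alg ⟦ x ⟧ (inv J) (inv (J ℕ.+ x)) (∑ [1… x ] (λ m → inv (J ℕ.+ m) * inv (J ℕ.+ m)))))))))
    where
    w : ℕ → ℕ
    w m = x ÷ ((J ℕ.+ m) ℕ.* (J ℕ.+ m))
    χ : ℕ → ℕ → ℚ
    χ k m = 𝟙 (k ℕ.≤? w m)
    alg : ∀ x i j s → x * i - x * s ≡ x * (i - j - s + j)
    alg = Solver.solve-∀ ring
    1≤J+ : ∀ m → 1 ℕ.≤ J ℕ.+ m
    1≤J+ m = ℕ.≤-trans 1≤J (ℕ.m≤m+n J m)
    total : ∑ [1… y ] (λ k → ⟦ J ⟧ + ∑ [1… x ] (λ m → χ k m)) ≡ ⟦ y ⟧ * ⟦ J ⟧ + ∑ [1… x ] (λ m → ∑ [1… y ] (λ k → χ k m))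
    total = trans (∑-+ [1… y ] (λ _ → ⟦ J ⟧) (λ k → ∑ [1… x ] (χ k))) (cong₂ _+_ (trans (∑-const [1… y ] ⟦ J ⟧) (cong (λ t → ⟦ t ⟧ * ⟦ J ⟧) (length-[1…] y))) (∑-swap [1… y ] [1… x ] χ))
    column : ∀ m → m ∈ [1… x ] → ∑ [1… y ] (λ k → χ k m) ≤ ⟦ x ⟧ * (inv (J ℕ.+ m) * inv (J ℕ.+ m))
    column m _ = ℚ.≤-trans (∑-indicator-≤ y (w m)) (subst (⟦ w m ⟧ ≤_) (trans (cong (_* ⟦ x ⟧) (inv-* (1≤J+ m) (1≤J+ m))) (ℚ.*-comm _ ⟦ x ⟧)) (÷≤ℚ x (ℕ.*-mono-≤ (1≤J+ m) (1≤J+ m))))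
    0≤χ : ∀ k m → 0ℚ ≤ χ k m
    0≤χ k m = 0≤𝟙 (k ℕ.≤? w m)
    pointwise : ∀ k → 1 ℕ.≤ k → ⟦ isqrt (x ÷ k) ⟧ ≤ ⟦ J ⟧ + ∑ [1… x ] (χ k)
    pointwise k 1≤k with ℕ.≤-total (isqrt (x ÷ k)) J
    ... | inj₁ small = by-diff (0≤+ (diff (⟦⟧-mono small)) (∑-nonneg [1… x ] {χ k} (λ m _ → 0≤χ k m))) (eq ⟦ J ⟧ ⟦ isqrt (x ÷ k) ⟧ (∑ [1… x ] (χ k)))
      where
      eq : ∀ j n s → j + s - n ≡ j - n + s
      eq = Solver.solve-∀ ring
    ... | inj₂ large = subst (_≤ ⟦ J ⟧ + ∑ [1… x ] (χ k)) (trans (sym (⟦⟧-+ J t)) (cong ⟦_⟧ N≡)) (ℚ.+-monoʳ-≤ ⟦ J ⟧ (ℚ.≤-trans ones (∑-range-mono (χ k) t≤x (λ m _ _ → 0≤χ k m))))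
      where
      N = isqrt (x ÷ k)
      t = N ℕ.∸ J
      N≡ : J ℕ.+ t ≡ N
      N≡ = ℕ.m+[n∸m]≡n large
      N≤N² : ∀ n → n ℕ.≤ n ℕ.* n
      N≤N² zero = z≤n
      N≤N² n@(suc _) = ℕ.m≤m*n n n
      t≤x : t ℕ.≤ x
      t≤x = ℕ.≤-trans (ℕ.m∸n≤m N J) (ℕ.≤-trans (ℕ.≤-trans (N≤N² N) (isqrt-lower (x ÷ k))) (÷≤ x k))
      ones : ⟦ t ⟧ ≤ ∑ [1… t ] (χ k)
      ones = subst (_≤ ∑ [1… t ] (χ k)) (trans (∑-const [1… t ] 1ℚ) (trans (ℚ.*-identityʳ _) (cong ⟦_⟧ (length-[1…] t))))
        (∑-mono [1… t ] {λ _ → 1ℚ} {χ k} (λ m m∈ → ℚ.≤-reflexive (sym (𝟙-yes (k ℕ.≤? w m) (in-range m (proj₂ (∈[1…]⁻ t m∈)))))))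
        where
        in-range : ∀ m → m ℕ.≤ t → k ℕ.≤ w m
        in-range m m≤t = *≤⇒≤÷ (ℕ.*-mono-≤ (1≤J+ m) (1≤J+ m)) (subst (ℕ._≤ x) (ℕ.*-comm ((J ℕ.+ m) ℕ.* (J ℕ.+ m)) k)
          (≤÷⇒*≤ k (ℕ.≤-trans (ℕ.*-mono-≤ J+m≤N J+m≤N) (isqrt-lower (x ÷ k)))))
          where
          J+m≤N : J ℕ.+ m ℕ.≤ N
          J+m≤N = subst (J ℕ.+ m ℕ.≤_) N≡ (ℕ.+-monoʳ-≤ J m≤t)

  -- 27 = 12 + 12 + 3 in `small-k`, 36 = 8 (1 + 1/2 + 3) in `large-k`, and 66 = 27 + 36 + 3, the
  -- last 3 bounding the correction `γ / x`.
  27ℚ 36ℚ 66ℚ : ℚ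
  27ℚ = ℤ.+ 27 ℚ./ 1
  36ℚ = ℤ.+ 36 ℚ./ 1
  66ℚ = ℤ.+ 66 ℚ./ 1

  ÷-antitone : ∀ x {k} → 1 ℕ.≤ k → x ÷ suc k ℕ.≤ x ÷ k
  ÷-antitone x {k} 1≤k = *≤⇒≤÷ 1≤k (ℕ.≤-trans (ℕ.*-monoʳ-≤ (x ÷ suc k) (ℕ.n≤1+n k)) (÷-*≤ x (suc k)))

  module _ {x : ℕ} (1≤x : 1 ℕ.≤ x) where

    -- Γ (isqrt x) stands for its limit, so that no limit has to be constructed. In Δ, the term γ / k is traded for
    -- γ ⌊x/k⌋ / x because Σ μ(k) ⌊x/k⌋ = 1 exactly.
    γ : ℚ
    γ = Γ (isqrt x)

    Δ₁ Δ₂ Δ₃ Δ : ℕ → ℚ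
    Δ₁ k = inv k * H (isqrt (x ÷ k))
    Δ₂ k = inv k * H (x ÷ k)
    Δ₃ k = inv x * ⟦ x ÷ k ⟧
    Δ k = Δ₁ k - ½ * Δ₂ k - γ * Δ₃ k

    inv-x : inv x * ⟦ x ⟧ ≡ 1ℚ
    inv-x = inv-inverse 1≤x

    -- Both subtracted sums equal 1 exactly before their coefficients, so they leave only the
    -- constants `½` and `γ * inv x`.
    ∑-μ-Δ : ∑ [1… x ] (λ k → μℚ k * Δ k) ≡ ∑ [1… x ] (λ k → μ/ k * H (isqrt (x ÷ k))) - ½ - γ * inv x
    ∑-μ-Δ = trans (∑-cong [1… x ] (λ k _ → expand (μℚ k) (inv k) (H (isqrt (x ÷ k))) (H (x ÷ k)) γ (inv x) ⟦ x ÷ k ⟧))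
      (trans (∑-- [1… x ] (λ k → a k - ½ * b k) (λ k → γ * inv x * d k))
        (cong₂ _-_ (trans (∑-- [1… x ] a (λ k → ½ * b k)) (cong (λ t → ∑ [1… x ] a - t) (trans (∑-* [1… x ] ½ b) (trans (cong (½ *_) (∑-μ-H 1≤x)) (ℚ.*-identityʳ ½)))))
          (trans (∑-* [1… x ] (γ * inv x) d) (trans (cong (γ * inv x *_) (∑-μ-floor 1≤x)) (ℚ.*-identityʳ (γ * inv x))))))
      where
      a b d : ℕ → ℚ
      a k = μ/ k * H (isqrt (x ÷ k))
      b k = μ/ k * H (x ÷ k)
      d k = μℚ k * ⟦ x ÷ k ⟧
      expand : ∀ m i h h′ γ z v → m * (i * h - ½ * (i * h′) - γ * (z * v)) ≡ m * i * h - ½ * (m * i * h′) - γ * z * (m * v)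
      expand = Solver.solve-∀ ring

    -- Let `N = isqrt (x ÷ k)`. The deviation of `δH` from `γ` gives `3 / (k N)`, and `x ≤ 4 N² k`
    -- turns `1 / (k N)` into `4 N / x`, a form that `∑-isqrt` can sum. Trading `γ / k` for
    -- `γ ⌊x/k⌋ / x` adds at most `3 / x`.
    ∣Δ∣≤ : ∀ k → 1 ℕ.≤ k → k ℕ.≤ x → ∣ Δ k ∣ ≤ 3ℚ * (4ℚ * (inv x * ⟦ isqrt (x ÷ k) ⟧)) + 3ℚ * inv x
    ∣Δ∣≤ k 1≤k k≤x = ≤-resp (cong ∣_∣ (sym (regroup (inv k) (H (isqrt v)) (H v) γ (inv x) ⟦ v ⟧))) refl
        (∣∣-triangle {inv k * (δH v - γ)} {γ * (inv k - inv x * ⟦ v ⟧)}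
          deviation
          (∣∣-*-≤ {γ} {inv k - inv x * ⟦ v ⟧} (∣Γ∣≤3 (isqrt x) (1≤isqrt 1≤x)) fraction))
      where
      v = x ÷ k
      N = isqrt v
      1≤v : 1 ℕ.≤ v
      1≤v = *≤⇒≤÷ 1≤k (ℕ.≤-trans (ℕ.≤-reflexive (ℕ.*-identityˡ k)) k≤x)
      1≤N : 1 ℕ.≤ N
      1≤N = 1≤isqrt 1≤v
      regroup : ∀ i h h′ γ z v → i * h - ½ * (i * h′) - γ * (z * v) ≡ i * (h - ½ * h′ - γ) + γ * (i - z * v)
      regroup = Solver.solve-∀ ring
      x≤ : x ℕ.≤ N ℕ.* (k ℕ.* (N ℕ.* 4))
      x≤ = begin
        x                                  ≤⟨ ℕ.<⇒≤ (<÷-* x 1≤k) ⟩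
        suc v ℕ.* k                        ≤⟨ ℕ.*-monoˡ-≤ k (ℕ.≤-trans (isqrt-upper v) (ℕ.*-mono-≤ (ℕ.+-monoˡ-≤ N 1≤N) (ℕ.+-monoˡ-≤ N 1≤N))) ⟩
        (N ℕ.+ N) ℕ.* (N ℕ.+ N) ℕ.* k      ≡⟨ eq₁ N k ⟩
        N ℕ.* (k ℕ.* (N ℕ.* 4))            ∎
        where
        open ℕ.≤-Reasoning
        eq₁ : ∀ n k → (n ℕ.+ n) ℕ.* (n ℕ.+ n) ℕ.* k ≡ n ℕ.* (k ℕ.* (n ℕ.* 4))
        eq₁ = ℕ-Solver.solve-∀
      ⟦4⟧ : ⟦ 4 ⟧ ≡ 4ℚ
      ⟦4⟧ = trans (⟦⟧-+ 2 2) (cong₂ _+_ ⟦2⟧ ⟦2⟧)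
        where
        ⟦2⟧ : ⟦ 2 ⟧ ≡ 2ℚ
        ⟦2⟧ = trans (⟦⟧-+ 1 1) (cong₂ _+_ ι1 ι1)
      small : inv k * inv N ≤ inv x * (⟦ N ⟧ * 4ℚ)
      small = ≤inv* 1≤x (≤-resp (comm (inv k) (inv N) ⟦ x ⟧) (trans (⟦⟧-* N 4) (cong (⟦ N ⟧ *_) ⟦4⟧))
          (inv*≤ 1≤k (inv*≤ 1≤N (subst (⟦ x ⟧ ≤_) (trans (⟦⟧-* N (k ℕ.* (N ℕ.* 4))) (cong (⟦ N ⟧ *_) (⟦⟧-* k (N ℕ.* 4)))) (⟦⟧-mono x≤)))))
        where
        comm : ∀ a b c → a * (b * c) ≡ c * (a * b)
        comm = Solver.solve-∀ ring
      eq : ∀ i j z n → 3ℚ * (4ℚ * (z * n)) - i * (3ℚ * j) ≡ 3ℚ * (z * (n * 4ℚ) - i * j)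
      eq = Solver.solve-∀ ring
      deviation : ∣ inv k * (δH v - γ) ∣ ≤ 3ℚ * (4ℚ * (inv x * ⟦ N ⟧))
      deviation = ℚ.≤-trans (∣∣-*-≤ {inv k} {δH v - γ} (ℚ.≤-reflexive (ℚ.0≤p⇒∣p∣≡p (0≤inv k))) (δH≈γ 1≤v (÷≤ x k)))
        (by-diff (0≤* 0≤3 (diff small)) (eq (inv k) (inv N) (inv x) ⟦ N ⟧))
      fraction : ∣ inv k - inv x * ⟦ v ⟧ ∣ ≤ inv x
      fraction = ≤-resp (sym (ℚ.0≤p⇒∣p∣≡p (diff below))) refl (by-diff (diff above) (eq₂ (inv x) ⟦ v ⟧ (inv k)))
        where
        eq₂ : ∀ z v i → z - (i - z * v) ≡ z * (1ℚ + v) - i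
        eq₂ = Solver.solve-∀ ring
        below : inv x * ⟦ v ⟧ ≤ inv k
        below = inv*≤ 1≤x (subst (⟦ v ⟧ ≤_) (ℚ.*-comm (inv k) ⟦ x ⟧) (÷≤ℚ x 1≤k))
        above : inv k ≤ inv x * (1ℚ + ⟦ v ⟧)
        above = ≤inv* 1≤x (subst (_≤ 1ℚ + ⟦ v ⟧) (ℚ.*-comm (inv k) ⟦ x ⟧) (≤÷+1ℚ x 1≤k))

    module _ {J : ℕ} (1≤J : 1 ℕ.≤ J) where

      K y l : ℕ
      K = J ℕ.* J
      y = x ÷ K
      l = x ℕ.∸ y

      1≤K : 1 ℕ.≤ K
      1≤K = ℕ.*-mono-≤ 1≤J 1≤J

      -- `∑-isqrt` is cut at the same `J` that defines `y`: as `y ≤ x / J²`, both of its terms are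
      -- at most `x / J`.
      small-k : ∣ ∑ [1… y ] (λ k → μℚ k * Δ k) ∣ ≤ 27ℚ * inv J
      small-k = ℚ.≤-trans (∑-abs-≤ [1… y ] {λ k → μℚ k * Δ k} {λ k → 3ℚ * 4ℚ * inv x * ⟦ isqrt (x ÷ k) ⟧ + 3ℚ * inv x} term)
          (subst (_≤ 27ℚ * inv J) (sym total) (bound (inv x) ⟦ x ⟧ ⟦ y ⟧ ⟦ J ⟧ (inv J) (inv K) (∑ [1… y ] (λ k → ⟦ isqrt (x ÷ k) ⟧))
            inv-x (trans (cong (_* ⟦ J ⟧) (inv-* 1≤J 1≤J)) (trans (ℚ.*-assoc (inv J) (inv J) ⟦ J ⟧) (trans (cong (inv J *_) (inv-inverse 1≤J)) (ℚ.*-identityʳ (inv J)))))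
            (0≤inv x) (0≤⟦⟧ J) (inv-antitone 1≤J (subst (ℕ._≤ K) (ℕ.*-identityʳ J) (ℕ.*-monoʳ-≤ J 1≤J))) (÷≤ℚ x 1≤K) (∑-isqrt x y J 1≤J)))
        where
        assoc : ∀ z n → 1ℚ * (3ℚ * (4ℚ * (z * n)) + 3ℚ * z) ≡ 3ℚ * 4ℚ * z * n + 3ℚ * z
        assoc = Solver.solve-∀ ring
        term : ∀ k → k ∈ [1… y ] → ∣ μℚ k * Δ k ∣ ≤ 3ℚ * 4ℚ * inv x * ⟦ isqrt (x ÷ k) ⟧ + 3ℚ * inv x
        term k k∈ = subst (∣ μℚ k * Δ k ∣ ≤_) (assoc (inv x) ⟦ isqrt (x ÷ k) ⟧)
          (∣∣-*-≤ {μℚ k} {Δ k} (∣μ∣≤1 1≤k) (∣Δ∣≤ k 1≤k (ℕ.≤-trans (proj₂ (∈[1…]⁻ y k∈)) (÷≤ x K))))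
          where
          1≤k : 1 ℕ.≤ k
          1≤k = proj₁ (∈[1…]⁻ y k∈)
        total : ∑ [1… y ] (λ k → 3ℚ * 4ℚ * inv x * ⟦ isqrt (x ÷ k) ⟧ + 3ℚ * inv x) ≡ 3ℚ * 4ℚ * inv x * ∑ [1… y ] (λ k → ⟦ isqrt (x ÷ k) ⟧) + ⟦ y ⟧ * (3ℚ * inv x)
        total = trans (∑-+ [1… y ] (λ k → 3ℚ * 4ℚ * inv x * ⟦ isqrt (x ÷ k) ⟧) (λ _ → 3ℚ * inv x)) (cong₂ _+_ (∑-* [1… y ] (3ℚ * 4ℚ * inv x) (λ k → ⟦ isqrt (x ÷ k) ⟧))
          (trans (∑-const [1… y ] (3ℚ * inv x)) (cong (λ t → ⟦ t ⟧ * (3ℚ * inv x)) (length-[1…] y))))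
        bound : ∀ z X y J i k s → z * X ≡ 1ℚ → k * J ≡ i → 0ℚ ≤ z → 0ℚ ≤ J → k ≤ i → y ≤ k * X → s ≤ y * J + X * i → 3ℚ * 4ℚ * z * s + y * (3ℚ * z) ≤ 27ℚ * i
        bound z X y J i k s zX kJ 0≤z 0≤J k≤i hy hs = by-diff (0≤+ (0≤* (0≤* (0≤* 0≤3 0≤4) 0≤z) (diff hs)) (0≤+ (0≤* (0≤* (0≤* (0≤* 0≤3 0≤4) 0≤z) 0≤J) (diff hy))
              (0≤+ (0≤* (0≤* 0≤3 0≤z) (diff hy)) (0≤* 0≤3 (diff k≤i)))))
            (trans (eq z X y J i k s) (trans (+-vanish (3ℚ * 4ℚ * z * X) (sym kJ)) (+-vanish ((3ℚ * 4ℚ + 3ℚ * 4ℚ) * i + 3ℚ * k) (sym zX))))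
          where
          eq : ∀ z X y J i k s → 27ℚ * i - (3ℚ * 4ℚ * z * s + y * (3ℚ * z)) ≡
            3ℚ * 4ℚ * z * (y * J + X * i - s) + (3ℚ * 4ℚ * z * J * (k * X - y) + (3ℚ * z * (k * X - y) + 3ℚ * (i - k)))
              + ((3ℚ * 4ℚ + 3ℚ * 4ℚ) * i + 3ℚ * k) * (1ℚ - z * X) + 3ℚ * 4ℚ * z * X * (i - k * J)
          eq = Solver.solve-∀ ring

      module _ {e X₀ : ℕ} (mean : ∀ X → X₀ ℕ.≤ X → ⟦ 2 ℕ.^ e ⟧ * ∣ ∑ [1… X ] μℚ ∣ ≤ 4ℚ * ⟦ X ⟧)
               (X₀≤y : X₀ ℕ.≤ y) (e-large : J ℕ.* (K ℕ.* K) ℕ.≤ 2 ℕ.^ e) (J≤x : J ℕ.≤ x) where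

        private
          y+l : y ℕ.+ l ≡ x
          y+l = ℕ.m+[n∸m]≡n (÷≤ x K)

          η : ℚ
          η = inv (2 ℕ.^ e) * (4ℚ * ⟦ x ⟧)

          0≤η : 0ℚ ≤ η
          0≤η = 0≤* (0≤inv (2 ℕ.^ e)) (0≤* 0≤4 (0≤⟦⟧ x))

          M≤η : ∀ k → y ℕ.≤ k → k ℕ.≤ y ℕ.+ l → ∣ ∑ [1… k ] μℚ ∣ ≤ η
          M≤η k y≤k k≤ = ≤inv* (1≤2^ e) (ℚ.≤-trans (mean k (ℕ.≤-trans X₀≤y y≤k)) (by-diff (0≤* 0≤4 (diff (⟦⟧-mono (subst (k ℕ.≤_) y+l k≤)))) (eq ⟦ x ⟧ ⟦ k ⟧)))
            where
            eq : ∀ a b → 4ℚ * a - 4ℚ * b ≡ 4ℚ * (a - b)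
            eq = Solver.solve-∀ ring

          -- A common bound for the three pieces at `k = y + 1`, where `1/k ≤ K/x` and `x ÷ k ≤ K`,
          -- together with `H v ≤ v`.
          β : ℚ
          β = inv x * ⟦ K ⟧ * ⟦ K ⟧

          v≤K : x ÷ suc y ℕ.≤ K
          v≤K = ℕ.<⇒≤ (ℕ.*-cancelʳ-< (suc y) (x ÷ suc y) K (ℕ.≤-<-trans (÷-*≤ x (suc y)) (subst (x ℕ.<_) (ℕ.*-comm (suc y) K) (<÷-* x 1≤K))))

          inv-y : inv (suc y) ≤ inv x * ⟦ K ⟧
          inv-y = ≤inv* 1≤x (subst (_≤ ⟦ K ⟧) (ℚ.*-comm (inv (suc y)) ⟦ x ⟧) (inv*≤ (s≤s z≤n) (subst (⟦ x ⟧ ≤_) (⟦⟧-* (suc y) K) (⟦⟧-mono (ℕ.<⇒≤ (<÷-* x 1≤K))))))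

          isqrt≤ : ∀ v → isqrt v ℕ.≤ v
          isqrt≤ v = ℕ.≤-trans (r≤r² (isqrt v)) (isqrt-lower v)
            where
            r≤r² : ∀ r → r ℕ.≤ r ℕ.* r
            r≤r² zero = z≤n
            r≤r² r@(suc _) = ℕ.m≤m*n r r

          H≤K : ∀ {v} → v ℕ.≤ K → H v ≤ ⟦ K ⟧
          H≤K {v} h = ℚ.≤-trans (H≤ v) (⟦⟧-mono h)

          -- `Δ` combines decreasing functions with signs, so Abel summation is applied to each
          -- piece separately.
          part : (φ : ℕ → ℚ) → (∀ k → 1 ℕ.≤ k → φ (suc k) ≤ φ k) → (∀ k → 0ℚ ≤ φ k) → φ (suc y) ≤ β →
            ∣ ∑ [1… l ] (λ k → μℚ (y ℕ.+ k) * φ (y ℕ.+ k)) ∣ ≤ η * (2ℚ * β)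
          part φ anti 0≤φ φ≤β = ℚ.≤-trans (abel μℚ φ y anti 0≤φ η l M≤η) (by-diff (0≤* 0≤η (0≤* 0≤2 (diff φ≤β))) (eq η β (φ (suc y))))
            where
            eq : ∀ e b f → e * (2ℚ * b) - e * (2ℚ * f) ≡ e * (2ℚ * (b - f))
            eq = Solver.solve-∀ ring

          sum : (ℕ → ℚ) → ℚ
          sum φ = ∑ [1… l ] (λ k → μℚ (y ℕ.+ k) * φ (y ℕ.+ k))

          part₁ : ∣ sum Δ₁ ∣ ≤ η * (2ℚ * β)
          part₁ = part Δ₁ (λ k 1≤k → *-mono-≤ (0≤inv (suc k)) (0≤H (isqrt (x ÷ suc k))) (inv-antitone 1≤k (ℕ.n≤1+n k)) (H-mono (isqrt-mono (÷-antitone x 1≤k))))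
            (λ k → 0≤* (0≤inv k) (0≤H (isqrt (x ÷ k)))) (*-mono-≤ (0≤inv (suc y)) (0≤H (isqrt (x ÷ suc y))) inv-y (H≤K (ℕ.≤-trans (isqrt≤ (x ÷ suc y)) v≤K)))

          part₂ : ∣ sum Δ₂ ∣ ≤ η * (2ℚ * β)
          part₂ = part Δ₂ (λ k 1≤k → *-mono-≤ (0≤inv (suc k)) (0≤H (x ÷ suc k)) (inv-antitone 1≤k (ℕ.n≤1+n k)) (H-mono (÷-antitone x 1≤k)))
            (λ k → 0≤* (0≤inv k) (0≤H (x ÷ k))) (*-mono-≤ (0≤inv (suc y)) (0≤H (x ÷ suc y)) inv-y (H≤K v≤K))

          part₃ : ∣ sum Δ₃ ∣ ≤ η * (2ℚ * β)
          part₃ = part Δ₃ (λ k 1≤k → *-mono-≤ (0≤inv x) (0≤⟦⟧ (x ÷ suc k)) ℚ.≤-refl (⟦⟧-mono (÷-antitone x 1≤k)))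
            (λ k → 0≤* (0≤inv x) (0≤⟦⟧ (x ÷ k)))
            (by-diff (0≤+ (0≤* (0≤inv x) (diff (⟦⟧-mono v≤K))) (0≤* (0≤* (0≤inv x) (0≤⟦⟧ K)) (diff (1≤⟦⟧ 1≤K)))) (eq (inv x) ⟦ K ⟧ ⟦ x ÷ suc y ⟧))
            where
            eq : ∀ z k v → z * k * k - z * v ≡ z * (k - v) + z * k * (k - 1ℚ)
            eq = Solver.solve-∀ ring

          split : sum Δ ≡ sum Δ₁ - ½ * sum Δ₂ - γ * sum Δ₃
          split = trans (∑-cong [1… l ] (λ k _ → expand (μℚ (y ℕ.+ k)) (Δ₁ (y ℕ.+ k)) (Δ₂ (y ℕ.+ k)) (Δ₃ (y ℕ.+ k)) γ))
            (trans (∑-- [1… l ] (λ k → m₁ k - ½ * m₂ k) (λ k → γ * m₃ k)) (cong₂ _-_ (trans (∑-- [1… l ] m₁ (λ k → ½ * m₂ k)) (cong (λ t → sum Δ₁ - t) (∑-* [1… l ] ½ m₂))) (∑-* [1… l ] γ m₃)))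
            where
            m₁ m₂ m₃ : ℕ → ℚ
            m₁ k = μℚ (y ℕ.+ k) * Δ₁ (y ℕ.+ k)
            m₂ k = μℚ (y ℕ.+ k) * Δ₂ (y ℕ.+ k)
            m₃ k = μℚ (y ℕ.+ k) * Δ₃ (y ℕ.+ k)
            expand : ∀ m a b d γ → m * (a - ½ * b - γ * d) ≡ m * a - ½ * (m * b) - γ * (m * d)
            expand = Solver.solve-∀ ring

        -- Each piece is at most `8 K² / 2 ^ e`, and they enter with coefficients 1, 1/2 and `γ`,
        -- where `∣ γ ∣ ≤ 3`. The hypothesis `e-large` makes `K² / 2 ^ e` at most `1 / J`.
        large-k : ∣ sum Δ ∣ ≤ 36ℚ * inv J
        large-k = ℚ.≤-trans (subst (λ s → ∣ s ∣ ≤ τ + ½ * τ + 3ℚ * τ) (sym split) (ℚ.≤-trans (ℚ.∣p-q∣≤∣p∣+∣q∣ (sum Δ₁ - ½ * sum Δ₂) (γ * sum Δ₃))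
            (ℚ.+-mono-≤ (ℚ.≤-trans (ℚ.∣p-q∣≤∣p∣+∣q∣ (sum Δ₁) (½ * sum Δ₂)) (ℚ.+-mono-≤ part₁ (∣∣-*-≤ {½} {sum Δ₂} ℚ.≤-refl part₂)))
              (∣∣-*-≤ {γ} {sum Δ₃} (∣Γ∣≤3 (isqrt x) (1≤isqrt 1≤x)) part₃))))
            (by-diff (0≤* 0≤36 (diff K²≤)) (trans (eq (inv (2 ℕ.^ e)) ⟦ x ⟧ (inv x) ⟦ K ⟧ (inv J)) (+-vanish (36ℚ * (inv (2 ℕ.^ e) * (⟦ K ⟧ * ⟦ K ⟧))) (sym inv-x))))
          where
          τ : ℚ
          τ = η * (2ℚ * β)
          0≤36 : 0ℚ ≤ 36ℚ
          0≤36 = ℚ.nonNegative⁻¹ 36ℚ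
          K²≤ : inv (2 ℕ.^ e) * (⟦ K ⟧ * ⟦ K ⟧) ≤ inv J
          K²≤ = inv*≤ (1≤2^ e) (subst (⟦ K ⟧ * ⟦ K ⟧ ≤_) (ℚ.*-comm (inv J) ⟦ 2 ℕ.^ e ⟧) (≤inv* 1≤J
            (subst (_≤ ⟦ 2 ℕ.^ e ⟧) (trans (⟦⟧-* J (K ℕ.* K)) (cong (⟦ J ⟧ *_) (⟦⟧-* K K))) (⟦⟧-mono e-large))))
          eq : ∀ w X z k j → 36ℚ * j - (w * (4ℚ * X) * (2ℚ * (z * k * k)) + ½ * (w * (4ℚ * X) * (2ℚ * (z * k * k))) + 3ℚ * (w * (4ℚ * X) * (2ℚ * (z * k * k))))
            ≡ 36ℚ * (j - w * (k * k)) + 36ℚ * (w * (k * k)) * (1ℚ - z * X)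
          eq = Solver.solve-∀ ring

        main-bound : ∣ ∑ [1… x ] (λ k → μ/ k * H (isqrt (x ÷ k))) - ½ ∣ ≤ 66ℚ * inv J
        main-bound = ≤-resp (cong ∣_∣ recombine) refl (ℚ.≤-trans
            (∣∣-triangle {∑ [1… y ] m + sum Δ} {γ * inv x} (∣∣-triangle {∑ [1… y ] m} {sum Δ} small-k large-k) (∣∣-*-≤ {γ} {inv x} (∣Γ∣≤3 (isqrt x) (1≤isqrt 1≤x)) (ℚ.≤-reflexive (ℚ.0≤p⇒∣p∣≡p (0≤inv x)))))
            (by-diff (0≤* 0≤3 (diff (inv-antitone 1≤J J≤x))) (eq (inv J) (inv x))))
          where
          m : ℕ → ℚ
          m k = μℚ k * Δ k
          eq : ∀ j z → 66ℚ * j - (27ℚ * j + 36ℚ * j + 3ℚ * z) ≡ 3ℚ * (j - z)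
          eq = Solver.solve-∀ ring
          cancel : ∀ c h z → c - h - z + z ≡ c - h
          cancel = Solver.solve-∀ ring
          recombine : ∑ [1… y ] m + sum Δ + γ * inv x ≡ ∑ [1… x ] (λ k → μ/ k * H (isqrt (x ÷ k))) - ½
          recombine = trans (cong (_+ γ * inv x) (trans (sym (∑-split y l m)) (trans (cong (λ t → ∑ [1… t ] m) y+l) ∑-μ-Δ))) (cancel (∑ [1… x ] (λ k → μ/ k * H (isqrt (x ÷ k)))) ½ (γ * inv x))

  open MeanZero μℚ ∣μ∣≤1 (λ {p} {n} pr 1≤n p∤n → trans (cong ι (μ-prime-* pr 1≤n p∤n)) (ι-neg (μ n))) using (mean-value-zero)

  small-error : ∀ ε → 0ℚ < ε → ∃ λ J → 1 ℕ.≤ J × 66ℚ * inv J < ε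
  small-error ε 0<ε = proj₁ small , proj₁ (proj₂ small) , ℚ.≤-<-trans (by-diff (0≤* 0≤66 (diff (proj₂ (proj₂ small)))) (eq ε (inv (proj₁ small))))
      (subst (ε * ½ <_) (ℚ.*-identityʳ ε) (ℚ.*-monoʳ-<-pos ε {{ℚ.positive 0<ε}} ½<1))
    where
    -- Half of 1/66, so that the error is at most `ε / 2` and the final inequality is strict.
    ρ : ℚ
    ρ = ℤ.+ 1 ℚ./ 132
    small : ∃ λ J → 1 ℕ.≤ J × inv J ≤ ε * ρ
    small = archimedes (ε * ρ) (ℚ.positive⁻¹ (ε * ρ) {{ℚ.pos*pos⇒pos ε {{ℚ.positive 0<ε}} ρ}})
    ½<1 : ½ < 1ℚ
    ½<1 = from-yes (½ ℚ.<? 1ℚ)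
    0≤66 : 0ℚ ≤ 66ℚ
    0≤66 = ℚ.nonNegative⁻¹ 66ℚ
    eq : ∀ ε j → ε * ½ - 66ℚ * j ≡ 66ℚ * (ε * (ℤ.+ 1 ℚ./ 132) - j)
    eq = Solver.solve-∀ ring

  partialSum-error : (c : ℕ → ℤ) → (∀ m k → SquareFree k → c (m ℕ.* m ℕ.* k) ≡ (ℤ.+ m) ℤ.* μ k) →
    ∀ J → 1 ℕ.≤ J → ∃ λ N → ∀ n → N ℕ.≤ n → ∣ partialSum c n - ½ ∣ ≤ 66ℚ * inv J
  -- `X₀ * J²` puts the cut `n ÷ J²` beyond `X₀`, so the mean value bound holds on the whole upper
  -- range; adding `J` gives `1/n ≤ 1/J`.
  partialSum-error c c-spec J 1≤J = X₀ ℕ.* J² ℕ.+ J , λ n N≤n →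
      subst (λ s → ∣ s - ½ ∣ ≤ 66ℚ * inv J) (sym (partialSum≡ c c-spec n))
        (main-bound (ℕ.≤-trans 1≤J (J≤ N≤n)) 1≤J {e} {X₀} (proj₂ (mean-value-zero e))
          (*≤⇒≤÷ (ℕ.*-mono-≤ 1≤J 1≤J) (ℕ.≤-trans (ℕ.m≤m+n (X₀ ℕ.* J²) J) N≤n)) (n≤2^n e) (J≤ N≤n))
    where
    J² e X₀ : ℕ
    J² = J ℕ.* J
    -- By `n ≤ 2 ^ n`, this generous choice is the hypothesis `e-large`.
    e = J ℕ.* (J² ℕ.* J²)
    X₀ = proj₁ (mean-value-zero e)
    J≤ : ∀ {n} → X₀ ℕ.* J² ℕ.+ J ℕ.≤ n → J ℕ.≤ n
    J≤ = ℕ.≤-trans (ℕ.m≤n+m J (X₀ ℕ.* J²))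

open import Data.Nat as ℕ using (ℕ; _*_; _≤_)
open import Data.Integer as ℤ using (ℤ; +_)
open import Data.Rational as ℚ using (ℚ; ½; ∣_∣)
open import Data.Product using (∃)
open import Relation.Binary.PropositionalEquality using (_≡_)

theorem4p1 : (c : ℕ → ℤ)
    → (∀ m k → SquareFree k → c (m * m * k) ≡ (+ m) ℤ.* μ k)
    → ∀ (ε : ℚ) → ℚ.0ℚ ℚ.< ε
    → ∃ λ N → ∀ n → N ≤ n → ∣ partialSum c n ℚ.- ½ ∣ ℚ.< ε
theorem4p1 c c-spec ε 0<ε =
  let J , 1≤J , small = Summation.small-error ε 0<ε
      N , bound = Summation.partialSum-error c c-spec J 1≤J
  in N , λ n N≤n → ℚ.≤-<-trans (bound n N≤n) small
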